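{- Let $P=[n_1]+[n_2]+\cdots+[n_k]$ be a disjoint union of chains on $[n]$, $n=n_1+\cdots+n_k$, whose elements are labeled consecutively within chains (the $i$-th chain is $N_i+1\prec N_i+2\prec\cdots\prec N_i+n_i$ with $N_i=n_1+\cdots+n_{i-1}$). Let $M$ be the transition matrix of the promotion graph of $P$ with edge weights given by indeterminates $x_1,\dots,x_n$. Then $$\det(\lambda\mathbb{1}-M)=\lambda\prod_{\substack{\emptyset\subsetneq S\subseteq[n]\\ S\text{ lower set in }P}}(\lambda+x_S)^{\mathfrak{d}_S},$$ where $x_S=\sum_{i\in S}x_i$ and $\mathfrak{d}_S$ is the number of poset derangements of the restriction of $P$ to $S$.
   Context: $\mathcal{L}(P)=\{\pi\in S_n : i\prec j \Rightarrow \pi^{ -1}_i<\pi^{ -1}_j\}$, in one-line notation $\pi=\pi_1\cdots\pi_n$. $\pi\tau_i$ ($1\le i<n$) swaps $\pi_i,\pi_{i+1}$ if they are incomparable and is $\pi$ otherwise; operators act on the right; $\partial_j=\tau_j\cdots\tau_{n-1}$. Promotion graph: vertices $\mathcal{L}(P)$, an edge $\pi\to\pi\partial_j$ of weight $x_{\pi_j}$ for each $\pi$, $j\in[n]$. Transition matrix $M$: for $\pi'\ne\pi$, $M(\pi',\pi)$ is the sum of weights of edges $\pi\to\pi'$; $M(\pi,\pi)$ is minus the sum of weights of edges $\pi\to\pi'$ with $\pi'\ne\pi$. A lower set $S$ satisfies $x\in S,\ y\preceq x\Rightarrow y\in S$. A poset derangement of a poset $Q$ labeled by $[m]$ is a linear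 extension $\pi$ of $Q$ with $\pi_j\ne j$ for all $j$. For a lower set $S$, the restriction $P|_S$ is relabeled by $[|S|]$ via the unique order-preserving bijection of integer labels $S\to[|S|]$ (it is again a union of chains labeled consecutively within chains), and $\mathfrak{d}_S$ is its number of poset derangements. -}

module Defs where

open import Level using (0ℓ)
open import Algebra.Bundles using (CommutativeRing; Semiring)
open import Data.Bool.Base using (if_then_else_)
open import Data.Fin.Base using (Fin; zero; suc; toℕ; punchIn; splitAt; _≤_; _<_)
open import Data.Fin.Properties
  using (_≟_; _≤?_; _<?_; all?; suc-injective; ≤-refl; ≤-trans; ≤-antisym)
open import Data.Fin.Subset using (Subset; inside; outside; ∣_∣) renaming (_∈_ to _∈ˢ_)
open import Data.Fin.Subset.Properties using (_∈?_; nonempty?)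
open import Data.List.Base as List using (List; []; _∷_; allFin; cartesianProductWith; drop; filter; foldl; length)
open import Data.Nat.Base using (ℕ; zero; suc)
open import Data.Product.Base using (_×_; _,_)
open import Data.Sum.Base using ([_,_]′)
open import Data.Vec.Base using (Vec; []; _∷_; lookup; sum)
open import Data.Vec.Properties using (≡-dec)
open import Data.Vec.Relation.Unary.AllPairs using (allPairs?)
open import Data.Vec.Relation.Unary.Unique.Propositional using (Unique)
open import Function.Base using (_∘_; const)
open import Relation.Binary.Core using (Rel)
open import Relation.Binary.Definitions using (Decidable)
open import Relation.Binary.PropositionalEquality
  using (_≡_; _≢_; refl; sym; trans; cong; isEquivalence)
open import Relation.Binary.Structures using (IsDecPartialOrder)
import Relation.Binary.Construct.NonStrictToStrict as Strict
open import Relation.Nullary.Decidable using (does; ¬?; _×-dec_; _→-dec_)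
open import Relation.Nullary.Negation using (¬_)
import Relation.Unary as U

-- Elements of [n], word positions and chains are all indexed from 0: the
-- element i of [n] is the inhabitant of Fin n whose toℕ is i - 1.

record LabelledPoset (n : ℕ) : Set₁ where
  infix 4 _≼_
  field
    _≼_               : Rel (Fin n) 0ℓ
    isDecPartialOrder : IsDecPartialOrder _≡_ _≼_

  open IsDecPartialOrder isDecPartialOrder public
    using () renaming (refl to ≼-refl; trans to ≼-trans; antisym to ≼-antisym; _≤?_ to _≼?_)

  open Strict _≡_ _≼_ public using () renaming (_<_ to _≺_)

  _≺?_ : Decidable _≺_
  _≺?_ = Strict.<-decidable _≡_ _≼_ _≟_ _≼?_

  Incomparable : Rel (Fin n) 0ℓ
  Incomparable a b = ¬ (a ≼ b) × ¬ (b ≼ a)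

  incomparable? : Decidable Incomparable
  incomparable? a b = ¬? (a ≼? b) ×-dec ¬? (b ≼? a)

  IsLower : Subset n → Set
  IsLower S = ∀ x y → x ∈ˢ S → y ≼ x → y ∈ˢ S

  isLower? : U.Decidable IsLower
  isLower? S = all? λ x → all? λ y → (x ∈? S) →-dec ((y ≼? x) →-dec (y ∈? S))

-- Disjoint unions of chains, labelled consecutively within chains.

-- splitAt m sends the first m labels to the first chain, and renumbers the
-- remaining ones from 0.
chainOf : ∀ {k} (ns : Vec ℕ k) → Fin (sum ns) → Fin k
chainOf (m ∷ ns) i = [ const zero , suc ∘ chainOf ns ]′ (splitAt m i)

chains : ∀ {k} (ns : Vec ℕ k) → LabelledPoset (sum ns)
chains ns = record
  { _≼_               = λ i j → chainOf ns i ≡ chainOf ns j × i ≤ j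
  ; isDecPartialOrder = record
    { isPartialOrder = record
      { isPreorder = record
        { isEquivalence = isEquivalence
        ; reflexive     = λ { refl → refl , ≤-refl }
        ; trans         = λ { (p , i≤j) (q , j≤k) → trans p q , ≤-trans i≤j j≤k }
        }
      ; antisym = λ { (_ , i≤j) (_ , j≤i) → ≤-antisym i≤j j≤i }
      }
    ; _≟_  = _≟_
    ; _≤?_ = λ i j → (chainOf ns i ≟ chainOf ns j) ×-dec (i ≤? j)
    }
  }

-- Restriction to a subset.

-- The increasing enumeration of S, i.e. the inverse of the order-preserving
-- bijection of labels S → [|S|].
embed : ∀ {n} (S : Subset n) → Fin ∣ S ∣ → Fin n
embed (outside ∷ S) i       = suc (embed S i)
embed (inside  ∷ S) zero    = zero
embed (inside  ∷ S) (suc i) = suc (embed S i)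

embed-injective : ∀ {n} (S : Subset n) {i j} → embed S i ≡ embed S j → i ≡ j
embed-injective (outside ∷ S)                 eq = embed-injective S (suc-injective eq)
embed-injective (inside  ∷ S) {zero}  {zero}  eq = refl
embed-injective (inside  ∷ S) {suc i} {suc j} eq =
  cong suc (embed-injective S (suc-injective eq))

_∣ₚ_ : ∀ {n} → LabelledPoset n → (S : Subset n) → LabelledPoset ∣ S ∣
P ∣ₚ S = record
  { _≼_               = λ i j → embed S i ≼ embed S j
  ; isDecPartialOrder = record
    { isPartialOrder = record
      { isPreorder = record
        { isEquivalence = isEquivalence
        ; reflexive     = λ { refl → ≼-refl }
        ; trans         = ≼-trans
        }
      ; antisym = λ p q → embed-injective S (≼-antisym p q)
      }
    ; _≟_  = _≟_
    ; _≤?_ = λ i j → embed S i ≼? embed S j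
    }
  }
  where open LabelledPoset P

allVecs : ∀ {A : Set} → List A → (m : ℕ) → List (Vec A m)
allVecs as zero    = [] ∷ []
allVecs as (suc m) = cartesianProductWith _∷_ as (allVecs as m)

-- A permutation of [n] in one-line notation is a word of length n in the
-- alphabet [n] without repeated letters.
Word : ℕ → Set
Word n = Vec (Fin n) n

module _ {n : ℕ} (P : LabelledPoset n) where
  open LabelledPoset P

  -- "i ≺ j implies π⁻¹ᵢ < π⁻¹ⱼ", with i and j written as π_p and π_q, so that
  -- p and q are their positions in π.
  IsLinearExtension : Word n → Set
  IsLinearExtension π = Unique π × (∀ p q → lookup π p ≺ lookup π q → p < q)

  isLinearExtension? : U.Decidable IsLinearExtension
  isLinearExtension? π =
    allPairs? (λ a b → ¬? (a ≟ b)) π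
      ×-dec all? λ p → all? λ q → (lookup π p ≺? lookup π q) →-dec (p <? q)

  linearExtensions : List (Word n)
  linearExtensions = filter isLinearExtension? (allVecs (allFin n) n)

  IsPosetDerangement : Word n → Set
  IsPosetDerangement π = IsLinearExtension π × (∀ j → lookup π j ≢ j)

  isPosetDerangement? : U.Decidable IsPosetDerangement
  isPosetDerangement? π = isLinearExtension? π ×-dec all? λ j → ¬? (lookup π j ≟ j)

  #posetDerangements : ℕ
  #posetDerangements = length (filter isPosetDerangement? (allVecs (allFin n) n))

  nonemptyLowerSets : List (Subset n)
  nonemptyLowerSets =
    filter (λ S → nonempty? S ×-dec isLower? S) (allVecs (inside ∷ outside ∷ []) n)

  -- Word length is kept separate from the alphabet so that τ is structural;
  -- τ i acts on the letters at positions i and i + 1.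
  τ : ∀ {m} → Fin m → Vec (Fin n) (suc m) → Vec (Fin n) (suc m)
  τ zero    (a ∷ b ∷ w) = if does (incomparable? a b) then b ∷ a ∷ w else a ∷ b ∷ w
  τ (suc i) (a ∷ w)     = a ∷ τ i w

  -- π ∂_j = π τ_j τ_{j+1} ⋯ τ_{n-1}: since the operators act on the right, τ_j
  -- is applied first.
  ∂ : ∀ {m} → Fin m → Vec (Fin n) m → Vec (Fin n) m
  ∂ {suc m} j π = foldl (λ w i → τ i w) π (drop (toℕ j) (allFin m))

_≟ʷ_ : ∀ {n} → Decidable {A = Word n} _≡_
_≟ʷ_ = ≡-dec _≟_

-- The weights x are elements of an arbitrary commutative ring R.  The case of
-- indeterminates is R = ℤ[λ, x₁, …, xₙ].
module OverRing {c ℓ} (R : CommutativeRing c ℓ) where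
  open CommutativeRing R using (Carrier; _*_; _-_; -_; 0#; 1#; semiring)
  open import Algebra.Definitions.RawSemiring (Semiring.rawSemiring semiring) public
    using (_^_) renaming (sum to ∑)

  ∏[_] : ∀ {A : Set} → List A → (A → Carrier) → Carrier
  ∏[ as ] f = List.foldr _*_ 1# (List.map f as)

  Matrix : ℕ → Set c
  Matrix N = Fin N → Fin N → Carrier

  -- Cofactor expansion along the first row.
  det : ∀ {N} → Matrix N → Carrier
  det {zero}  A = 1#
  det {suc N} A =
    ∑ λ j → (- 1#) ^ toℕ j * (A zero j * det λ r s → A (suc r) (punchIn j s))

  scalar : ∀ {N} → Carrier → Matrix N
  scalar t i j = if does (i ≟ j) then t else 0#

  infixl 6 _-ᴹ_
  _-ᴹ_ : ∀ {N} → Matrix N → Matrix N → Matrix N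
  (A -ᴹ B) i j = A i j - B i j

  subsetSum : ∀ {n} → (Fin n → Carrier) → Subset n → Carrier
  subsetSum x S = ∑ λ i → if does (i ∈? S) then x i else 0#

  module _ {n : ℕ} (P : LabelledPoset n) (x : Fin n → Carrier) where

    -- The promotion graph has one edge π → ∂ P j π, of weight x (lookup π j),
    -- for each vertex π and each j; distinct j may give parallel edges or loops.
    entry : Word n → Word n → Carrier
    entry π′ π =
      if does (π′ ≟ʷ π)
      then - ∑ (λ j → if does (∂ P j π ≟ʷ π) then 0# else x (lookup π j))
      else ∑ (λ j → if does (∂ P j π ≟ʷ π′) then x (lookup π j) else 0#)

    transitionMatrix : Matrix (length (linearExtensions P))
    transitionMatrix r s =
      entry (List.lookup (linearExtensions P) r) (List.lookup (linearExtensions P) s)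

{-# OPTIONS --safe #-}
module Submission where

-- A linear extension of a union of chains is a word in the chain labels, and ∂ⱼ moves the j-th letter
-- of the word to its end.  Naming a letter by its chain c and by the number q of earlier letters c, we
-- have t - M = z - A with z = t + Σ xᵢ and A = Σ x_(c,q) T_(c,q), where T_(c,q) moves the letter (c,q).
--
-- Cut a word at its first ascent, then what follows at its first ascent, and so on: this gives a
-- factorisation w = D₁ b₁ D₂ b₂ ⋯ Dᵣ bᵣ U, in which each Dᵢ and U is weakly decreasing and bᵢ exceeds the
-- last letter of Dᵢ.  Let F_w(v) = 1 if v arises from w by rearranging the Dᵢ and U, and 0 otherwise.
-- The matrix E of all F_w(v) is unitriangular for the lexicographic order.  Moreover,
--     F_w(T_(c,q) v) = [(c,q) lies in U] F_w(v) + Σ F_w′(v),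
-- where the w′ arise from w by moving a letter c from U to some Dᵢ.  Hence E (z - A) = (z - L) E with L
-- triangular for a suitable weight, and the determinant is the product over w of t + x_S(w), where S(w)
-- is the set of labels outside U.
--
-- The number of w with S(w) = S is the number of words with content S and empty U.  It agrees with the
-- number of derangements: let Z i be the set of words in which U has no letter below i, or the set of
-- words without fixed point below i.  In both cases #Z i = #Z (i+1) + #Z i, where the last term counts
-- words with one letter i less, since exactly one place is admissible for putting this letter back.

open import Algebra.Bundles using (CommutativeRing)
open import Data.Fin.Base using (Fin)
open import Data.Nat.Base using (ℕ)
open import Data.Vec.Base using (Vec; sum)
open import Defs

open import Level using (Level; _⊔_)
open import Data.Bool.Base using (if_then_else_; true)
import Data.Bool.Properties as Boolₚ
open import Data.Fin.Base as Fin using (zero; suc; toℕ; fromℕ<; inject₁; punchIn; splitAt)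
open import Data.Fin.Induction using (<-weakInduction)
open import Data.Fin.Permutation as Perm using (Permutation′; _⟨$⟩ʳ_; _⟨$⟩ˡ_)
open import Data.Fin.Properties as Finₚ using (_≟_; suc-injective; toℕ<n; toℕ-fromℕ<; toℕ-injective; toℕ-inject₁; punchIn-injective; punchInᵢ≢i)
open import Data.Fin.Subset using (Subset; inside; outside; ⊥) renaming (_∈_ to _∈ˢ_)
import Data.Fin.Subset.Properties as Subsetₚ
open import Data.List.Base as List using (List; []; _∷_; _++_; length; [_]; filter; allFin)
import Data.List.Properties as Listₚ
open import Data.List.Membership.Propositional using (_∈_)
import Data.List.Membership.Propositional.Properties as ∈ₚ
import Data.List.Membership.DecPropositional as DecMembership
open import Data.List.Relation.Binary.Permutation.Propositional as ↭ using (_↭_; ↭-sym; ↭-trans; ↭-refl; prep; swap)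
open import Data.List.Relation.Binary.Permutation.Propositional.Properties as ↭ₚ using (↭-length; Any-resp-↭; ∈-resp-↭; drop-∷; shift; ∷↭∷ʳ; ++⁺ˡ; ++⁺ʳ)
import Data.List.Relation.Binary.Permutation.Setoid.Properties as Permutationₛ
open import Data.List.Relation.Unary.All as All using (All; []; _∷_)
import Data.List.Relation.Unary.All.Properties as Allₚ
open import Data.List.Relation.Unary.AllPairs as AllPairs using (AllPairs; []; _∷_)
import Data.List.Relation.Unary.AllPairs.Properties as AllPairsₚ
open import Data.List.Relation.Unary.Any as Any using (Any; here; there)
import Data.List.Relation.Unary.Any.Properties as Anyₚ
open import Data.List.Relation.Unary.Sorted.TotalOrder.Properties using (Sorted⇒AllPairs)
open import Data.List.Relation.Unary.Unique.Propositional using (Unique)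
import Data.List.Relation.Unary.Unique.Propositional.Properties as Uniqueₚ
import Data.List.Sort
open import Data.Maybe.Base as Maybe using (Maybe; just; nothing; maybe′)
import Data.Maybe.Relation.Unary.All as MaybeAll
open import Data.Nat.Base as ℕ using (zero; suc; z≤n; s≤s)
open import Data.Nat.ListAction using () renaming (sum to sumᴸ)
open import Data.Nat.ListAction.Properties using (sum-++)
import Data.Nat.Properties as ℕₚ
open import Data.Nat.Solver using (module +-*-Solver)
open import Data.Product.Base using (_×_; _,_; proj₁; proj₂; ∃; ∃₂)
open import Data.Sum.Base using (_⊎_; inj₁; inj₂)
open import Data.Unit.Base using (⊤; tt)
open import Data.Vec.Base as Vec using ([]; _∷_; lookup; toList; here; there)
open import Data.Vec.Functional as V using ()
import Data.Vec.Functional.Properties as Vₚ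
import Data.Vec.Properties as Vecₚ
import Data.Vec.Relation.Unary.All as VecAll
import Data.Vec.Relation.Unary.All.Properties as VecAllₚ
import Data.Vec.Relation.Unary.AllPairs as VecAllPairs
import Data.Vec.Relation.Unary.Unique.Propositional.Properties as VecUnique
open import Function.Base using (_∘_; id; const)
import Relation.Binary.Construct.Flip.EqAndOrd as Flip
open import Relation.Binary.Definitions using (tri<; tri≈; tri>)
open import Relation.Binary.PropositionalEquality as ≡ using (_≡_; _≢_)
open import Relation.Nullary.Decidable using (Dec; does; yes; no; ¬?; _×-dec_; _→-dec_; map′)
open import Relation.Nullary.Negation using (¬_; contradiction)
import Relation.Unary as U

-- The weights lie in an arbitrary commutative ring, so neither eigenvectors nor inverse matrices
-- are available. `E` enters only through `det E ≈ 1#` and the product rule for determinants, which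
-- is derived from the uniqueness of alternating multilinear forms.
--
-- The factorisation is chosen to be closed under the moves. Suppose that w matches v after the
-- letter (c,q) of v has gone to the end. If this letter was among the first |D₁| + 1 letters of v,
-- then these letters rearrange D₁ with one c more, and the remainder of v followed by c matches b₁
-- D₂ b₂ ⋯ U. Stripping the final c takes a c out of U; if U is empty, it takes away bᵣ, which must
-- be c, and Dᵣ becomes the new U. A block that has gained a c still contains a letter below its b,
-- so the outcome is again a factorisation of the required kind.
--
-- The two counts at the end are compared through a common recurrence, not by a direct bijection.

module _ {p a} {P : Set p} {A : Set a} {x y : A} where
  if-yes : (P? : Dec P) → P → (if does P? then x else y) ≡ x
  if-yes (yes _) p = ≡.refl
  if-yes (no ¬p) p = contradiction p ¬p

  if-no : (P? : Dec P) → ¬ P → (if does P? then x else y) ≡ y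
  if-no (yes p) ¬p = contradiction p ¬p
  if-no (no _)  ¬p = ≡.refl

-- Determinants over a commutative ring.

module Determinant {c ℓ : Level} (R : CommutativeRing c ℓ) where
  open V using (insertAt; removeAt; updateAt) renaming (_∷_ to _◂_)
  open CommutativeRing R hiding (zero)
  open OverRing R
  open import Algebra.Properties.Semiring.Sum semiring
    using (sum-cong-≋; sum-remove; ∑-distrib-+; ∑-comm; sum-replicate-zero; *-distribˡ-sum; *-distribʳ-sum)
  open import Algebra.Properties.Ring ring using (-1*x≈-x)
  open import Algebra.Solver.Ring.NaturalCoefficients.Default commutativeSemiring
    using (solve; _:=_; _:+_; _:*_)
  open import Relation.Binary.Reasoning.Setoid setoid

  sum-zero : ∀ {n} {f : Fin n → Carrier} → (∀ i → f i ≈ 0#) → ∑ f ≈ 0#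
  sum-zero {n} f≈0 = trans (sum-cong-≋ f≈0) (sum-replicate-zero n)

  sum-single : ∀ {n} i {f : Fin n → Carrier} → (∀ j → j ≢ i → f j ≈ 0#) → ∑ f ≈ f i
  sum-single {suc n} i {f} f≈0 = begin
    ∑ f                      ≈⟨ sum-remove {i = i} f ⟩
    f i + ∑ (removeAt f i)   ≈⟨ +-congˡ (sum-zero λ j → f≈0 _ (punchInᵢ≢i i j)) ⟩
    f i + 0#                 ≈⟨ +-identityʳ _ ⟩
    f i                      ∎

  ∑-linear : ∀ {n} a (f g h : Fin n → Carrier) → (∀ j → f j ≈ a * g j + h j) → ∑ f ≈ a * ∑ g + ∑ h
  ∑-linear a f g h eq = begin
    ∑ f                                ≈⟨ sum-cong-≋ eq ⟩
    ∑ (λ j → a * g j + h j)            ≈⟨ ∑-distrib-+ (λ j → a * g j) h ⟩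
    ∑ (λ j → a * g j) + ∑ h            ≈⟨ +-congʳ (*-distribˡ-sum a g) ⟨
    a * ∑ g + ∑ h                      ∎

  1ᴹ : ∀ {N} → Matrix N
  1ᴹ = scalar 1#

  1ᴹ-diagonal : ∀ {N} (i : Fin N) → 1ᴹ i i ≈ 1#
  1ᴹ-diagonal i with i ≟ i
  ... | yes _   = refl
  ... | no  i≢i = contradiction ≡.refl i≢i

  1ᴹ-off-diagonal : ∀ {N} {i j : Fin N} → i ≢ j → 1ᴹ i j ≈ 0#
  1ᴹ-off-diagonal {i = i} {j} i≢j with i ≟ j
  ... | yes i≡j = contradiction i≡j i≢j
  ... | no  _   = refl

  Rows : ℕ → ℕ → Set c
  Rows N M = Fin N → Fin M → Carrier

  infix 4 _≋_ _≋[≢_]_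
  _≋_ : ∀ {M} (u v : Fin M → Carrier) → Set ℓ
  u ≋ v = ∀ m → u m ≈ v m

  _≋[≢_]_ : ∀ {N M} → Rows N M → Fin N → Rows N M → Set ℓ
  A ≋[≢ i ] B = ∀ j → j ≢ i → A j ≋ B j

  -- `linear` merges additivity (`a = 1#`) with scaling. It compares three matrices that agree off
  -- row `i`, so that no row has to be overwritten in the statement.
  record Multilinear {N M} (D : Rows N M → Carrier) : Set (c ⊔ ℓ) where
    field
      respects : ∀ {A B} → (∀ i → A i ≋ B i) → D A ≈ D B
      linear   : ∀ i a {A B C} → A ≋[≢ i ] B → A ≋[≢ i ] C →
                 (∀ m → A i m ≈ a * B i m + C i m) → D A ≈ a * D B + D C

  AlternatesAt : ∀ {N M} → (Rows N M → Carrier) → Fin N → Fin N → Set (c ⊔ ℓ)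
  AlternatesAt D i k = ∀ A → A i ≋ A k → D A ≈ 0#

  Alternating : ∀ {N M} → (Rows N M → Carrier) → Set (c ⊔ ℓ)
  Alternating D = ∀ i k → i ≢ k → AlternatesAt D i k

  module _ {N M} {D : Rows N M → Carrier} (D-multilinear : Multilinear D) where
    open Multilinear D-multilinear

    -- A zero row is minus itself plus itself, so linearity with `B = C = A` gives
    -- `D A ≈ - D A + D A`.
    zero-row : ∀ i A → (∀ m → A i m ≈ 0#) → D A ≈ 0#
    zero-row i A Aᵢ≈0 = begin
      D A               ≈⟨ linear i (- 1#) (λ _ _ _ → refl) (λ _ _ _ → refl) row ⟩
      - 1# * D A + D A  ≈⟨ +-congʳ (-1*x≈-x _) ⟩
      - D A + D A       ≈⟨ -‿inverseˡ _ ⟩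
      0#                ∎
      where
      row : ∀ m → A i m ≈ - 1# * A i m + A i m
      row m = begin
        A i m                 ≈⟨ Aᵢ≈0 m ⟩
        0#                    ≈⟨ -‿inverseˡ _ ⟨
        - A i m + A i m       ≈⟨ +-congʳ (-1*x≈-x _) ⟨
        - 1# * A i m + A i m  ∎

    -- The value with `u+v` in both rows vanishes and expands into four terms, two of which vanish
    -- as well. Alternation is assumed for this one pair of rows, because the induction for `det`
    -- has to use the result before all pairs are settled.
    antisymmetric : ∀ {i k} → i ≢ k → AlternatesAt D i k → ∀ A B → A i ≋ B k → A k ≋ B i →
                    (∀ j → j ≢ i → j ≢ k → A j ≋ B j) → D A + D B ≈ 0#
    antisymmetric {i} {k} i≢k alternates A B Aᵢ≋Bₖ Aₖ≋Bᵢ A≋B = begin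
      D A + D B
        ≈⟨ +-cong (respects A≋) (respects B≋) ⟩
      D (X u v) + D (X v u)
        ≈⟨ +-cong (trans (+-congʳ (zeroʳ 1#)) (+-identityˡ _)) (trans (+-identityʳ _) (*-identityˡ _)) ⟨
      (1# * 0# + D (X u v)) + (1# * D (X v u) + 0#)
        ≈⟨ +-cong (+-congʳ (*-congˡ (X-alternates u))) (+-congˡ (X-alternates v)) ⟨
      (1# * D (X u u) + D (X u v)) + (1# * D (X v u) + D (X v v))
        ≈⟨ +-cong (X-linearʳ u) (X-linearʳ v) ⟨
      D (X u u+v) + D (X v u+v)
        ≈⟨ +-congʳ (*-identityˡ _) ⟨
      1# * D (X u u+v) + D (X v u+v)
        ≈⟨ X-linearˡ ⟨
      D (X u+v u+v)
        ≈⟨ X-alternates u+v ⟩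
      0# ∎
      where
      u = A i
      v = A k
      u+v : Fin M → Carrier
      u+v m = 1# * u m + v m
      X : (p q : Fin M → Carrier) → Rows N M
      X p q j = if does (j ≟ i) then p else if does (j ≟ k) then q else A j
      X-i : ∀ p q → X p q i ≡ p
      X-i p q with i ≟ i
      ... | yes _   = ≡.refl
      ... | no  i≢i = contradiction ≡.refl i≢i
      X-k : ∀ p q → X p q k ≡ q
      X-k p q with k ≟ i | k ≟ k
      ... | yes k≡i | _       = contradiction (≡.sym k≡i) i≢k
      ... | no  _   | yes _   = ≡.refl
      ... | no  _   | no  k≢k = contradiction ≡.refl k≢k
      X-j : ∀ p q j → j ≢ i → j ≢ k → X p q j ≡ A j
      X-j p q j j≢i j≢k with j ≟ i | j ≟ k
      ... | yes j≡i | _       = contradiction j≡i j≢i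
      ... | no  _   | yes j≡k = contradiction j≡k j≢k
      ... | no  _   | no  _   = ≡.refl
      X-alternates : ∀ p → D (X p p) ≈ 0#
      X-alternates p = alternates (X p p) λ m →
        reflexive (≡.cong-app (≡.trans (X-i p p) (≡.sym (X-k p p))) m)
      X-linearʳ : ∀ p → D (X p u+v) ≈ 1# * D (X p u) + D (X p v)
      X-linearʳ p = linear k 1# (off u) (off v) row
        where
        off : ∀ q → X p u+v ≋[≢ k ] X p q
        off q j j≢k m with j ≟ i | j ≟ k
        ... | yes _ | _       = refl
        ... | no  _ | yes j≡k = contradiction j≡k j≢k
        ... | no  _ | no  _   = refl
        row : ∀ m → X p u+v k m ≈ 1# * X p u k m + X p v k m
        row m rewrite X-k p u+v | X-k p u | X-k p v = refl
      X-linearˡ : D (X u+v u+v) ≈ 1# * D (X u u+v) + D (X v u+v)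
      X-linearˡ = linear i 1# (off u) (off v) row
        where
        off : ∀ p → X u+v u+v ≋[≢ i ] X p u+v
        off p j j≢i m with j ≟ i
        ... | yes j≡i = contradiction j≡i j≢i
        ... | no  _   = refl
        row : ∀ m → X u+v u+v i m ≈ 1# * X u u+v i m + X v u+v i m
        row m rewrite X-i u+v u+v | X-i u u+v | X-i v u+v = refl
      A≋ : ∀ j → A j ≋ X u v j
      A≋ j m with j ≟ i | j ≟ k
      ... | yes ≡.refl | _          = refl
      ... | no  _      | yes ≡.refl = refl
      ... | no  _      | no  _      = refl
      B≋ : ∀ j → B j ≋ X v u j
      B≋ j m with j ≟ i | j ≟ k
      ... | yes ≡.refl | _          = sym (Aₖ≋Bᵢ m)
      ... | no  _      | yes ≡.refl = sym (Aᵢ≋Bₖ m)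
      ... | no  j≢i    | no  j≢k    = sym (A≋B j j≢i j≢k m)

  minor : ∀ {N} → Matrix (suc N) → Fin (suc N) → Matrix N
  minor A j r s = A (suc r) (punchIn j s)

  sign : ∀ {N} → Fin N → Carrier
  sign j = (- 1#) ^ toℕ j

  det-multilinear : ∀ {N} → Multilinear (det {N})
  det-multilinear {zero} = record
    { respects = λ _ → refl
    ; linear   = λ ()
    }
  det-multilinear {suc N} = record
    { respects = λ A≋B → sum-cong-≋ λ j → *-congˡ {sign j}
        (*-cong (A≋B zero j) (respects λ r s → A≋B (suc r) (punchIn j s)))
    ; linear   = lin
    }
    where
    open Multilinear (det-multilinear {N})
    term : Matrix (suc N) → Fin (suc N) → Carrier
    term A j = sign j * (A zero j * det (minor A j))
    lin : ∀ i a {A B C} → A ≋[≢ i ] B → A ≋[≢ i ] C →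
          (∀ m → A i m ≈ a * B i m + C i m) → det A ≈ a * det B + det C
    lin zero a {A} {B} {C} A≋B A≋C A₀ = ∑-linear a (term A) (term B) (term C) λ j → begin
      sign j * (A zero j * det (minor A j))
        ≈⟨ *-congˡ (*-congʳ (A₀ j)) ⟩
      sign j * ((a * B zero j + C zero j) * det (minor A j))
        ≈⟨ solve 5 (λ s a b c d → s :* ((a :* b :+ c) :* d) := a :* (s :* (b :* d)) :+ s :* (c :* d)) refl _ _ _ _ _ ⟩
      a * (sign j * (B zero j * det (minor A j))) + sign j * (C zero j * det (minor A j))
        ≈⟨ +-cong (*-congˡ (*-congˡ (*-congˡ (respects λ r s → A≋B (suc r) (λ ()) _))))
                  (*-congˡ (*-congˡ (respects λ r s → A≋C (suc r) (λ ()) _))) ⟩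
      a * term B j + term C j ∎
    lin (suc i) a {A} {B} {C} A≋B A≋C Aᵢ = ∑-linear a (term A) (term B) (term C) λ j → begin
      sign j * (A zero j * det (minor A j))
        ≈⟨ *-congˡ (*-congˡ (linear i a
             (λ r r≢i s → A≋B (suc r) (r≢i ∘ suc-injective) _)
             (λ r r≢i s → A≋C (suc r) (r≢i ∘ suc-injective) _)
             (λ s → Aᵢ (punchIn j s)))) ⟩
      sign j * (A zero j * (a * det (minor B j) + det (minor C j)))
        ≈⟨ solve 5 (λ s x a b c → s :* (x :* (a :* b :+ c)) := a :* (s :* (x :* b)) :+ s :* (x :* c)) refl _ _ _ _ _ ⟩
      a * (sign j * (A zero j * det (minor B j))) + sign j * (A zero j * det (minor C j))
        ≈⟨ +-cong (*-congˡ (*-congˡ (*-congʳ (A≋B zero (λ ()) j)))) (*-congˡ (*-congʳ (A≋C zero (λ ()) j))) ⟩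
      a * term B j + term C j ∎

  -- The pairs (j , punchIn j l) run over all ordered pairs of distinct columns;
  -- the hypothesis matches each pair with its transpose.
  ∑∑-cancel : ∀ {N} (h : Fin (suc N) → Fin N → Carrier) →
              (∀ j l → j Fin.≤ l → h (inject₁ j) l + h (suc l) j ≈ 0#) →
              ∑ (λ j → ∑ (h j)) ≈ 0#
  ∑∑-cancel {zero}  h cancel = +-identityʳ 0#
  ∑∑-cancel {suc N} h cancel = begin
    ∑ (h zero) + ∑ (λ j → h (suc j) zero + ∑ (λ l → h (suc j) (suc l)))
      ≈⟨ +-congˡ (∑-distrib-+ (λ j → h (suc j) zero) (λ j → ∑ (λ l → h (suc j) (suc l)))) ⟩
    ∑ (h zero) + (∑ (λ j → h (suc j) zero) + ∑ (λ j → ∑ (λ l → h (suc j) (suc l))))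
      ≈⟨ +-assoc _ _ _ ⟨
    (∑ (h zero) + ∑ (λ j → h (suc j) zero)) + ∑ (λ j → ∑ (λ l → h (suc j) (suc l)))
      ≈⟨ +-cong
           (trans (sym (∑-distrib-+ (h zero) (λ j → h (suc j) zero))) (sum-zero λ l → cancel zero l z≤n))
           (∑∑-cancel (λ j l → h (suc j) (suc l)) λ j l j≤l → cancel (suc j) (suc l) (s≤s j≤l)) ⟩
    0# + 0# ≈⟨ +-identityʳ 0# ⟩
    0# ∎

  punchIn-inject₁ : ∀ {n} {j l : Fin n} → j Fin.≤ l → punchIn (inject₁ j) l ≡ suc l
  punchIn-inject₁ {j = zero}           j≤l       = ≡.refl
  punchIn-inject₁ {j = suc j} {suc l} (s≤s j≤l) = ≡.cong suc (punchIn-inject₁ j≤l)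

  punchIn-suc : ∀ {n} {j l : Fin n} → j Fin.≤ l → punchIn (suc l) j ≡ inject₁ j
  punchIn-suc {j = zero}           j≤l       = ≡.refl
  punchIn-suc {j = suc j} {suc l} (s≤s j≤l) = ≡.cong suc (punchIn-suc j≤l)

  punchIn-punchIn : ∀ {n} {j l : Fin (suc n)} → j Fin.≤ l → ∀ s →
                    punchIn (inject₁ j) (punchIn l s) ≡ punchIn (suc l) (punchIn j s)
  punchIn-punchIn {j = zero}                      j≤l       s       = ≡.refl
  punchIn-punchIn {suc n} {j = suc j} {l = suc l} (s≤s j≤l) zero    = ≡.refl
  punchIn-punchIn {suc n} {j = suc j} {l = suc l} (s≤s j≤l) (suc s) =
    ≡.cong suc (punchIn-punchIn j≤l s)

  -- Expanding along both rows gives a sum over ordered pairs of distinct columns. Exchanging the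
  -- two columns leaves the minor and the product of the entries alone, but lowers the index of one
  -- column by one, which flips the sign.
  det-alternates-01 : ∀ {N} → AlternatesAt (det {suc (suc N)}) zero (suc zero)
  det-alternates-01 {N} A A₀≋A₁ = trans (sum-cong-≋ expand) (∑∑-cancel h cancel)
    where
    m : Fin (suc (suc N)) → Fin (suc N) → Carrier
    m j l = det (minor (minor A j) l)
    h : Fin (suc (suc N)) → Fin (suc N) → Carrier
    h j l = (sign j * A zero j) * (sign l * (A (suc zero) (punchIn j l) * m j l))
    expand : ∀ j → sign j * (A zero j * det (minor A j)) ≈ ∑ (h j)
    expand j = trans (sym (*-assoc _ _ _)) (*-distribˡ-sum (sign j * A zero j) (λ l → sign l * (A (suc zero) (punchIn j l) * m j l)))
    cancel : ∀ j l → j Fin.≤ l → h (inject₁ j) l + h (suc l) j ≈ 0#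
    cancel j l j≤l
      rewrite punchIn-inject₁ j≤l | punchIn-suc j≤l | toℕ-inject₁ j = begin
        (sj * a) * (sl * (A (suc zero) (suc l) * m (inject₁ j) l)) + ((- 1# * sl) * b) * (sj * (A (suc zero) (inject₁ j) * m (suc l) j))
          ≈⟨ +-cong (*-congˡ (*-congˡ (*-cong (sym (A₀≋A₁ _)) (Multilinear.respects det-multilinear λ r s →
               reflexive (≡.cong (A (suc (suc r))) (punchIn-punchIn j≤l s))))))
               (*-congˡ (*-congˡ (*-congʳ (sym (A₀≋A₁ _))))) ⟩
        (sj * a) * (sl * (b * m (suc l) j)) + ((- 1# * sl) * b) * (sj * (a * m (suc l) j))
          ≈⟨ solve 6 (λ n sj a sl b d → (sj :* a) :* (sl :* (b :* d)) :+ ((n :* sl) :* b) :* (sj :* (a :* d))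
                        := (sj :* a :* sl :* b :* d) :+ n :* (sj :* a :* sl :* b :* d)) refl (- 1#) sj a sl b _ ⟩
        z + - 1# * z ≈⟨ +-congˡ (-1*x≈-x z) ⟩
        z + - z      ≈⟨ -‿inverseʳ z ⟩
        0#           ∎
        where
        sj = sign j
        sl = sign l
        a = A zero (inject₁ j)
        b = A zero (suc l)
        z = sj * a * sl * b * m (suc l) j

  det-alternates-0 : ∀ {N} → Alternating (det {N}) → ∀ k → AlternatesAt (det {suc N}) zero (suc k)
  det-alternates-suc : ∀ {N} → Alternating (det {N}) → ∀ i k → i ≢ k → AlternatesAt (det {suc N}) (suc i) (suc k)

  det-alternates-suc alt i k i≢k A Aᵢ≋Aₖ = sum-zero λ j → begin
    sign j * (A zero j * det (minor A j)) ≈⟨ *-congˡ (*-congˡ (alt i k i≢k _ λ s → Aᵢ≋Aₖ (punchIn j s))) ⟩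
    sign j * (A zero j * 0#)              ≈⟨ *-congˡ (zeroʳ _) ⟩
    sign j * 0#                           ≈⟨ zeroʳ _ ⟩
    0#                                    ∎

  det-alternates-0 {suc N} alt zero    A A₀≋A₁ = det-alternates-01 A A₀≋A₁
  -- `B` is `A` with rows 1 and `suc (suc k)` exchanged, so its first two rows agree. The exchange
  -- only changes the sign, since both rows lie below the first and alternation there is inherited
  -- from the minors.
  det-alternates-0 {suc N} alt (suc k) A A₀≋Aₖ = begin
    det A         ≈⟨ +-identityʳ _ ⟨
    det A + 0#    ≈⟨ +-congˡ (det-alternates-01 B (λ m → trans (A₀≋Aₖ m) (reflexive (≡.cong-app (≡.sym B₁) m)))) ⟨
    det A + det B ≈⟨ antisymmetric det-multilinear {suc zero} {suc (suc k)} (λ ())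
                       (det-alternates-suc alt zero (suc k) λ ()) A B
                       (λ m → reflexive (≡.cong-app (≡.sym Bₖ) m)) (λ m → reflexive (≡.cong-app (≡.sym B₁) m)) off ⟩
    0#            ∎
    where
    B : Matrix _
    B = updateAt (updateAt A (suc zero) (const (A (suc (suc k))))) (suc (suc k)) (const (A (suc zero)))
    B₁ : B (suc zero) ≡ A (suc (suc k))
    B₁ = ≡.refl
    Bₖ : B (suc (suc k)) ≡ A (suc zero)
    Bₖ = Vₚ.updateAt-updates k (λ i → A (suc (suc i)))
    off : ∀ j → j ≢ suc zero → j ≢ suc (suc k) → A j ≋ B j
    off zero          _   _   m = refl
    off (suc zero)    j≢1 _   m = contradiction ≡.refl j≢1
    off (suc (suc j)) _   j≢k m = reflexive (≡.cong-app (≡.sym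
      (Vₚ.updateAt-minimal j k (λ i → A (suc (suc i))) (λ eq → j≢k (≡.cong (λ i → suc (suc i)) eq)))) m)

  det-alternating : ∀ {N} → Alternating (det {N})
  det-alternating {suc N} zero    zero    i≢k = contradiction ≡.refl i≢k
  det-alternating {suc N} zero    (suc k) i≢k = det-alternates-0 det-alternating k
  det-alternating {suc N} (suc i) zero    i≢k = λ A Aᵢ≋A₀ → det-alternates-0 det-alternating i A (sym ∘ Aᵢ≋A₀)
  det-alternating {suc N} (suc i) (suc k) i≢k = det-alternates-suc det-alternating i k (i≢k ∘ ≡.cong suc)

  expand-first-row : ∀ {N M} {D : Rows (suc N) M → Carrier} → Multilinear D →
    ∀ {L} (a : Fin L → Carrier) (e : Rows L M) u T → (∀ m → u m ≈ ∑ (λ j → a j * e j m)) →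
    D (u ◂ T) ≈ ∑ (λ j → a j * D (e j ◂ T))
  expand-first-row         D-lin {zero}  a e u T u≈ = zero-row D-lin zero _ u≈
  expand-first-row {D = D} D-lin {suc L} a e u T u≈ = begin
    D (u ◂ T)
      ≈⟨ Multilinear.linear D-lin zero (a zero) (off (e zero)) (off rest) u≈ ⟩
    a zero * D (e zero ◂ T) + D (rest ◂ T)
      ≈⟨ +-congˡ (expand-first-row D-lin (a ∘ suc) (e ∘ suc) rest T λ _ → refl) ⟩
    a zero * D (e zero ◂ T) + ∑ (λ j → a (suc j) * D (e (suc j) ◂ T)) ∎
    where
    rest : Fin _ → Carrier
    rest m = ∑ (λ j → a (suc j) * e (suc j) m)
    off : ∀ v → (u ◂ T) ≋[≢ zero ] (v ◂ T)
    off v zero    j≢0 m = contradiction ≡.refl j≢0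
    off v (suc j) _   m = refl

  -- Multiples of the top row `e` may be subtracted from the other rows. The induction is on `n`, a
  -- bound for the rows still to be treated: from row `n` on, `A` already agrees with `B`.
  clear-rows : ∀ {N M} {D : Rows (suc N) M → Carrier} → Multilinear D → Alternating D →
    ∀ n e A B (a : Fin N → Carrier) → (∀ i → n ℕ.≤ toℕ i → A i ≋ B i) →
    (∀ i m → A i m ≈ a i * e m + B i m) → D (e ◂ A) ≈ D (e ◂ B)
  clear-rows D-lin D-alt zero e A B a A≋B A≈ = Multilinear.respects D-lin
    λ { zero m → refl ; (suc i) → A≋B i z≤n }
  clear-rows {N} {D = D} D-lin D-alt (suc n) e A B a A≋B A≈ with n ℕₚ.<? N
  ... | no n≮N = clear-rows D-lin D-alt n e A B a
                   (λ i n≤i → contradiction (ℕₚ.≤-<-trans n≤i (toℕ<n i)) n≮N) A≈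
  ... | yes n<N = begin
    D (e ◂ A)
      ≈⟨ Multilinear.linear D-lin (suc i) (a i) (off (λ _ → e)) (off B) row ⟩
    a i * D (e ◂ upd (λ _ → e)) + D (e ◂ upd B)
      ≈⟨ +-congʳ (trans (*-congˡ (D-alt zero (suc i) (λ ()) _ λ m → reflexive (≡.cong-app (≡.sym (upd-i _)) m))) (zeroʳ _)) ⟩
    0# + D (e ◂ upd B)
      ≈⟨ +-identityˡ _ ⟩
    D (e ◂ upd B)
      ≈⟨ clear-rows D-lin D-alt n e (upd B) B a′ agree eqs ⟩
    D (e ◂ B) ∎
    where
    i = fromℕ< n<N
    upd : Rows N _ → Rows N _
    upd C = updateAt A i (const (C i))
    upd-i : ∀ C → upd C i ≡ C i
    upd-i C = Vₚ.updateAt-updates i A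
    upd-j : ∀ C j → j ≢ i → upd C j ≡ A j
    upd-j C j j≢i = Vₚ.updateAt-minimal j i A j≢i
    off : ∀ C → (e ◂ A) ≋[≢ suc i ] (e ◂ upd C)
    off C zero    _   m = refl
    off C (suc j) j≢i m = reflexive (≡.cong-app (≡.sym (upd-j C j (j≢i ∘ ≡.cong suc))) m)
    row : ∀ m → A i m ≈ a i * upd (λ _ → e) i m + upd B i m
    row m rewrite upd-i (λ _ → e) | upd-i B = A≈ i m
    agree : ∀ j → n ℕ.≤ toℕ j → upd B j ≋ B j
    agree j n≤j m with j ≟ i
    ... | yes ≡.refl = reflexive (≡.cong-app (upd-i B) m)
    ... | no  j≢i    = trans (reflexive (≡.cong-app (upd-j B j j≢i) m))
                         (A≋B j (ℕₚ.≤∧≢⇒< n≤j λ n≡j → j≢i (toℕ-injective (≡.trans (≡.sym n≡j) (≡.sym (toℕ-fromℕ< n<N))))) m)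
    a′ : Fin N → Carrier
    -- Row `i` now equals its goal, so its multiple of `e` is zero from here on.
    a′ j = if does (j ≟ i) then 0# else a j
    eqs : ∀ j m → upd B j m ≈ a′ j * e m + B j m
    eqs j m with j ≟ i
    ... | yes ≡.refl = trans (reflexive (≡.cong-app (upd-i B) m)) (sym (trans (+-congʳ (zeroˡ _)) (+-identityˡ _)))
    ... | no  j≢i    = trans (reflexive (≡.cong-app (upd-j B j j≢i) m)) (A≈ j m)

  insert0 : ∀ {N} → Fin (suc N) → (Fin N → Carrier) → Fin (suc N) → Carrier
  insert0 j u = insertAt u j 0#

  insert0-linear : ∀ {N} (j : Fin (suc N)) a {u v w : Fin N → Carrier} →
                   (∀ m → u m ≈ a * v m + w m) → ∀ m → insert0 j u m ≈ a * insert0 j v m + insert0 j w m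
  insert0-linear         zero    a eq zero    = sym (trans (+-congʳ (zeroʳ a)) (+-identityʳ 0#))
  insert0-linear         zero    a eq (suc m) = eq m
  insert0-linear {suc N} (suc j) a eq zero    = eq zero
  insert0-linear {suc N} (suc j) a eq (suc m) = insert0-linear j a (eq ∘ suc) m

  insert0-cong : ∀ {N} (j : Fin (suc N)) {u v : Fin N → Carrier} → u ≋ v → insert0 j u ≋ insert0 j v
  insert0-cong         zero    eq zero    = refl
  insert0-cong         zero    eq (suc m) = eq m
  insert0-cong {suc N} (suc j) eq zero    = eq zero
  insert0-cong {suc N} (suc j) eq (suc m) = insert0-cong j (eq ∘ suc) m

  1ᴹ-suc : ∀ {N} (i m : Fin N) → 1ᴹ (suc i) (suc m) ≈ 1ᴹ i m
  1ᴹ-suc i m with i ≟ m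
  ... | yes _ = refl
  ... | no  _ = refl

  insert0-1ᴹ : ∀ {N} (j : Fin (suc N)) i → insert0 j (1ᴹ i) ≋ 1ᴹ (punchIn j i)
  insert0-1ᴹ         zero    i       zero    = refl
  insert0-1ᴹ         zero    i       (suc m) = sym (1ᴹ-suc i m)
  insert0-1ᴹ {suc N} (suc j) zero    zero    = refl
  insert0-1ᴹ {suc N} (suc j) (suc i) zero    = refl
  insert0-1ᴹ {suc N} (suc j) zero    (suc m) = trans (zeros j m) (sym (1ᴹ-off-diagonal {i = zero} {suc m} λ ()))
    where
    zeros : ∀ {n} (j m : Fin (suc n)) → insert0 j (λ _ → 0#) m ≈ 0#
    zeros         zero    zero    = refl
    zeros         zero    (suc m) = refl
    zeros {suc n} (suc j) zero    = refl
    zeros {suc n} (suc j) (suc m) = zeros j m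
  insert0-1ᴹ {suc N} (suc j) (suc i) (suc m) = begin
    insert0 j (λ m → 1ᴹ (suc i) (suc m)) m ≈⟨ insert0-cong j (1ᴹ-suc i) m ⟩
    insert0 j (1ᴹ i) m                     ≈⟨ insert0-1ᴹ j i m ⟩
    1ᴹ (punchIn j i) m                     ≈⟨ 1ᴹ-suc (punchIn j i) m ⟨
    1ᴹ (suc (punchIn j i)) (suc m)         ∎

  -- The matrix is the identity with row `j` moved to the top. Passing from `inject₁ i` to `suc i`
  -- exchanges the top row with row `suc i`, which costs one sign.
  det-cycle : ∀ {N} {D : Rows (suc N) (suc N) → Carrier} → Multilinear D → Alternating D →
              ∀ j → D (1ᴹ j ◂ (λ i → 1ᴹ (punchIn j i))) ≈ sign j * D 1ᴹ
  det-cycle {N} {D} D-lin D-alt = <-weakInduction _ base step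
    where
    open Multilinear D-lin
    X : Fin (suc N) → Matrix (suc N)
    X j = 1ᴹ j ◂ (λ i → 1ᴹ (punchIn j i))
    base : D (X zero) ≈ 1# * D 1ᴹ
    base = trans (respects λ { zero m → refl ; (suc i) m → refl }) (sym (*-identityˡ _))
    step : ∀ i → D (X (inject₁ i)) ≈ sign (inject₁ i) * D 1ᴹ → D (X (suc i)) ≈ (- 1# * sign i) * D 1ᴹ
    step i ih = begin
      D (X (suc i))
        ≈⟨ +-identityˡ _ ⟨
      0# + D (X (suc i))
        ≈⟨ +-congʳ (-‿inverseˡ _) ⟨
      - D (X (inject₁ i)) + D (X (inject₁ i)) + D (X (suc i))
        ≈⟨ +-assoc _ _ _ ⟩
      - D (X (inject₁ i)) + (D (X (inject₁ i)) + D (X (suc i)))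
        ≈⟨ +-congˡ (antisymmetric D-lin {zero} {suc i} (λ ()) (D-alt zero (suc i) λ ()) _ _
             (λ m → reflexive (≡.cong (λ k → 1ᴹ k m) (≡.sym (punchIn-suc {j = i} {i} ℕₚ.≤-refl))))
             (λ m → reflexive (≡.cong (λ k → 1ᴹ k m) (punchIn-inject₁ {j = i} {i} ℕₚ.≤-refl)))
             off) ⟩
      - D (X (inject₁ i)) + 0#
        ≈⟨ +-identityʳ _ ⟩
      - D (X (inject₁ i))
        ≈⟨ -1*x≈-x _ ⟨
      - 1# * D (X (inject₁ i))
        ≈⟨ *-congˡ ih ⟩
      - 1# * (sign (inject₁ i) * D 1ᴹ)
        ≈⟨ *-congˡ (*-congʳ (reflexive (≡.cong ((- 1#) ^_) (toℕ-inject₁ i)))) ⟩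
      - 1# * (sign i * D 1ᴹ)
        ≈⟨ *-assoc _ _ _ ⟨
      (- 1# * sign i) * D 1ᴹ ∎
      where
      punchIn-≢ : ∀ {n} (i l : Fin n) → l ≢ i → punchIn (inject₁ i) l ≡ punchIn (suc i) l
      punchIn-≢ zero    zero    l≢i = contradiction ≡.refl l≢i
      punchIn-≢ zero    (suc l) l≢i = ≡.refl
      punchIn-≢ (suc i) zero    l≢i = ≡.refl
      punchIn-≢ (suc i) (suc l) l≢i = ≡.cong suc (punchIn-≢ i l (l≢i ∘ ≡.cong suc))
      off : ∀ j → j ≢ zero → j ≢ suc i → X (inject₁ i) j ≋ X (suc i) j
      off zero    j≢0 _   m = contradiction ≡.refl j≢0
      off (suc l) _   l≢i m = reflexive (≡.cong (λ k → 1ᴹ k m) (punchIn-≢ i l (l≢i ∘ ≡.cong suc)))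

  -- Expand the first row into unit vectors. Under the unit vector `1ᴹ j`, column `j` of the other
  -- rows can be cleared, so `D` becomes an alternating form `Dⱼ j` of the minor, to which induction
  -- applies. Its value at the identity is the sign of a cycle times `D 1ᴹ`.
  det-unique : ∀ {N} {D : Matrix N → Carrier} → Multilinear D → Alternating D → ∀ A → D A ≈ det A * D 1ᴹ
  det-unique {zero}      D-lin D-alt A = trans (Multilinear.respects D-lin λ ()) (sym (*-identityˡ _))
  det-unique {suc N} {D} D-lin D-alt A = begin
    D A
      ≈⟨ respects (λ { zero m → refl ; (suc i) m → refl }) ⟩
    D (A zero ◂ (A ∘ suc))
      ≈⟨ expand-first-row D-lin (A zero) 1ᴹ (A zero) (A ∘ suc) (λ m → sym (begin
           ∑ (λ j → A zero j * 1ᴹ j m) ≈⟨ sum-single m (λ j j≢m → trans (*-congˡ {A zero j} (1ᴹ-off-diagonal j≢m)) (zeroʳ _)) ⟩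
           A zero m * 1ᴹ m m           ≈⟨ *-congˡ (1ᴹ-diagonal m) ⟩
           A zero m * 1#               ≈⟨ *-identityʳ _ ⟩
           A zero m                    ∎)) ⟩
    ∑ (λ j → A zero j * D (1ᴹ j ◂ (A ∘ suc)))
      ≈⟨ sum-cong-≋ (λ j → trans (*-congˡ {A zero j} (column j)) (solve 4 (λ a d s e → a :* (d :* (s :* e)) := (s :* (a :* d)) :* e) refl _ _ _ _)) ⟩
    ∑ (λ j → (sign j * (A zero j * det (minor A j))) * D 1ᴹ)
      ≈⟨ *-distribʳ-sum (D 1ᴹ) (λ j → sign j * (A zero j * det (minor A j))) ⟨
    det A * D 1ᴹ ∎
    where
    open Multilinear D-lin
    Dⱼ : Fin (suc N) → Matrix N → Carrier
    Dⱼ j B = D (1ᴹ j ◂ (insert0 j ∘ B))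
    Dⱼ-multilinear : ∀ j → Multilinear (Dⱼ j)
    Dⱼ-multilinear j = record
      { respects = λ A≋B → respects λ { zero m → refl ; (suc i) → insert0-cong j (A≋B i) }
      ; linear   = λ i a A≋B A≋C Aᵢ → linear (suc i) a
          (λ { zero _ m → refl ; (suc l) l≢i → insert0-cong j (A≋B l (l≢i ∘ ≡.cong suc)) })
          (λ { zero _ m → refl ; (suc l) l≢i → insert0-cong j (A≋C l (l≢i ∘ ≡.cong suc)) })
          (insert0-linear j a Aᵢ)
      }
    Dⱼ-alternating : ∀ j → Alternating (Dⱼ j)
    Dⱼ-alternating j i k i≢k B Bᵢ≋Bₖ =
      D-alt (suc i) (suc k) (i≢k ∘ suc-injective) _ (insert0-cong j Bᵢ≋Bₖ)
    decompose : ∀ {n} (j : Fin (suc n)) (u : Fin (suc n) → Carrier) →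
                ∀ m → u m ≈ u j * 1ᴹ j m + insert0 j (u ∘ punchIn j) m
    decompose zero u zero = sym (trans (+-identityʳ _) (*-identityʳ _))
    decompose zero u (suc m) = sym (trans (+-congʳ (zeroʳ _)) (+-identityˡ _))
    decompose {suc n} (suc j) u zero = sym (trans (+-congʳ (zeroʳ _)) (+-identityˡ _))
    decompose {suc n} (suc j) u (suc m) =
      trans (decompose j (u ∘ suc) m) (+-congʳ (*-congˡ (sym (1ᴹ-suc j m))))
    column : ∀ j → D (1ᴹ j ◂ (A ∘ suc)) ≈ det (minor A j) * (sign j * D 1ᴹ)
    column j = begin
      D (1ᴹ j ◂ (A ∘ suc))
        ≈⟨ clear-rows D-lin D-alt N (1ᴹ j) (A ∘ suc) (insert0 j ∘ minor A j) (λ i → A (suc i) j)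
             (λ i N≤i → contradiction (toℕ<n i) (ℕₚ.≤⇒≯ N≤i)) (λ i → decompose j (A (suc i))) ⟩
      Dⱼ j (minor A j)
        ≈⟨ det-unique (Dⱼ-multilinear j) (Dⱼ-alternating j) (minor A j) ⟩
      det (minor A j) * Dⱼ j 1ᴹ
        ≈⟨ *-congˡ (respects λ { zero m → refl ; (suc i) → insert0-1ᴹ j i }) ⟩
      det (minor A j) * D (1ᴹ j ◂ (λ i → 1ᴹ (punchIn j i)))
        ≈⟨ *-congˡ (det-cycle D-lin D-alt j) ⟩
      det (minor A j) * (sign j * D 1ᴹ) ∎

  infixl 7 _*ᴹ_
  _*ᴹ_ : ∀ {N} → Matrix N → Matrix N → Matrix N
  (A *ᴹ B) i k = ∑ λ j → A i j * B j k

  det-cong : ∀ {N} {A B : Matrix N} → (∀ i j → A i j ≈ B i j) → det A ≈ det B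
  det-cong = Multilinear.respects det-multilinear

  -- For fixed `B` the left side is multilinear and alternating in the rows of `A`, with value
  -- `det B` at the identity.
  det-* : ∀ {N} (A B : Matrix N) → det (A *ᴹ B) ≈ det A * det B
  det-* {N} A B = trans (det-unique mult alt A) (*-congˡ (det-cong λ i k → begin
    ∑ (λ j → 1ᴹ i j * B j k) ≈⟨ sum-single i (λ j j≢i → trans (*-congʳ (1ᴹ-off-diagonal (j≢i ∘ ≡.sym))) (zeroˡ _)) ⟩
    1ᴹ i i * B i k           ≈⟨ *-congʳ (1ᴹ-diagonal i) ⟩
    1# * B i k               ≈⟨ *-identityˡ _ ⟩
    B i k                    ∎))
    where
    rows-cong : ∀ {u v : Fin N → Carrier} → u ≋ v → ∀ k → ∑ (λ j → u j * B j k) ≈ ∑ (λ j → v j * B j k)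
    rows-cong u≋v k = sum-cong-≋ λ j → *-congʳ (u≋v j)
    mult : Multilinear (λ A → det (A *ᴹ B))
    mult = record
      { respects = λ A≋B → det-cong λ i → rows-cong (A≋B i)
      ; linear   = λ i a A≋B A≋C Aᵢ → Multilinear.linear det-multilinear i a
          (λ j j≢i → rows-cong (A≋B j j≢i)) (λ j j≢i → rows-cong (A≋C j j≢i))
          (λ k → ∑-linear a _ _ _ λ j → trans (*-congʳ (Aᵢ j))
            (solve 4 (λ a b c d → (a :* b :+ c) :* d := a :* (b :* d) :+ c :* d) refl _ _ _ _))
      }
    alt : Alternating (λ A → det (A *ᴹ B))
    alt i k i≢k A Aᵢ≋Aₖ = det-alternating i k i≢k _ (rows-cong Aᵢ≋Aₖ)

  -- Triangular matrices.

  ∏ᶠ : ∀ {N} → (Fin N → Carrier) → Carrier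
  ∏ᶠ {zero}  f = 1#
  ∏ᶠ {suc N} f = f zero * ∏ᶠ (f ∘ suc)

  ∏ᶠ-cong : ∀ {N} {f g : Fin N → Carrier} → (∀ i → f i ≈ g i) → ∏ᶠ f ≈ ∏ᶠ g
  ∏ᶠ-cong {zero}  eq = refl
  ∏ᶠ-cong {suc N} eq = *-cong (eq zero) (∏ᶠ-cong (eq ∘ suc))

  ∏ᶠ-1 : ∀ {N} {f : Fin N → Carrier} → (∀ i → f i ≈ 1#) → ∏ᶠ f ≈ 1#
  ∏ᶠ-1 {zero}  eq = refl
  ∏ᶠ-1 {suc N} eq = trans (*-cong (eq zero) (∏ᶠ-1 (eq ∘ suc))) (*-identityˡ 1#)

  ∏ᶠ-remove : ∀ {N} (i : Fin (suc N)) (f : Fin (suc N) → Carrier) → ∏ᶠ f ≈ f i * ∏ᶠ (f ∘ punchIn i)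
  ∏ᶠ-remove         zero    f = refl
  ∏ᶠ-remove {suc N} (suc i) f = trans (*-congˡ (∏ᶠ-remove i (f ∘ suc)))
    (solve 3 (λ a b c → a :* (b :* c) := b :* (a :* c)) refl _ _ _)

  det-single-entry : ∀ {N} (A : Matrix (suc N)) → (∀ j → A zero (suc j) ≈ 0#) → det A ≈ A zero zero * det (minor A zero)
  det-single-entry A A₀≈0 = trans (+-congˡ (sum-zero λ j →
      trans (*-congˡ (trans (*-congʳ (A₀≈0 j)) (zeroˡ _))) (zeroʳ _)))
    (trans (+-identityʳ _) (*-identityˡ _))

  det-1ᴹ : ∀ {N} → det (1ᴹ {N}) ≈ 1#
  det-1ᴹ {zero}  = refl
  det-1ᴹ {suc N} = trans (det-single-entry (1ᴹ {suc N}) (λ j → refl)) (trans (*-identityˡ _)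
    (trans (det-cong (1ᴹ-suc {N})) (det-1ᴹ {N})))

  -- Rows and columns undergo the same permutation, so the identity matrix is preserved and
  -- uniqueness gives the factor 1; the sign of `σ` never has to be defined.
  det-reindex : ∀ {N} (σ : Permutation′ N) (A : Matrix N) → det (λ i j → A (σ ⟨$⟩ʳ i) (σ ⟨$⟩ʳ j)) ≈ det A
  det-reindex {N} σ A = begin
    det (λ i j → A (σ ⟨$⟩ʳ i) (σ ⟨$⟩ʳ j))
      ≈⟨ det-unique mult alt A ⟩
    det A * det (λ i j → 1ᴹ (σ ⟨$⟩ʳ i) (σ ⟨$⟩ʳ j))
      ≈⟨ *-congˡ (trans (det-cong 1ᴹ-reindex) (det-1ᴹ {N})) ⟩
    det A * 1#
      ≈⟨ *-identityʳ _ ⟩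
    det A ∎
    where
    σ-injective : ∀ {i j} → σ ⟨$⟩ʳ i ≡ σ ⟨$⟩ʳ j → i ≡ j
    σ-injective eq = ≡.trans (≡.sym (Perm.inverseˡ σ)) (≡.trans (≡.cong (σ ⟨$⟩ˡ_) eq) (Perm.inverseˡ σ))
    preimage : ∀ {i j} → j ≢ σ ⟨$⟩ˡ i → σ ⟨$⟩ʳ j ≢ i
    preimage j≢ σj≡i = j≢ (≡.trans (≡.sym (Perm.inverseˡ σ)) (≡.cong (σ ⟨$⟩ˡ_) σj≡i))
    1ᴹ-reindex : ∀ i j → 1ᴹ (σ ⟨$⟩ʳ i) (σ ⟨$⟩ʳ j) ≈ 1ᴹ i j
    1ᴹ-reindex i j with i ≟ j
    ... | yes ≡.refl = 1ᴹ-diagonal (σ ⟨$⟩ʳ i)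
    ... | no  i≢j    = 1ᴹ-off-diagonal (i≢j ∘ σ-injective)
    mult : Multilinear (λ A → det (λ i j → A (σ ⟨$⟩ʳ i) (σ ⟨$⟩ʳ j)))
    mult = record
      { respects = λ A≋B → det-cong λ i j → A≋B (σ ⟨$⟩ʳ i) (σ ⟨$⟩ʳ j)
      ; linear   = λ i a {A} {B} {C} A≋B A≋C Aᵢ → Multilinear.linear det-multilinear (σ ⟨$⟩ˡ i) a
          (λ j j≢ m → A≋B _ (preimage j≢) (σ ⟨$⟩ʳ m)) (λ j j≢ m → A≋C _ (preimage j≢) (σ ⟨$⟩ʳ m))
          (λ m → ≡.subst (λ i → A i (σ ⟨$⟩ʳ m) ≈ a * B i (σ ⟨$⟩ʳ m) + C i (σ ⟨$⟩ʳ m)) (≡.sym (Perm.inverseʳ σ)) (Aᵢ (σ ⟨$⟩ʳ m)))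
      }
    alt : Alternating (λ A → det (λ i j → A (σ ⟨$⟩ʳ i) (σ ⟨$⟩ʳ j)))
    alt i k i≢k A Aᵢ≋Aₖ = det-alternating (σ ⟨$⟩ˡ i) (σ ⟨$⟩ˡ k)
      (λ eq → i≢k (≡.trans (≡.sym (Perm.inverseʳ σ)) (≡.trans (≡.cong (σ ⟨$⟩ʳ_) eq) (Perm.inverseʳ σ)))) _
      λ m → ≡.subst₂ (λ i k → A i (σ ⟨$⟩ʳ m) ≈ A k (σ ⟨$⟩ʳ m)) (≡.sym (Perm.inverseʳ σ)) (≡.sym (Perm.inverseʳ σ)) (Aᵢ≋Aₖ (σ ⟨$⟩ʳ m))

  argmin : ∀ {N} (ρ : Fin (suc N) → ℕ) → ∃ λ i → ∀ j → ρ i ℕ.≤ ρ j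
  argmin {zero}  ρ = zero , λ { zero → ℕₚ.≤-refl }
  argmin {suc N} ρ with argmin (ρ ∘ suc)
  ... | i , ρᵢ≤ with ℕₚ.≤-total (ρ zero) (ρ (suc i))
  ...   | inj₁ ρ₀≤ρᵢ = zero , λ { zero → ℕₚ.≤-refl ; (suc j) → ℕₚ.≤-trans ρ₀≤ρᵢ (ρᵢ≤ j) }
  ...   | inj₂ ρᵢ≤ρ₀ = suc i , λ { zero → ρᵢ≤ρ₀ ; (suc j) → ρᵢ≤ j }

  -- The row of an index of minimal rank vanishes off the diagonal; a simultaneous permutation
  -- brings it to the front, where the cofactor expansion has one term. The rank `ρ` is a parameter
  -- because `E` and `T` are triangular for different orders on the same indices.
  det-triangular : ∀ {N} (ρ : Fin N → ℕ) (A : Matrix N) →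
                   (∀ i j → i ≢ j → ¬ ρ j ℕ.< ρ i → A i j ≈ 0#) → det A ≈ ∏ᶠ (λ i → A i i)
  det-triangular {zero}  ρ A tri = refl
  det-triangular {suc N} ρ A tri with argmin ρ
  ... | i , ρᵢ≤ = begin
    det A
      ≈⟨ det-reindex σ A ⟨
    det (λ r s → A (σ ⟨$⟩ʳ r) (σ ⟨$⟩ʳ s))
      ≈⟨ det-single-entry (λ r s → A (σ ⟨$⟩ʳ r) (σ ⟨$⟩ʳ s)) (λ j → tri i _ (λ eq → punchInᵢ≢i i j (≡.trans (≡.sym (Perm.insert-punchIn zero i Perm.id j)) (≡.sym eq))) (ℕₚ.≤⇒≯ (ρᵢ≤ _))) ⟩
    A i i * det (λ r s → A (σ ⟨$⟩ʳ suc r) (σ ⟨$⟩ʳ suc s))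
      ≈⟨ *-congˡ (det-cong λ r s → reflexive (≡.cong₂ A (Perm.insert-punchIn zero i Perm.id r) (Perm.insert-punchIn zero i Perm.id s))) ⟩
    A i i * det (λ r s → A (punchIn i r) (punchIn i s))
      ≈⟨ *-congˡ (det-triangular (ρ ∘ punchIn i) _ λ r s r≢s → tri _ _ (r≢s ∘ punchIn-injective i r s)) ⟩
    A i i * ∏ᶠ (λ r → A (punchIn i r) (punchIn i r))
      ≈⟨ ∏ᶠ-remove i (λ r → A r r) ⟨
    ∏ᶠ (λ r → A r r) ∎
    where
    σ : Permutation′ (suc N)
    σ = Perm.insert zero i Perm.id

-- Indicators of decidable propositions as natural numbers.

module Indicators where
  open import Data.Nat.Base using (_+_; _*_)
  open ≡ using (refl; sym; cong)

  ⟦_⟧ : ∀ {p} {P : Set p} → Dec P → ℕ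
  ⟦ P? ⟧ = if does P? then 1 else 0

  module _ {p q} {P : Set p} {Q : Set q} where
    ⟦⟧-cong : (P? : Dec P) (Q? : Dec Q) → (P → Q) → (Q → P) → ⟦ P? ⟧ ≡ ⟦ Q? ⟧
    ⟦⟧-cong (yes p) (yes q) to from = refl
    ⟦⟧-cong (yes p) (no ¬q) to from = contradiction (to p) ¬q
    ⟦⟧-cong (no ¬p) (yes q) to from = contradiction (from q) ¬p
    ⟦⟧-cong (no ¬p) (no ¬q) to from = refl

    ⟦⟧*⟦⟧-cong : (P? : Dec P) (Q? : Dec Q) {x y : ℕ} → (P → Q → x ≡ y) →
                 ⟦ P? ⟧ * (⟦ Q? ⟧ * x) ≡ ⟦ P? ⟧ * (⟦ Q? ⟧ * y)
    ⟦⟧*⟦⟧-cong (yes p) (yes q) eq = cong (λ z → 1 * (1 * z)) (eq p q)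
    ⟦⟧*⟦⟧-cong (yes p) (no  _) eq = refl
    ⟦⟧*⟦⟧-cong (no  _) _       eq = refl

  module _ {p} {P : Set p} where
    ⟦⟧-yes : (P? : Dec P) → P → ⟦ P? ⟧ ≡ 1
    ⟦⟧-yes (yes _) p = refl
    ⟦⟧-yes (no ¬p) p = contradiction p ¬p

    ⟦⟧-no : (P? : Dec P) → ¬ P → ⟦ P? ⟧ ≡ 0
    ⟦⟧-no (yes p) ¬p = contradiction p ¬p
    ⟦⟧-no (no _)  ¬p = refl

    ⟦⟧*-nonzero : (P? : Dec P) {x : ℕ} → ⟦ P? ⟧ * x ≢ 0 → P × x ≢ 0
    ⟦⟧*-nonzero (yes p) ≢0 = p , λ { refl → ≢0 refl }
    ⟦⟧*-nonzero (no  _) ≢0 = contradiction refl ≢0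

  ⟦⟧-× : ∀ {p q t} {P : Set p} {Q : Set q} {T : Set t} (P? : Dec P) (Q? : Dec Q) (T? : Dec T) →
         (P → Q × T) → (Q → T → P) → ⟦ P? ⟧ ≡ ⟦ Q? ⟧ * ⟦ T? ⟧
  ⟦⟧-× P? (yes q) (yes t) to from = ⟦⟧-yes P? (from q t)
  ⟦⟧-× P? (yes q) (no ¬t) to from = ⟦⟧-no P? (¬t ∘ proj₂ ∘ to)
  ⟦⟧-× P? (no ¬q) T?      to from = ⟦⟧-no P? (¬q ∘ proj₁ ∘ to)

  ⟦⟧-vanish : ∀ {p q t} {P : Set p} {Q : Set q} {T : Set t} (P? : Dec P) (Q? : Dec Q) (T? : Dec T) (x : ℕ) →
              (Q → T → ¬ P) → ⟦ P? ⟧ * (⟦ Q? ⟧ * (⟦ T? ⟧ * x)) ≡ 0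
  ⟦⟧-vanish (yes p) (yes q) (yes t) x contra = contradiction p (contra q t)
  ⟦⟧-vanish (yes p) (yes q) (no  _) x contra = refl
  ⟦⟧-vanish (yes p) (no  _) T?      x contra = refl
  ⟦⟧-vanish (no  _) Q?      T?      x contra = refl

  ⟦⟧-mono : ∀ {p q} {P : Set p} {Q : Set q} (P? : Dec P) (Q? : Dec Q) → (P → Q) → ⟦ P? ⟧ ℕ.≤ ⟦ Q? ⟧
  ⟦⟧-mono (yes p) Q? to = ℕₚ.≤-reflexive (sym (⟦⟧-yes Q? (to p)))
  ⟦⟧-mono (no  _) Q? to = z≤n

  ⟦⟧-mono-⊎ : ∀ {p q t} {P : Set p} {Q : Set q} {T : Set t} (P? : Dec P) (Q? : Dec Q) (T? : Dec T) →
              (P → ¬ Q) → (P → T) → (Q → T) → ⟦ P? ⟧ + ⟦ Q? ⟧ ℕ.≤ ⟦ T? ⟧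
  ⟦⟧-mono-⊎ (yes p) (yes q) T? disj P→T Q→T = contradiction q (disj p)
  ⟦⟧-mono-⊎ (yes p) (no  _) T? disj P→T Q→T = ℕₚ.≤-reflexive (sym (⟦⟧-yes T? (P→T p)))
  ⟦⟧-mono-⊎ (no  _) Q?      T? disj P→T Q→T = ⟦⟧-mono Q? T? Q→T

open Indicators

-- Products over lists, grouped by the value of a function.

module Products {c ℓ : Level} (R : CommutativeRing c ℓ) where
  open CommutativeRing R hiding (zero)
  open OverRing R
  open Determinant R using (∏ᶠ)
  open import Algebra.Properties.Semiring.Exp semiring using (^-homo-*)
  open import Algebra.Solver.Ring.NaturalCoefficients.Default commutativeSemiring
    using (solve; _:=_; _:*_)
  open import Relation.Binary.Reasoning.Setoid setoid

  ∏ᶠ-lookup : ∀ {B : Set} (f : B → Carrier) bs → ∏ᶠ (λ r → f (List.lookup bs r)) ≈ ∏[ bs ] f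
  ∏ᶠ-lookup f []       = refl
  ∏ᶠ-lookup f (b ∷ bs) = *-congˡ (∏ᶠ-lookup f bs)

  ∏-cong : ∀ {B : Set} {f g : B → Carrier} bs → (∀ {b} → b ∈ bs → f b ≈ g b) → ∏[ bs ] f ≈ ∏[ bs ] g
  ∏-cong []       eq = refl
  ∏-cong (b ∷ bs) eq = *-cong (eq (here ≡.refl)) (∏-cong bs (eq ∘ there))

  ∏-* : ∀ {B : Set} (f g : B → Carrier) bs → ∏[ bs ] (λ b → f b * g b) ≈ ∏[ bs ] f * ∏[ bs ] g
  ∏-* f g []       = sym (*-identityˡ 1#)
  ∏-* f g (b ∷ bs) = trans (*-congˡ (∏-* f g bs))
    (solve 4 (λ a b c d → (a :* b) :* (c :* d) := (a :* c) :* (b :* d)) refl (f b) (g b) _ _)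

  ∏-1 : ∀ {B : Set} (f : B → Carrier) bs → (∀ {b} → b ∈ bs → f b ≈ 1#) → ∏[ bs ] f ≈ 1#
  ∏-1 f []       eq = refl
  ∏-1 f (b ∷ bs) eq = trans (*-cong (eq (here ≡.refl)) (∏-1 f bs (eq ∘ there))) (*-identityˡ 1#)

  module _ {B : Set} (_≟ᴮ_ : (b b′ : B) → Dec (b ≡ b′)) (g : B → Carrier) where
    ∏-indicator : ∀ b₀ bs → Unique bs → b₀ ∈ bs → ∏[ bs ] (λ b → g b ^ ⟦ b₀ ≟ᴮ b ⟧) ≈ g b₀
    ∏-indicator b₀ (b ∷ bs) (b∉ ∷ bs!) (here ≡.refl) = trans (*-cong
        (trans (reflexive (≡.cong (g b ^_) (⟦⟧-yes (b ≟ᴮ b) ≡.refl))) (*-identityʳ (g b)))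
        (∏-1 _ bs λ {b′} b′∈ → reflexive (≡.cong (g b′ ^_) (⟦⟧-no (b ≟ᴮ b′) (All.lookup b∉ b′∈)))))
      (*-identityʳ (g b))
    ∏-indicator b₀ (b ∷ bs) (b∉ ∷ bs!) (there b₀∈) = trans (*-cong
        (reflexive (≡.cong (g b ^_) (⟦⟧-no (b₀ ≟ᴮ b) (λ eq → All.lookup b∉ b₀∈ (≡.sym eq)))))
        (∏-indicator b₀ bs bs! b₀∈))
      (*-identityˡ (g b₀))

    -- Each factor `g (h c)` is itself a product over `bs` with exponents 0 and 1; multiplying these
    -- up, the exponents add to the sizes of the fibres of `h`.
    ∏-group : ∀ {C : Set} (h : C → B) cs bs → Unique bs → (∀ {c} → c ∈ cs → h c ∈ bs) →
              ∏[ cs ] (g ∘ h) ≈ ∏[ bs ] (λ b → g b ^ length (filter (λ c → h c ≟ᴮ b) cs))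
    ∏-group h []       bs bs! h∈ = sym (∏-1 _ bs λ _ → refl)
    ∏-group h (c ∷ cs) bs bs! h∈ = begin
      g (h c) * ∏[ cs ] (g ∘ h)
        ≈⟨ *-cong (sym (∏-indicator (h c) bs bs! (h∈ (here ≡.refl)))) (∏-group h cs bs bs! (h∈ ∘ there)) ⟩
      ∏[ bs ] (λ b → g b ^ ⟦ h c ≟ᴮ b ⟧) * ∏[ bs ] (λ b → g b ^ length (filter (λ c → h c ≟ᴮ b) cs))
        ≈⟨ ∏-* (λ b → g b ^ ⟦ h c ≟ᴮ b ⟧) (λ b → g b ^ length (filter (λ c → h c ≟ᴮ b) cs)) bs ⟨
      ∏[ bs ] (λ b → g b ^ ⟦ h c ≟ᴮ b ⟧ * g b ^ length (filter (λ c → h c ≟ᴮ b) cs))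
        ≈⟨ ∏-cong bs (λ {b} _ → trans (sym (^-homo-* (g b) ⟦ h c ≟ᴮ b ⟧ _)) (reflexive (≡.cong (g b ^_) (count-∷ b)))) ⟩
      ∏[ bs ] (λ b → g b ^ length (filter (λ c → h c ≟ᴮ b) (c ∷ cs))) ∎
      where
      count-∷ : ∀ b → ⟦ h c ≟ᴮ b ⟧ ℕ.+ length (filter (λ c → h c ≟ᴮ b) cs) ≡ length (filter (λ c → h c ≟ᴮ b) (c ∷ cs))
      count-∷ b with h c ≟ᴮ b
      ... | yes _ = ≡.refl
      ... | no  _ = ≡.refl

-- Lists without repetition, bijections between them, and positions in vectors.

module ListLemmas where
  open import Data.Nat.Base using (_+_)
  open ≡ using (refl; sym; trans; cong; subst)

  split-at : ∀ {a} {A : Set a} n (v : List A) → n ℕ.< length v →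
             ∃ λ p → ∃₂ λ b r → v ≡ p ++ b ∷ r × n ≡ length p
  split-at zero    (b ∷ v) n<     = [] , b , v , refl , refl
  split-at (suc n) (a ∷ v) (s≤s n<) with split-at n v n<
  ... | p , b , r , refl , refl = a ∷ p , b , r , refl , refl

  take-length-++ : ∀ {a} {A : Set a} (p r : List A) → List.take (length p) (p ++ r) ≡ p
  take-length-++ []      r = refl
  take-length-++ (a ∷ p) r = cong (a ∷_) (take-length-++ p r)

  drop-length-++ : ∀ {a} {A : Set a} (p r : List A) → List.drop (length p) (p ++ r) ≡ r
  drop-length-++ []      r = refl
  drop-length-++ (a ∷ p) r = drop-length-++ p r

  module _ {a} {A : Set a} where
    open Permutationₛ (≡.setoid A) using (Unique-resp-↭)

    unique⇒↭ : {xs ys : List A} → Unique xs → Unique ys →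
               (∀ {x} → x ∈ xs → x ∈ ys) → (∀ {x} → x ∈ ys → x ∈ xs) → xs ↭ ys
    unique⇒↭ {[]}     {[]}     _ _ _ _ = ↭-refl
    unique⇒↭ {[]}     {y ∷ ys} _ _ _ ⊇ = contradiction (⊇ (here refl)) λ ()
    unique⇒↭ {x ∷ xs} {ys} (x∉xs ∷ xs!) ys! ⊆ ⊇ with ∈ₚ.∈-∃++ (⊆ (here refl))
    ... | ys₁ , ys₂ , refl = ↭-trans (prep x (unique⇒↭ xs! rest! ⊆′ ⊇′)) (↭-sym (shift x ys₁ ys₂))
      where
      x∷rest! : Unique (x ∷ ys₁ ++ ys₂)
      x∷rest! = Unique-resp-↭ (↭.↭⇒↭ₛ (shift x ys₁ ys₂)) ys!
      rest! = AllPairs.tail x∷rest!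
      x∉rest = AllPairs.head x∷rest!
      ⊆′ : ∀ {z} → z ∈ xs → z ∈ ys₁ ++ ys₂
      ⊆′ z∈ with ∈-resp-↭ (shift x ys₁ ys₂) (⊆ (there z∈))
      ... | here refl = contradiction refl (All.lookup x∉xs z∈)
      ... | there z∈′ = z∈′
      ⊇′ : ∀ {z} → z ∈ ys₁ ++ ys₂ → z ∈ xs
      ⊇′ z∈ with ⊇ (∈-resp-↭ (↭-sym (shift x ys₁ ys₂)) (there z∈))
      ... | here refl = contradiction refl (All.lookup x∉rest z∈)
      ... | there z∈′ = z∈′

    length-filter-cong : ∀ {p q} {P : U.Pred A p} {Q : U.Pred A q} (P? : U.Decidable P) (Q? : U.Decidable Q) xs →
                         (∀ {x} → x ∈ xs → P x → Q x) → (∀ {x} → x ∈ xs → Q x → P x) →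
                         length (filter P? xs) ≡ length (filter Q? xs)
    length-filter-cong P? Q? []       to from = refl
    length-filter-cong P? Q? (x ∷ xs) to from with P? x | Q? x | length-filter-cong P? Q? xs (to ∘ there) (from ∘ there)
    ... | yes p | yes q | ih = cong suc ih
    ... | yes p | no ¬q | ih = contradiction (to (here refl) p) ¬q
    ... | no ¬p | yes q | ih = contradiction (from (here refl) q) ¬p
    ... | no ¬p | no ¬q | ih = ih

    length-filter-split : ∀ {p q} {P : U.Pred A p} {Q : U.Pred A q} (P? : U.Decidable P) (Q? : U.Decidable Q) xs →
                          (∀ {x} → Q x → P x) →
                          length (filter P? xs) ≡ length (filter Q? xs) + length (filter (λ x → P? x ×-dec ¬? (Q? x)) xs)
    length-filter-split P? Q? []       Q⊆P = refl
    length-filter-split P? Q? (x ∷ xs) Q⊆P with P? x | Q? x | length-filter-split P? Q? xs Q⊆P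
    ... | yes p | yes q | ih = cong suc ih
    ... | yes p | no ¬q | ih = trans (cong suc ih) (sym (ℕₚ.+-suc _ _))
    ... | no ¬p | yes q | ih = contradiction (Q⊆P q) ¬p
    ... | no ¬p | no ¬q | ih = ih

  bijection-↭ : ∀ {a b} {A : Set a} {B : Set b} {xs : List A} {ys : List B} (f : A → B) → Unique xs → Unique ys →
                (∀ {x} → x ∈ xs → f x ∈ ys) → (∀ {x y} → x ∈ xs → y ∈ xs → f x ≡ f y → x ≡ y) →
                (∀ {y} → y ∈ ys → ∃ λ x → x ∈ xs × f x ≡ y) → List.map f xs ↭ ys
  bijection-↭ {xs = xs} {ys} f xs! ys! to inj surj = unique⇒↭ (map! xs! inj) ys!
    (λ y∈ → case-map (∈ₚ.∈-map⁻ f y∈))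
    (λ y∈ → case-surj (surj y∈))
    where
    map! : ∀ {zs} → Unique zs → (∀ {x y} → x ∈ zs → y ∈ zs → f x ≡ f y → x ≡ y) → Unique (List.map f zs)
    map! []         _   = []
    map! (z∉ ∷ zs!) inj = Allₚ.map⁺ (All.tabulate λ y∈ eq → All.lookup z∉ y∈ (inj (here refl) (there y∈) eq))
                        ∷ map! zs! (λ x∈ y∈ → inj (there x∈) (there y∈))
    case-map : ∀ {y} → ∃ (λ x → x ∈ xs × y ≡ f x) → y ∈ ys
    case-map (x , x∈ , refl) = to x∈
    case-surj : ∀ {y} → ∃ (λ x → x ∈ xs × f x ≡ y) → y ∈ List.map f xs
    case-surj (x , x∈ , refl) = ∈ₚ.∈-map⁺ f x∈

  bijection-length : ∀ {a b} {A : Set a} {B : Set b} {xs : List A} {ys : List B} (f : A → B) → Unique xs → Unique ys →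
                     (∀ {x} → x ∈ xs → f x ∈ ys) → (∀ {x y} → x ∈ xs → y ∈ xs → f x ≡ f y → x ≡ y) →
                     (∀ {y} → y ∈ ys → ∃ λ x → x ∈ xs × f x ≡ y) → length xs ≡ length ys
  bijection-length {xs = xs} f xs! ys! to inj surj =
    trans (sym (Listₚ.length-map f xs)) (↭-length (bijection-↭ f xs! ys! to inj surj))

  AllPairs-++⁻ˡ : ∀ {a r} {A : Set a} {R : A → A → Set r} v {w} → AllPairs R (v ++ w) → AllPairs R v
  AllPairs-++⁻ˡ []      _            = []
  AllPairs-++⁻ˡ (_ ∷ v) (a∼ ∷ v++w∼) = Allₚ.++⁻ˡ v a∼ ∷ AllPairs-++⁻ˡ v v++w∼

  toList-injective : ∀ {a} {A : Set a} {n} (v w : Vec A n) → Vec.toList v ≡ Vec.toList w → v ≡ w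
  toList-injective v w eq = trans (sym (Vecₚ.cast-is-id refl v)) (Vecₚ.toList-injective refl v w eq)

  module _ {A : Set} {as : List A} where
    allVecs-unique : Unique as → ∀ m → Unique (allVecs as m)
    allVecs-unique as! zero    = [] ∷ []
    allVecs-unique as! (suc m) = Uniqueₚ.cartesianProductWith⁺ _∷_ Vecₚ.∷-injective as! (allVecs-unique as! m)

    ∈-allVecs : (∀ a → a ∈ as) → ∀ {m} (v : Vec A m) → v ∈ allVecs as m
    ∈-allVecs all []      = here refl
    ∈-allVecs all (a ∷ v) = ∈ₚ.∈-cartesianProductWith⁺ _∷_ (all a) (∈-allVecs all v)

  All-toList : ∀ {a p} {A : Set a} {P : A → Set p} {n} (v : Vec A n) → (∀ i → P (lookup v i)) → All P (toList v)
  All-toList []      p = []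
  All-toList (a ∷ v) p = p zero ∷ All-toList v (p ∘ suc)

  lookup-∈-toList : ∀ {a} {A : Set a} {n} (v : Vec A n) i → lookup v i ∈ toList v
  lookup-∈-toList (a ∷ v) zero    = here refl
  lookup-∈-toList (a ∷ v) (suc i) = there (lookup-∈-toList v i)

  toList-split : ∀ {a} {A : Set a} {n} (v : Vec A n) i → ∃₂ λ l r → toList v ≡ l ++ lookup v i ∷ r × length l ≡ toℕ i
  toList-split (a ∷ v) zero    = [] , toList v , refl , refl
  toList-split (a ∷ v) (suc i) with toList-split v i
  ... | l , r , eq , len = a ∷ l , r , cong (a ∷_) eq , cong suc len

  lookup-split : ∀ {a} {A : Set a} {n} (v : Vec A n) l {b r} → toList v ≡ l ++ b ∷ r → ∃ λ i → lookup v i ≡ b × toℕ i ≡ length l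
  lookup-split (a ∷ v) []      refl = zero , refl , refl
  lookup-split (a ∷ v) (_ ∷ l) eq with lookup-split v l (Listₚ.∷-injectiveʳ eq)
  ... | i , look , len = suc i , look , cong suc len
  lookup-split []      []      ()
  lookup-split []      (_ ∷ _) ()

  map-split : ∀ {a b} {A : Set a} {B : Set b} (f : A → B) v p {c r} → List.map f v ≡ p ++ c ∷ r →
              ∃₂ λ l a → ∃ λ s → v ≡ l ++ a ∷ s × List.map f l ≡ p × f a ≡ c
  map-split f []      []      ()
  map-split f []      (_ ∷ _) ()
  map-split f (a ∷ v) []      refl = [] , a , v , refl , refl , refl
  map-split f (a ∷ v) (_ ∷ p) eq with map-split f v p (Listₚ.∷-injectiveʳ eq)
  ... | l , b , s , refl , refl , refl = a ∷ l , b , s , refl , cong (_∷ List.map f l) (Listₚ.∷-injectiveˡ eq) , refl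

  lookup-injective : ∀ {a} {A : Set a} {l : List A} → Unique l → ∀ p q → List.lookup l p ≡ List.lookup l q → p ≡ q
  lookup-injective (_ ∷ _)   zero    zero    eq = refl
  lookup-injective (a∉ ∷ _)  zero    (suc q) eq = contradiction eq (All.lookup a∉ (∈ₚ.∈-lookup q))
  lookup-injective (a∉ ∷ _)  (suc p) zero    eq = contradiction (sym eq) (All.lookup a∉ (∈ₚ.∈-lookup p))
  lookup-injective (_ ∷ l!)  (suc p) (suc q) eq = cong suc (lookup-injective l! p q eq)

  -- Pigeonhole principle: with a missing `i` in front, `l` would list `suc m` distinct elements of
  -- `Fin m`.
  unique-complete : ∀ {m} {l : List (Fin m)} → Unique l → length l ≡ m → ∀ i → i ∈ l
  unique-complete {m} {l} l! len i with DecMembership._∈?_ _≟_ i l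
  ... | yes i∈l = i∈l
  ... | no  i∉l = contradiction (Finₚ.injective⇒≤ (λ {p} {q} → lookup-injective i∷l! p q))
      (ℕₚ.<⇒≱ (s≤s (ℕₚ.≤-reflexive (sym len))))
    where
    i∷l! : Unique (i ∷ l)
    i∷l! = All.tabulate (λ j∈l i≡j → i∉l (subst (_∈ l) (sym i≡j) j∈l)) ∷ l!

open ListLemmas

-- Words in the chain labels, shapes, and the effect of moving a letter to the end.

module Shapes (k : ℕ) where
  open import Data.Nat.Base using (_+_; _*_; _∸_)
  open ≡ using (refl; sym; trans; cong; cong₂; subst; module ≡-Reasoning)
  open +-*-Solver using (solve; _:=_; _:+_; _:*_; con)

  private
    Letter : Set
    Letter = Fin k

  open DecMembership {A = Letter} _≟_ using (_∈?_)
  open Data.List.Sort (Flip.decTotalOrder (Finₚ.≤-decTotalOrder k)) public using (sort; sort-↭)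
  open Data.List.Sort (Flip.decTotalOrder (Finₚ.≤-decTotalOrder k)) using (sort-↗)

  count : Letter → List Letter → ℕ
  count c []      = 0
  count c (d ∷ v) = ⟦ c ≟ d ⟧ + count c v

  count-++ : ∀ c v w → count c (v ++ w) ≡ count c v + count c w
  count-++ c []      w = refl
  count-++ c (d ∷ v) w = trans (cong (⟦ c ≟ d ⟧ +_) (count-++ c v w)) (sym (ℕₚ.+-assoc ⟦ c ≟ d ⟧ _ _))

  count-here : ∀ c v → count c (c ∷ v) ≡ suc (count c v)
  count-here c v = cong (_+ count c v) (⟦⟧-yes (c ≟ c) refl)

  count-↭ : ∀ c {v w} → v ↭ w → count c v ≡ count c w
  count-↭ c ↭.refl        = refl
  count-↭ c (prep d p)    = cong (⟦ c ≟ d ⟧ +_) (count-↭ c p)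
  count-↭ c (swap d e p)  = trans (cong (λ n → ⟦ c ≟ d ⟧ + (⟦ c ≟ e ⟧ + n)) (count-↭ c p))
    (solve 3 (λ x y z → x :+ (y :+ z) := y :+ (x :+ z)) refl ⟦ c ≟ d ⟧ ⟦ c ≟ e ⟧ _)
  count-↭ c (↭.trans p q) = trans (count-↭ c p) (count-↭ c q)

  count>0⇒∈ : ∀ c v → 0 ℕ.< count c v → c ∈ v
  count>0⇒∈ c (d ∷ v) 0< with c ≟ d
  ... | yes c≡d = here c≡d
  ... | no  _   = there (count>0⇒∈ c v 0<)

  ∈⇒count>0 : ∀ {c v} → c ∈ v → 0 ℕ.< count c v
  ∈⇒count>0 {c} {d ∷ v} (here refl) = subst (0 ℕ.<_) (sym (count-here c v)) (s≤s z≤n)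
  ∈⇒count>0 {c} {d ∷ v} (there c∈v) = ℕₚ.≤-trans (∈⇒count>0 c∈v) (ℕₚ.m≤n+m _ _)

  count⇒↭ : ∀ {v w} → (∀ c → count c v ≡ count c w) → v ↭ w
  count⇒↭ {[]} {[]}    eq = ↭-refl
  count⇒↭ {[]} {d ∷ w} eq = contradiction (trans (eq d) (count-here d w)) λ ()
  count⇒↭ {c ∷ v} {w}  eq with ∈ₚ.∈-∃++ (count>0⇒∈ c w (subst (0 ℕ.<_) (trans (sym (count-here c v)) (eq c)) (s≤s z≤n)))
  ... | w₁ , w₂ , refl = ↭-trans (prep c (count⇒↭ λ d → ℕₚ.+-cancelˡ-≡ ⟦ d ≟ c ⟧ _ _
                           (trans (eq d) (count-↭ d (shift c w₁ w₂))))) (↭-sym (shift c w₁ w₂))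

  infix 4 _↭?_
  abstract
    _↭?_ : (v w : List Letter) → Dec (v ↭ w)
    v ↭? w = map′ count⇒↭ (λ p c → count-↭ c p) (Finₚ.all? λ c → count c v ℕₚ.≟ count c w)

  -- rm c q deletes the occurrence number q of c, counted from 0.
  rm : Letter → ℕ → List Letter → List Letter
  rm c q       []      = []
  rm c q       (d ∷ v) with c ≟ d
  rm c zero    (d ∷ v) | yes _ = v
  rm c (suc q) (d ∷ v) | yes _ = d ∷ rm c q v
  rm c q       (d ∷ v) | no  _ = d ∷ rm c q v

  rm-↭ : ∀ c q v → q ℕ.< count c v → c ∷ rm c q v ↭ v
  rm-↭ c q       (d ∷ v) q<       with c ≟ d
  rm-↭ c zero    (d ∷ v) q<       | yes refl = ↭-refl
  rm-↭ c (suc q) (d ∷ v) (s≤s q<) | yes refl = prep d (rm-↭ c q v q<)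
  rm-↭ c q       (d ∷ v) q<       | no  _    = ↭-trans (swap c d ↭-refl) (prep d (rm-↭ c q v q<))

  rm-++ˡ : ∀ c q p r → q ℕ.< count c p → rm c q (p ++ r) ≡ rm c q p ++ r
  rm-++ˡ c q       (d ∷ p) r q<       with c ≟ d
  rm-++ˡ c zero    (d ∷ p) r q<       | yes _ = refl
  rm-++ˡ c (suc q) (d ∷ p) r (s≤s q<) | yes _ = cong (d ∷_) (rm-++ˡ c q p r q<)
  rm-++ˡ c q       (d ∷ p) r q<       | no  _ = cong (d ∷_) (rm-++ˡ c q p r q<)

  rm-++ʳ : ∀ c q p r → count c p ℕ.≤ q → rm c q (p ++ r) ≡ p ++ rm c (q ∸ count c p) r
  rm-++ʳ c q       []      r ≤q       = refl
  rm-++ʳ c q       (d ∷ p) r ≤q       with c ≟ d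
  rm-++ʳ c (suc q) (d ∷ p) r (s≤s ≤q) | yes _ = cong (d ∷_) (rm-++ʳ c q p r ≤q)
  rm-++ʳ c q       (d ∷ p) r ≤q       | no  _ = cong (d ∷_) (rm-++ʳ c q p r ≤q)

  All-rm : ∀ {P : Letter → Set} c q {v} → All P v → All P (rm c q v)
  All-rm c q           []           = []
  All-rm c q {d ∷ _}   (px ∷ pxs)   with c ≟ d
  All-rm c zero        (px ∷ pxs)   | yes _ = pxs
  All-rm c (suc q)     (px ∷ pxs)   | yes _ = px ∷ All-rm c q pxs
  All-rm c q           (px ∷ pxs)   | no  _ = px ∷ All-rm c q pxs

  AllPairs-rm : ∀ {R : Letter → Letter → Set} c q {v} → AllPairs R v → AllPairs R (rm c q v)
  AllPairs-rm c q           []           = []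
  AllPairs-rm c q {d ∷ _}   (px ∷ pxs)   with c ≟ d
  AllPairs-rm c zero        (px ∷ pxs)   | yes _ = pxs
  AllPairs-rm c (suc q)     (px ∷ pxs)   | yes _ = All-rm c q px ∷ AllPairs-rm c q pxs
  AllPairs-rm c q           (px ∷ pxs)   | no  _ = All-rm c q px ∷ AllPairs-rm c q pxs

  Descending : List Letter → Set
  Descending = AllPairs Fin._≥_

  sort-descending : ∀ v → Descending (sort v)
  sort-descending v = Sorted⇒AllPairs (Flip.totalOrder (Finₚ.≤-totalOrder k)) (sort-↗ v)

  -- block D₁ b₁ (⋯ (block Dᵣ bᵣ (last U))) stands for the words obtained from D₁ b₁ ⋯ Dᵣ bᵣ U by
  -- rearranging D₁, …, Dᵣ and U; match is the indicator function of this set of words.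
  data Shape : Set where
    last  : List Letter → Shape
    block : List Letter → Letter → Shape → Shape

  body : Shape → List Letter
  body (last U)      = []
  body (block D b F) = D ++ b ∷ body F

  rest : Shape → List Letter
  rest (last U)      = U
  rest (block D b F) = rest F

  flatten : Shape → List Letter
  flatten (last U)      = U
  flatten (block D b F) = D ++ b ∷ flatten F

  flatten≡body++rest : ∀ F → flatten F ≡ body F ++ rest F
  flatten≡body++rest (last U)      = refl
  flatten≡body++rest (block D b F) =
    trans (cong (λ w → D ++ b ∷ w) (flatten≡body++rest F)) (sym (Listₚ.++-assoc D (b ∷ body F) (rest F)))

  match : Shape → List Letter → ℕ
  match-from : Letter → Shape → List Letter → ℕ
  match (last U)      v = ⟦ U ↭? v ⟧
  match (block D b F) v = ⟦ D ↭? List.take (length D) v ⟧ * match-from b F (List.drop (length D) v)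
  match-from b F []      = 0
  match-from b F (a ∷ v) = ⟦ b ≟ a ⟧ * match F v

  match-block : ∀ D b F p r → length D ≡ length p → match (block D b F) (p ++ r) ≡ ⟦ D ↭? p ⟧ * match-from b F r
  match-block D b F p r eq rewrite eq | take-length-++ p r | drop-length-++ p r = refl

  match? : Maybe Shape → List Letter → ℕ
  match? F v = maybe′ (λ F → match F v) 0 F

  ∑match : List Shape → List Letter → ℕ
  ∑match Fs v = sumᴸ (List.map (λ F → match F v) Fs)

  ∑match-++ : ∀ Fs Gs v → ∑match (Fs ++ Gs) v ≡ ∑match Fs v + ∑match Gs v
  ∑match-++ Fs Gs v = trans (cong sumᴸ (Listₚ.map-++ _ Fs Gs)) (sum-++ (List.map _ Fs) _)

  -- The shape of the words `u` for which `u ++ [ c ]` is matched. With an empty last part, the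
  -- final letter is the `b` of the innermost block; it disappears, and the `D` of that block
  -- becomes the last part.
  unsnoc : Letter → Shape → Maybe Shape
  unsnoc c (last U)                         = if does (c ∈? U) then just (last (rm c 0 U)) else nothing
  unsnoc c (block D b (last []))            = if does (b ≟ c) then just (last D) else nothing
  unsnoc c (block D b F@(last (_ ∷ _)))     = Maybe.map (block D b) (unsnoc c F)
  unsnoc c (block D b F@(block _ _ _))      = Maybe.map (block D b) (unsnoc c F)

  -- The two recursive clauses of `unsnoc` differ only in their patterns; this view restores their
  -- common equation, so that proofs treat them once.
  data FinalBlock : Shape → Set where
    empty    : FinalBlock (last [])
    nonempty : ∀ {F} → 0 ℕ.< length (flatten F) →
               (∀ c D b → unsnoc c (block D b F) ≡ Maybe.map (block D b) (unsnoc c F)) → FinalBlock F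

  finalBlock : ∀ F → FinalBlock F
  finalBlock (last [])      = empty
  finalBlock (last (u ∷ U)) = nonempty (s≤s z≤n) λ _ _ _ → refl
  finalBlock (block D b F)  = nonempty (subst (0 ℕ.<_) (sym (trans (Listₚ.length-++ D) (ℕₚ.+-suc _ _))) (s≤s z≤n)) λ _ _ _ → refl

  length-++-∷ : ∀ D (b : Letter) w → length (D ++ b ∷ w) ≡ suc (length D + length w)
  length-++-∷ D b w = trans (Listₚ.length-++ D) (ℕₚ.+-suc _ _)

  match-map-block : ∀ m D b p a r → length D ≡ length p →
                    match? (Maybe.map (block D b) m) (p ++ a ∷ r) ≡ ⟦ D ↭? p ⟧ * (⟦ b ≟ a ⟧ * match? m r)
  match-map-block (just F) D b p a r eq = match-block D b F p (a ∷ r) eq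
  match-map-block nothing  D b p a r eq = sym (trans (cong (⟦ D ↭? p ⟧ *_) (ℕₚ.*-zeroʳ ⟦ b ≟ a ⟧)) (ℕₚ.*-zeroʳ ⟦ D ↭? p ⟧))

  -- A word is cut into its parts by their lengths alone. Given the right total length, the final
  -- letter therefore belongs to the last part, or is the innermost `b` if that part is empty.
  match-snoc : ∀ c F u → length (flatten F) ≡ suc (length u) → match F (u ++ [ c ]) ≡ match? (unsnoc c F) u
  match-snoc c (last U) u eq with c ∈? U
  ... | no c∉U = ⟦⟧-no (U ↭? _) λ p → c∉U (∈-resp-↭ (↭-trans (∷↭∷ʳ c u) (↭-sym p)) (here refl))
  ... | yes c∈U = ⟦⟧-cong (U ↭? _) (rm c 0 U ↭? u)
      (λ p → drop-∷ (↭-trans rm-c (↭-trans p (↭-sym (∷↭∷ʳ c u)))))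
      (λ p → ↭-trans (↭-sym rm-c) (↭-trans (prep c p) (∷↭∷ʳ c u)))
    where
    rm-c : c ∷ rm c 0 U ↭ U
    rm-c = rm-↭ c 0 U (∈⇒count>0 c∈U)
  match-snoc c (block D b F) u eq with finalBlock F
  ... | empty rewrite match-block D b (last []) u [ c ] (ℕₚ.suc-injective (trans (sym (trans (length-++-∷ D b []) (cong suc (ℕₚ.+-identityʳ _)))) eq)) with b ≟ c
  ...   | yes _ = trans (cong (λ n → ⟦ D ↭? u ⟧ * (1 * n)) (⟦⟧-yes ([] ↭? []) ↭-refl)) (ℕₚ.*-identityʳ _)
  ...   | no  _ = ℕₚ.*-zeroʳ ⟦ D ↭? u ⟧
  match-snoc c (block D b F) u eq | nonempty 0< unsnoc-block
    with split-at (length D) u (subst (length D ℕ.<_) eq′ (ℕₚ.m<m+n (length D) 0<))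
      where eq′ = ℕₚ.suc-injective (trans (sym (length-++-∷ D b _)) eq)
  ... | p , a , r , refl , D≡p rewrite unsnoc-block c D b = begin
    match (block D b F) ((p ++ a ∷ r) ++ [ c ])
      ≡⟨ cong (match (block D b F)) (Listₚ.++-assoc p (a ∷ r) [ c ]) ⟩
    match (block D b F) (p ++ a ∷ r ++ [ c ])
      ≡⟨ match-block D b F p _ D≡p ⟩
    ⟦ D ↭? p ⟧ * (⟦ b ≟ a ⟧ * match F (r ++ [ c ]))
      ≡⟨ cong (λ n → ⟦ D ↭? p ⟧ * (⟦ b ≟ a ⟧ * n)) (match-snoc c F r lengths) ⟩
    ⟦ D ↭? p ⟧ * (⟦ b ≟ a ⟧ * match? (unsnoc c F) r)
      ≡⟨ match-map-block (unsnoc c F) D b p a r D≡p ⟨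
    match? (Maybe.map (block D b) (unsnoc c F)) (p ++ a ∷ r) ∎
    where
    open ≡-Reasoning
    lengths : length (flatten F) ≡ suc (length r)
    lengths = ℕₚ.+-cancelˡ-≡ (length p) _ _ (begin
      length p + length (flatten F)         ≡⟨ cong (_+ _) D≡p ⟨
      length D + length (flatten F)         ≡⟨ ℕₚ.suc-injective (trans (sym (length-++-∷ D b _)) eq) ⟩
      length (p ++ a ∷ r)                   ≡⟨ Listₚ.length-++ p ⟩
      length p + suc (length r)             ∎)

  -- If F matches v once its c number q is moved to the end, then either F matches v, or v has one c
  -- more in some block and one c less in the last part; the latter shapes of v are listed here.
  lower : Letter → ℕ → Shape → List Shape
  lower c q (last U)      = []
  lower c q (block D b F) =
    (if does (q ℕₚ.≤? count c D) then List.fromMaybe (unsnoc c (block (sort (c ∷ D)) b F)) else []) ++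
    (if does (count c (b ∷ D) ℕₚ.≤? q) then List.map (block D b) (lower c (q ∸ count c (b ∷ D)) F) else [])

  ∑match-fromMaybe : ∀ m v → ∑match (List.fromMaybe m) v ≡ match? m v
  ∑match-fromMaybe (just F) v = ℕₚ.+-identityʳ _
  ∑match-fromMaybe nothing  v = refl

  ∑match-map-block : ∀ Fs D b p a r → length D ≡ length p →
                     ∑match (List.map (block D b) Fs) (p ++ a ∷ r) ≡ ⟦ D ↭? p ⟧ * (⟦ b ≟ a ⟧ * ∑match Fs r)
  ∑match-map-block []       D b p a r eq = sym (trans (cong (⟦ D ↭? p ⟧ *_) (ℕₚ.*-zeroʳ ⟦ b ≟ a ⟧)) (ℕₚ.*-zeroʳ ⟦ D ↭? p ⟧))
  ∑match-map-block (F ∷ Fs) D b p a r eq = trans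
    (cong₂ _+_ (match-block D b F p (a ∷ r) eq) (∑match-map-block Fs D b p a r eq))
    (solve 4 (λ x y m s → x :* (y :* m) :+ x :* (y :* s) := x :* (y :* (m :+ s))) refl ⟦ D ↭? p ⟧ ⟦ b ≟ a ⟧ _ _)

  ∑match-if : ∀ {p} {P : Set p} (P? : Dec P) Fs v → ∑match (if does P? then Fs else []) v ≡ ⟦ P? ⟧ * ∑match Fs v
  ∑match-if (yes _) Fs v = sym (ℕₚ.*-identityˡ _)
  ∑match-if (no  _) Fs v = refl

  -- Let `y` be the first `suc (length D)` letters of `v`. If the moved letter lies in `y`, the
  -- others must rearrange `D`; so `y` rearranges `c ∷ D`, and `v ++ [ c ]` is matched by the block
  -- enlarged by `c`, which explains the `unsnoc` in `lower`. Otherwise `y` stays in place and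
  -- induction applies behind it. When `b ≢ c` and `q ≡ count c D`, both tests in `lower` succeed;
  -- it then depends on `v` which of the two summands can be nonzero.
  match-move : ∀ c q F v → length (flatten F) ≡ length v → q ℕ.< count c v →
               match F (rm c q v ++ [ c ]) ≡ ⟦ count c (body F) ℕₚ.≤? q ⟧ * match F v + ∑match (lower c q F) v
  match-move c q (last U) v eq q< = begin
    ⟦ U ↭? rm c q v ++ [ c ] ⟧
      ≡⟨ ⟦⟧-cong (U ↭? _) (U ↭? v) (λ p → ↭-trans p moved) (λ p → ↭-trans p (↭-sym moved)) ⟩
    ⟦ U ↭? v ⟧
      ≡⟨ solve 1 (λ x → x := con 1 :* x :+ con 0) refl _ ⟩
    1 * ⟦ U ↭? v ⟧ + 0
      ≡⟨ cong (λ n → n * ⟦ U ↭? v ⟧ + 0) (⟦⟧-yes (0 ℕₚ.≤? q) z≤n) ⟨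
    ⟦ 0 ℕₚ.≤? q ⟧ * ⟦ U ↭? v ⟧ + 0 ∎
    where
    open ≡-Reasoning
    moved : rm c q v ++ [ c ] ↭ v
    moved = ↭-trans (↭-sym (∷↭∷ʳ c _)) (rm-↭ c q v q<)
  match-move c q (block D b F) v eq q<
    with split-at (length D) v (subst (length D ℕ.<_) (trans (sym (length-++-∷ D b _)) eq) (s≤s (ℕₚ.m≤m+n (length D) _)))
  ... | p , a , r , refl , D≡p = trans main (cong (A * match (block D b F) v +_) (sym ∑lower))
    where
    open ≡-Reasoning
    m = count c (b ∷ D)
    y = p ++ [ a ]
    G = block (sort (c ∷ D)) b F
    A = ⟦ count c (body (block D b F)) ℕₚ.≤? q ⟧
    y++r : p ++ a ∷ r ≡ y ++ r
    y++r = sym (Listₚ.++-assoc p [ a ] r)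
    near far : ℕ
    near = ⟦ q ℕₚ.≤? count c D ⟧ * (⟦ sort (c ∷ D) ↭? y ⟧ * match-from b F (r ++ [ c ]))
    far  = ⟦ m ℕₚ.≤? q ⟧ * (⟦ D ↭? p ⟧ * (⟦ b ≟ a ⟧ * ∑match (lower c (q ∸ m) F) r))
    length-y : length y ≡ suc (length p)
    length-y = trans (length-++-∷ p a []) (cong suc (ℕₚ.+-identityʳ _))
    length-sort : length (sort (c ∷ D)) ≡ suc (length D)
    length-sort = ↭-length (sort-↭ (c ∷ D))
    ∑lower : ∑match (lower c q (block D b F)) v ≡ near + far
    ∑lower = begin
      ∑match (lower c q (block D b F)) v
        ≡⟨ ∑match-++ (if does (q ℕₚ.≤? count c D) then List.fromMaybe (unsnoc c G) else []) _ v ⟩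
      ∑match (if does (q ℕₚ.≤? count c D) then List.fromMaybe (unsnoc c G) else []) v + _
        ≡⟨ cong₂ _+_ (∑match-if (q ℕₚ.≤? count c D) _ v) (∑match-if (m ℕₚ.≤? q) _ v) ⟩
      ⟦ q ℕₚ.≤? count c D ⟧ * ∑match (List.fromMaybe (unsnoc c G)) v + ⟦ m ℕₚ.≤? q ⟧ * ∑match (List.map (block D b) (lower c (q ∸ m) F)) v
        ≡⟨ cong₂ (λ n o → ⟦ q ℕₚ.≤? count c D ⟧ * n + ⟦ m ℕₚ.≤? q ⟧ * o) near-eq (∑match-map-block (lower c (q ∸ m) F) D b p a r D≡p) ⟩
      near + far ∎
      where
      near-eq : ∑match (List.fromMaybe (unsnoc c G)) v ≡ ⟦ sort (c ∷ D) ↭? y ⟧ * match-from b F (r ++ [ c ])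
      near-eq = begin
        ∑match (List.fromMaybe (unsnoc c G)) v ≡⟨ ∑match-fromMaybe (unsnoc c G) v ⟩
        match? (unsnoc c G) v                  ≡⟨ match-snoc c G v (trans (length-++-∷ (sort (c ∷ D)) b _) (cong suc
                                                    (trans (cong (_+ _) length-sort) (trans (sym (length-++-∷ D b _)) eq)))) ⟨
        match G (v ++ [ c ])                   ≡⟨ cong (match G) (trans (cong (_++ [ c ]) y++r) (Listₚ.++-assoc y r [ c ])) ⟩
        match G (y ++ (r ++ [ c ]))            ≡⟨ match-block _ b F y _ (trans length-sort (trans (cong suc D≡p) (sym length-y))) ⟩
        ⟦ sort (c ∷ D) ↭? y ⟧ * match-from b F (r ++ [ c ]) ∎
    count-v : count c v ≡ count c y + count c r
    count-v = trans (cong (count c) y++r) (count-++ c y r)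
    count-y : D ↭ p → b ≡ a → count c y ≡ m
    count-y D↭p refl = count-↭ c (↭-trans (↭-sym (∷↭∷ʳ a p)) (prep a (↭-sym D↭p)))
    count-body : count c (body (block D b F)) ≡ m + count c (body F)
    count-body = trans (count-++ c D (b ∷ body F))
      (solve 3 (λ d e f → d :+ (e :+ f) := (e :+ d) :+ f) refl (count c D) ⟦ c ≟ b ⟧ (count c (body F)))
    main : match (block D b F) (rm c q v ++ [ c ]) ≡ A * match (block D b F) v + (near + far)
    main with q ℕₚ.<? count c y
    ... | yes q<y = begin
      match (block D b F) (rm c q v ++ [ c ])
        ≡⟨ cong (match (block D b F)) (trans (cong (λ w → rm c q w ++ [ c ]) y++r)
             (trans (cong (_++ [ c ]) (rm-++ˡ c q y r q<y)) (Listₚ.++-assoc (rm c q y) r [ c ]))) ⟩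
      match (block D b F) (rm c q y ++ (r ++ [ c ]))
        ≡⟨ match-block D b F (rm c q y) _ (trans D≡p (ℕₚ.suc-injective (trans (sym length-y) (sym (↭-length rm-y))))) ⟩
      ⟦ D ↭? rm c q y ⟧ * match-from b F (r ++ [ c ])
        ≡⟨ cong (_* match-from b F (r ++ [ c ])) (⟦⟧-× (D ↭? rm c q y) (q ℕₚ.≤? count c D) (sort (c ∷ D) ↭? y) to from) ⟩
      ⟦ q ℕₚ.≤? count c D ⟧ * ⟦ sort (c ∷ D) ↭? y ⟧ * match-from b F (r ++ [ c ])
        ≡⟨ ℕₚ.*-assoc ⟦ q ℕₚ.≤? count c D ⟧ ⟦ sort (c ∷ D) ↭? y ⟧ _ ⟩
      near
        ≡⟨ solve 1 (λ x → x := con 0 :+ (x :+ con 0)) refl near ⟩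
      0 + (near + 0)
        -- If `y` rearranged `D` and `b`, it would contain `m` letters `c`, more than `q`; this is
        -- incompatible with either of the two remaining tests.
        ≡⟨ cong₂ (λ x z → x + (near + z))
             (trans (cong (A *_) (match-block D b F p (a ∷ r) D≡p)) (⟦⟧-vanish (count c (body (block D b F)) ℕₚ.≤? q) (D ↭? p) (b ≟ a) _
               λ D↭p b≡a body≤q → ℕₚ.<⇒≱ q<y (ℕₚ.≤-trans (ℕₚ.≤-reflexive (count-y D↭p b≡a))
                 (ℕₚ.≤-trans (ℕₚ.m≤m+n m _) (ℕₚ.≤-trans (ℕₚ.≤-reflexive (sym count-body)) body≤q)))))
             (⟦⟧-vanish (m ℕₚ.≤? q) (D ↭? p) (b ≟ a) _
               λ D↭p b≡a m≤q → ℕₚ.<⇒≱ q<y (ℕₚ.≤-trans (ℕₚ.≤-reflexive (count-y D↭p b≡a)) m≤q)) ⟨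
      A * match (block D b F) v + (near + far) ∎
      where
      rm-y : c ∷ rm c q y ↭ y
      rm-y = rm-↭ c q y q<y
      to : D ↭ rm c q y → q ℕ.≤ count c D × sort (c ∷ D) ↭ y
      to p′ = ℕₚ.≤-pred (subst (q ℕ.<_) (trans (sym (count-↭ c c∷D↭y)) (count-here c D)) q<y) , ↭-trans (sort-↭ (c ∷ D)) c∷D↭y
        where
        c∷D↭y : c ∷ D ↭ y
        c∷D↭y = ↭-trans (prep c p′) rm-y
      from : q ℕ.≤ count c D → sort (c ∷ D) ↭ y → D ↭ rm c q y
      from _ p′ = drop-∷ (↭-trans (↭-trans (↭-sym (sort-↭ (c ∷ D))) p′) (↭-sym rm-y))
    ... | no q≮y = begin
      match (block D b F) (rm c q v ++ [ c ])
        ≡⟨ cong (match (block D b F)) (trans (cong (λ w → rm c q w ++ [ c ]) y++r)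
             (trans (cong (_++ [ c ]) (rm-++ʳ c q y r y≤q))
             (trans (Listₚ.++-assoc y _ [ c ]) (Listₚ.++-assoc p [ a ] _)))) ⟩
      match (block D b F) (p ++ a ∷ (rm c q′ r ++ [ c ]))
        ≡⟨ match-block D b F p _ D≡p ⟩
      ⟦ D ↭? p ⟧ * (⟦ b ≟ a ⟧ * match F (rm c q′ r ++ [ c ]))
        ≡⟨ cong (λ n → ⟦ D ↭? p ⟧ * (⟦ b ≟ a ⟧ * n)) (match-move c q′ F r lengths q′<r) ⟩
      ⟦ D ↭? p ⟧ * (⟦ b ≟ a ⟧ * (⟦ count c (body F) ℕₚ.≤? q′ ⟧ * match F r + ∑match (lower c q′ F) r))
        -- The recursion subtracts `count c y`, whereas `lower` subtracts `m`. They coincide once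
        -- `D ↭ p` and `b ≡ a`, which the two indicators in front permit to assume.
        ≡⟨ ⟦⟧*⟦⟧-cong (D ↭? p) (b ≟ a) agree ⟩
      ⟦ D ↭? p ⟧ * (⟦ b ≟ a ⟧ * (A * match F r + ⟦ m ℕₚ.≤? q ⟧ * ∑match (lower c (q ∸ m) F) r))
        ≡⟨ solve 6 (λ x z A M B S → x :* (z :* (A :* M :+ B :* S)) := A :* (x :* (z :* M)) :+ (con 0 :+ B :* (x :* (z :* S)))) refl
             ⟦ D ↭? p ⟧ ⟦ b ≟ a ⟧ A (match F r) ⟦ m ℕₚ.≤? q ⟧ _ ⟩
      A * (⟦ D ↭? p ⟧ * (⟦ b ≟ a ⟧ * match F r)) + (0 + far)
        ≡⟨ cong₂ (λ x z → A * x + (z + far)) (match-block D b F p (a ∷ r) D≡p) near≡0 ⟨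
      A * match (block D b F) v + (near + far) ∎
      where
      y≤q = ℕₚ.≮⇒≥ q≮y
      q′ = q ∸ count c y
      q′<r : q′ ℕ.< count c r
      q′<r = ℕₚ.+-cancelˡ-< (count c y) _ _ (ℕₚ.≤-<-trans (ℕₚ.≤-reflexive (ℕₚ.m+[n∸m]≡n y≤q)) (ℕₚ.<-≤-trans q< (ℕₚ.≤-reflexive count-v)))
      lengths : length (flatten F) ≡ length r
      lengths = ℕₚ.+-cancelˡ-≡ (length p) _ _ (ℕₚ.suc-injective (begin
        suc (length p + length (flatten F))  ≡⟨ cong (λ n → suc (n + _)) D≡p ⟨
        suc (length D + length (flatten F))  ≡⟨ length-++-∷ D b _ ⟨
        length (D ++ b ∷ flatten F)          ≡⟨ eq ⟩
        length (p ++ a ∷ r)                  ≡⟨ length-++-∷ p a r ⟩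
        suc (length p + length r)            ∎))
      -- If `y` rearranges `c ∷ D`, then it contains `suc (count c D)` letters `c`, so `q` exceeds
      -- `count c D`.
      near≡0 : near ≡ 0
      near≡0 with sort (c ∷ D) ↭? y
      ... | no  _ = ℕₚ.*-zeroʳ ⟦ q ℕₚ.≤? count c D ⟧
      ... | yes s = cong (_* (1 * match-from b F (r ++ [ c ]))) (⟦⟧-no (q ℕₚ.≤? count c D) λ q≤D →
          ℕₚ.<⇒≱ (s≤s q≤D) (ℕₚ.≤-trans (ℕₚ.≤-reflexive (trans (sym (count-here c D)) (count-↭ c (↭-trans (↭-sym (sort-↭ (c ∷ D))) s)))) y≤q))
      agree : D ↭ p → b ≡ a → ⟦ count c (body F) ℕₚ.≤? q′ ⟧ * match F r + ∑match (lower c q′ F) r ≡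
                              A * match F r + ⟦ m ℕₚ.≤? q ⟧ * ∑match (lower c (q ∸ m) F) r
      agree D↭p b≡a rewrite count-y D↭p b≡a = cong₂ _+_
        (cong (_* match F r) (⟦⟧-cong (count c (body F) ℕₚ.≤? q ∸ m) (count c (body (block D b F)) ℕₚ.≤? q)
          (λ le → ℕₚ.≤-trans (ℕₚ.≤-reflexive count-body) (ℕₚ.≤-trans (ℕₚ.+-monoʳ-≤ m le) (ℕₚ.≤-reflexive (ℕₚ.m+[n∸m]≡n m≤q))))
          (λ le → ℕₚ.≤-trans (ℕₚ.≤-reflexive (sym (ℕₚ.m+n∸m≡n m _))) (ℕₚ.∸-monoˡ-≤ m (ℕₚ.≤-trans (ℕₚ.≤-reflexive (sym count-body)) le)))))
        (trans (sym (ℕₚ.*-identityˡ _)) (cong (_* ∑match (lower c (q ∸ m) F) r) (sym (⟦⟧-yes (m ℕₚ.≤? q) m≤q))))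
        where
        m≤q : m ℕ.≤ q
        m≤q = ℕₚ.≤-trans (ℕₚ.≤-reflexive (sym (count-y D↭p b≡a))) y≤q

-- The factorisation of a word, its weight, and the lexicographic order.

module Parsing (k : ℕ) where
  open import Data.Nat.Base using (_+_; _*_; _∸_; _^_)
  open ≡ using (refl; sym; trans; cong; cong₂; subst)
  open Shapes k

  private
    Letter : Set
    Letter = Fin k

  open DecMembership {A = Letter} _≟_ using (_∈?_)

  -- For descending `D`, some letter is below `b` exactly when the last one is. The form with `Any`
  -- does not depend on the order of the letters and persists when `D` gains a letter and is sorted
  -- again.
  data Valid : Shape → Set where
    last  : ∀ {U} → Descending U → Valid (last U)
    block : ∀ {D b F} → Descending D → Any (Fin._< b) D → Valid F → Valid (block D b F)

  -- Every `b` contributes the number of letters from it to the end. The letters of the `D` in front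
  -- of it do not count, so enlarging that `D` is free, whereas deleting the final letter afterwards
  -- strictly lowers the weight.
  weight : Shape → ℕ
  weight (last U)      = 0
  weight (block D b F) = suc (length (flatten F) + weight F)

  unsnoc-block : ∀ c {D b F} → Valid (block D b F) →
                 MaybeAll.All (λ G → Valid G × c ∷ flatten G ↭ D ++ b ∷ flatten F × weight G ℕ.< weight (block D b F))
                              (unsnoc c (block D b F))
  unsnoc-valid : ∀ c {F} → Valid F →
                 MaybeAll.All (λ G → Valid G × c ∷ flatten G ↭ flatten F × weight G ℕ.≤ weight F) (unsnoc c F)
  unsnoc-valid c {last U} (last U↓) with c ∈? U
  ... | yes c∈U = MaybeAll.just (last (AllPairs-rm c 0 U↓) , rm-↭ c 0 U (∈⇒count>0 c∈U) , z≤n)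
  ... | no  _   = MaybeAll.nothing
  unsnoc-valid c {block D b F} F-valid =
    MaybeAll.map (λ { (G-valid , p , lt) → G-valid , p , ℕₚ.<⇒≤ lt }) (unsnoc-block c F-valid)
  unsnoc-block c {D} {b} {F} (block D↓ D<b F-valid) with finalBlock F
  unsnoc-block c {D} {b} (block D↓ D<b F-valid) | empty with b ≟ c
  ... | yes refl = MaybeAll.just (last D↓ , ∷↭∷ʳ b D , s≤s z≤n)
  ... | no  _    = MaybeAll.nothing
  unsnoc-block c {D} {b} {F} (block D↓ D<b F-valid) | nonempty _ eq rewrite eq c D b
    with unsnoc c F | unsnoc-valid c F-valid
  ... | nothing | _ = MaybeAll.nothing
  ... | just G  | MaybeAll.just (G-valid , p , le) = MaybeAll.just
    ( block D↓ D<b G-valid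
    , ↭-trans (↭-sym (shift c D (b ∷ flatten G))) (++⁺ˡ D (↭-trans (swap c b ↭-refl) (prep b p)))
    , s≤s (ℕₚ.+-mono-≤ (ℕₚ.≤-reflexive (↭-length p)) le))

  All-fromMaybe : ∀ {P : Shape → Set} {m} → MaybeAll.All P m → All P (List.fromMaybe m)
  All-fromMaybe (MaybeAll.just px) = px ∷ []
  All-fromMaybe MaybeAll.nothing   = []

  All-if : ∀ {p} {Q : Set p} {P : Shape → Set} (Q? : Dec Q) {Fs} → All P Fs → All P (if does Q? then Fs else [])
  All-if (yes _) ps = ps
  All-if (no  _) ps = []

  -- Validity and equal content make each new shape the factorisation of another linear extension,
  -- hence a row of `E`; the drop in weight makes `L` triangular.
  lower-valid : ∀ c q {F} → Valid F → All (λ G → Valid G × flatten G ↭ flatten F × weight G ℕ.< weight F) (lower c q F)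
  lower-valid c q {last U}      F-valid = []
  lower-valid c q {block D b F} (block D↓ D<b F-valid) = Allₚ.++⁺
    (All-if (q ℕₚ.≤? count c D) (All.map
      (λ { (G-valid , p , lt) → G-valid , drop-∷ (↭-trans p (++⁺ʳ _ (sort-↭ (c ∷ D)))) , lt })
      (All-fromMaybe (unsnoc-block c (block (sort-descending (c ∷ D)) (Any-resp-↭ (↭-sym (sort-↭ (c ∷ D))) (there D<b)) F-valid)))))
    (All-if (count c (b ∷ D) ℕₚ.≤? q) (Allₚ.map⁺ (All.map
      (λ { (G-valid , p , lt) → block D↓ D<b G-valid , ++⁺ˡ D (prep b p)
                              , s≤s (ℕₚ.+-mono-≤-< (ℕₚ.≤-reflexive (↭-length p)) lt) })
      (lower-valid c (q ∸ count c (b ∷ D)) F-valid))))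

  push : Letter → Shape → Shape
  push c (last U)      = last (c ∷ U)
  push c (block D b F) = block (c ∷ D) b F

  -- `parse₁ d w` reads on from the letter `d` of the current run. The letter that ends the run by
  -- an ascent is set apart as `b` and is not compared with its successor, where `parse` starts
  -- afresh.
  parse  : List Letter → Shape
  parse₁ : Letter → List Letter → Shape
  parse []           = last []
  parse (d ∷ w)      = parse₁ d w
  parse₁ d []        = last [ d ]
  parse₁ d (e ∷ w) with e Finₚ.≤? d
  ... | yes _ = push d (parse₁ e w)
  ... | no  _ = block [ d ] e (parse w)

  flatten-push : ∀ c F → flatten (push c F) ≡ c ∷ flatten F
  flatten-push c (last U)      = refl
  flatten-push c (block D b F) = refl

  flatten-parse  : ∀ w → flatten (parse w) ≡ w
  flatten-parse₁ : ∀ d w → flatten (parse₁ d w) ≡ d ∷ w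
  flatten-parse []      = refl
  flatten-parse (d ∷ w) = flatten-parse₁ d w
  flatten-parse₁ d []      = refl
  flatten-parse₁ d (e ∷ w) with e Finₚ.≤? d
  ... | yes _ = trans (flatten-push d (parse₁ e w)) (cong (d ∷_) (flatten-parse₁ e w))
  ... | no  _ = cong (λ v → d ∷ e ∷ v) (flatten-parse w)

  firstRun : Shape → List Letter
  firstRun (last U)      = U
  firstRun (block D b F) = D

  push-valid : ∀ {c F} → Valid F → All (Fin._≤ c) (firstRun F) → Valid (push c F) × All (Fin._≤ c) (firstRun (push c F))
  push-valid (last U↓)              ≤c = last (≤c ∷ U↓) , Finₚ.≤-refl ∷ ≤c
  push-valid (block D↓ D<b F-valid) ≤c = block (≤c ∷ D↓) (there D<b) F-valid , Finₚ.≤-refl ∷ ≤c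

  parse-valid  : ∀ w → Valid (parse w)
  parse₁-valid : ∀ d w → Valid (parse₁ d w) × All (Fin._≤ d) (firstRun (parse₁ d w))
  parse-valid []      = last []
  parse-valid (d ∷ w) = proj₁ (parse₁-valid d w)
  parse₁-valid d []      = last ([] ∷ []) , Finₚ.≤-refl ∷ []
  parse₁-valid d (e ∷ w) with e Finₚ.≤? d
  ... | no e≰d = block ([] ∷ []) (here (ℕₚ.≰⇒> e≰d)) (parse-valid w) , Finₚ.≤-refl ∷ []
  ... | yes e≤d with parse₁-valid e w
  ...   | F-valid , ≤e = push-valid F-valid (All.map (λ le → Finₚ.≤-trans le e≤d) ≤e)

  parse-last : ∀ {U} → Descending U → parse U ≡ last U
  parse-last {[]}        _ = refl
  parse-last {d ∷ []}    _ = refl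
  parse-last {d ∷ e ∷ U} ((e≤d ∷ _) ∷ U↓) with e Finₚ.≤? d
  ... | yes _  = cong (push d) (parse-last U↓)
  ... | no e≰d = contradiction e≤d e≰d

  -- There is no ascent inside `D`, and a letter below `b` forces the last letter of `D` below `b`,
  -- so the first ascent is the step to `b`.
  parse-block : ∀ {D b F} → Descending D → Any (Fin._< b) D → parse (flatten F) ≡ F →
                parse (D ++ b ∷ flatten F) ≡ block D b F
  parse-block {d ∷ []} {b} D↓ (here d<b) eq with b Finₚ.≤? d
  ... | yes b≤d = contradiction b≤d (ℕₚ.<⇒≱ d<b)
  ... | no  _   = cong (block [ d ] b) eq
  parse-block {d ∷ e ∷ D} {b} ((e≤d ∷ _) ∷ D↓) D<b eq with e Finₚ.≤? d
  ... | yes _  = cong (push d) (parse-block D↓ (any D<b) eq)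
    where
    any : Any (Fin._< b) (d ∷ e ∷ D) → Any (Fin._< b) (e ∷ D)
    any (here d<b)  = here (ℕₚ.≤-<-trans e≤d d<b)
    any (there e<b) = e<b
  ... | no e≰d = contradiction e≤d e≰d

  parse-flatten : ∀ {F} → Valid F → parse (flatten F) ≡ F
  parse-flatten (last U↓)              = parse-last U↓
  parse-flatten (block D↓ D<b F-valid) = parse-block D↓ D<b (parse-flatten F-valid)

  infix 4 _⊏_
  data _⊏_ : List Letter → List Letter → Set where
    here  : ∀ {a b v w} → a Fin.< b → length v ≡ length w → a ∷ v ⊏ b ∷ w
    there : ∀ {a v w} → v ⊏ w → a ∷ v ⊏ a ∷ w

  -- The value of the word as a numeral in base `k`. It turns the lexicographic order into a rank,
  -- as `det-triangular` requires.
  numeral : List Letter → ℕ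
  numeral []      = 0
  numeral (c ∷ w) = toℕ c * k ^ length w + numeral w

  numeral< : ∀ w → numeral w ℕ.< k ^ length w
  numeral< []      = s≤s z≤n
  numeral< (c ∷ w) = ℕₚ.<-≤-trans (ℕₚ.+-monoʳ-< (toℕ c * k ^ length w) (numeral< w))
    (ℕₚ.≤-trans (ℕₚ.≤-reflexive (ℕₚ.+-comm _ (k ^ length w))) (ℕₚ.*-monoˡ-≤ (k ^ length w) (toℕ<n c)))

  ⊏-length : ∀ {v w} → v ⊏ w → length v ≡ length w
  ⊏-length (here _ eq) = cong suc eq
  ⊏-length (there v⊏w) = cong suc (⊏-length v⊏w)

  numeral-mono : ∀ {v w} → v ⊏ w → numeral v ℕ.< numeral w
  numeral-mono {a ∷ v} {b ∷ w} (here a<b eq) = ℕₚ.<-≤-trans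
    (ℕₚ.+-monoʳ-< (toℕ a * k ^ length v) (numeral< v))
    (ℕₚ.≤-trans (ℕₚ.≤-reflexive (trans (ℕₚ.+-comm _ (k ^ length v)) (cong (λ l → suc (toℕ a) * k ^ l) eq)))
    (ℕₚ.≤-trans (ℕₚ.*-monoˡ-≤ (k ^ length w) a<b) (ℕₚ.m≤m+n _ (numeral w))))
  numeral-mono {a ∷ v} {a ∷ w} (there v⊏w) rewrite ⊏-length v⊏w = ℕₚ.+-monoʳ-< (toℕ a * k ^ length w) (numeral-mono v⊏w)

  ++-⊏ : ∀ p {v w} → v ⊏ w → p ++ v ⊏ p ++ w
  ++-⊏ []      v⊏w = v⊏w
  ++-⊏ (a ∷ p) v⊏w = there (++-⊏ p v⊏w)

  -- The first difference from the descending arrangement is a smaller letter. It decides the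
  -- comparison whatever follows, hence the arbitrary continuations `v` and `w`.
  descending-greatest : ∀ {D p} → Descending D → D ↭ p → p ≡ D ⊎ (∀ {v w} → length v ≡ length w → p ++ v ⊏ D ++ w)
  descending-greatest {[]}    {[]}    D↓ D↭p = inj₁ refl
  descending-greatest {[]}    {a ∷ p} D↓ D↭p = contradiction (↭-sym D↭p) ↭ₚ.¬x∷xs↭[]
  descending-greatest {d ∷ D} {[]}    D↓ D↭p = contradiction D↭p ↭ₚ.¬x∷xs↭[]
  descending-greatest {d ∷ D} {a ∷ p} (≤d ∷ D↓) D↭p with Finₚ.<-cmp a d
  ... | tri< a<d _ _ = inj₂ λ {v} {w} eq → here a<d
          (trans (Listₚ.length-++ p) (trans (cong₂ _+_ (ℕₚ.suc-injective (sym (↭-length D↭p))) eq) (sym (Listₚ.length-++ D))))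
  ... | tri> _ _ d<a = contradiction (All.lookup (Finₚ.≤-refl ∷ ≤d) (∈-resp-↭ (↭-sym D↭p) (here refl))) (ℕₚ.<⇒≱ d<a)
  ... | tri≈ _ refl _ with descending-greatest D↓ (drop-∷ D↭p)
  ...   | inj₁ refl = inj₁ refl
  ...   | inj₂ lt   = inj₂ λ eq → there (lt eq)

  match-nonzero : ∀ {D b} F v → match (block D b F) v ≢ 0 → length (flatten (block D b F)) ≡ length v →
                  ∃ λ (p : List Letter) → ∃ λ (r : List Letter) → v ≡ p ++ b ∷ r × D ↭ p × match F r ≢ 0
  match-nonzero {D} {b} F v ≢0 eq
    with split-at (length D) v (subst (length D ℕ.<_) (trans (sym (length-++-∷ D b _)) eq) (s≤s (ℕₚ.m≤m+n (length D) _)))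
  ... | p , a , r , refl , D≡p rewrite match-block D b F p (a ∷ r) D≡p with ⟦⟧*-nonzero (D ↭? p) ≢0
  ... | D↭p , ≢0′ with ⟦⟧*-nonzero (b ≟ a) ≢0′
  ... | refl , ≢0″ = p , r , refl , D↭p , ≢0″

  match-triangular : ∀ {F} → Valid F → ∀ v → length (flatten F) ≡ length v → match F v ≢ 0 → v ≡ flatten F ⊎ v ⊏ flatten F
  match-triangular {last U} (last U↓) v eq ≢0 with U ↭? v
  ... | no _ = contradiction refl ≢0
  ... | yes U↭v with descending-greatest U↓ U↭v
  ...   | inj₁ v≡U = inj₁ v≡U
  ...   | inj₂ lt  = inj₂ (≡.subst₂ _⊏_ (Listₚ.++-identityʳ v) (Listₚ.++-identityʳ U) (lt {[]} {[]} refl))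
  match-triangular {block D b F} (block D↓ D<b F-valid) v eq ≢0 with match-nonzero {D} {b} F v ≢0 eq
  ... | p , r , refl , D↭p , ≢0′ = compare (descending-greatest D↓ D↭p) (match-triangular F-valid r F≡r ≢0′)
    where
    F≡r : length (flatten F) ≡ length r
    F≡r = ℕₚ.+-cancelˡ-≡ (length p) _ _ (ℕₚ.suc-injective
      (trans (cong (λ n → suc (n + _)) (sym (↭-length D↭p))) (trans (sym (length-++-∷ D b _)) (trans eq (length-++-∷ p b r)))))
    compare : p ≡ D ⊎ (∀ {v w} → length v ≡ length w → p ++ v ⊏ D ++ w) → r ≡ flatten F ⊎ r ⊏ flatten F →
              p ++ b ∷ r ≡ D ++ b ∷ flatten F ⊎ p ++ b ∷ r ⊏ D ++ b ∷ flatten F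
    compare (inj₂ lt)   _           = inj₂ (lt (cong suc (sym F≡r)))
    compare (inj₁ refl) (inj₁ refl) = inj₁ refl
    compare (inj₁ refl) (inj₂ r⊏F)  = inj₂ (++-⊏ D (there r⊏F))

  match-flatten : ∀ (F : Shape) → match F (flatten F) ≡ 1
  match-flatten (last U)      = ⟦⟧-yes (U ↭? U) ↭-refl
  match-flatten (block D b F) = trans (match-block D b F D _ refl)
    (cong₂ _*_ (⟦⟧-yes (D ↭? D) ↭-refl) (cong₂ _*_ (⟦⟧-yes (b ≟ b) refl) (match-flatten F)))

-- Words with empty last part are equinumerous with words without fixed points.

module Counting (k : ℕ) where
  open import Data.Nat.Base using (_+_)
  open ≡ using (refl; sym; trans; cong; cong₂; subst)
  open +-*-Solver using (solve; _:=_; _:+_)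
  open Shapes k
  open Parsing k

  private
    Letter : Set
    Letter = Fin k

  open DecMembership {A = Letter} _≟_ using (_∈?_)

  -- Filtering all words of the right length lists each rearrangement once, also when `t` has
  -- repeated letters.
  words : List Letter → List (List Letter)
  words t = filter (_↭? t) (List.map Vec.toList (allVecs (allFin k) (length t)))

  words-unique : ∀ t → Unique (words t)
  words-unique t = Uniqueₚ.filter⁺ (_↭? t)
    (Uniqueₚ.map⁺ (λ {v} {w} → toList-injective v w) (allVecs-unique (Uniqueₚ.allFin⁺ k) (length t)))

  ∈-words⁺ : ∀ {t v} → v ↭ t → v ∈ words t
  ∈-words⁺ {t} {v} v↭t = ∈ₚ.∈-filter⁺ (_↭? t) (∈-vecs (↭-length v↭t)) v↭t
    where
    ∈-vecs : ∀ {m} → length v ≡ m → v ∈ List.map Vec.toList (allVecs (allFin k) m)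
    ∈-vecs refl = subst (_∈ List.map Vec.toList (allVecs (allFin k) (length v))) (Vecₚ.toList∘fromList v) (∈ₚ.∈-map⁺ Vec.toList (∈-allVecs ∈ₚ.∈-allFin (Vec.fromList v)))

  ∈-words⁻ : ∀ {t v} → v ∈ words t → v ↭ t
  ∈-words⁻ {t} v∈ = proj₂ (∈ₚ.∈-filter⁻ (_↭? t) {xs = List.map Vec.toList (allVecs (allFin k) (length t))} v∈)

  -- Z n forbids the letters below n at certain places; grow i puts one more i at the only such place.
  record Peeling (Z : ℕ → List Letter → Set) : Set where
    field
      Z?      : ∀ n → U.Decidable (Z n)
      initial : ∀ w → Z 0 w
      weaken  : ∀ {n w} → Z (suc n) w → Z n w
      absent  : ∀ i {w} → ¬ i ∈ w → Z (toℕ i) w → Z (suc (toℕ i)) w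
      grow    : Letter → List Letter → List Letter
      grow-↭  : ∀ i w → grow i w ↭ i ∷ w
      grow-injective : ∀ i {v w} → grow i v ≡ grow i w → v ≡ w
      grow-Z  : ∀ i {w} → Z (toℕ i) w → Z (toℕ i) (grow i w) × ¬ Z (suc (toℕ i)) (grow i w)
      shrink  : ∀ i {w} → Z (toℕ i) w → ¬ Z (suc (toℕ i)) w → ∃ λ v → grow i v ≡ w × Z (toℕ i) v

    #words : ℕ → List Letter → ℕ
    #words n t = length (filter (Z? n) (words t))

    #words-absent : ∀ i {t} → ¬ i ∈ t → #words (toℕ i) t ≡ #words (suc (toℕ i)) t
    #words-absent i {t} i∉t = length-filter-cong (Z? (toℕ i)) (Z? (suc (toℕ i))) (words t)
      (λ w∈ → absent i (i∉t ∘ ∈-resp-↭ (∈-words⁻ w∈))) (λ _ → weaken)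

    #words-present : ∀ i {t t′} → i ∷ t′ ↭ t → #words (toℕ i) t ≡ #words (suc (toℕ i)) t + #words (toℕ i) t′
    #words-present i {t} {t′} p = trans (length-filter-split (Z? (toℕ i)) (Z? (suc (toℕ i))) (words t) weaken)
      (cong (#words (suc (toℕ i)) t +_) (sym (bijection-length (grow i)
        (Uniqueₚ.filter⁺ (Z? (toℕ i)) (words-unique t′)) (Uniqueₚ.filter⁺ Z∖Z? (words-unique t))
        (λ w∈ → let w∈′ , z = ∈ₚ.∈-filter⁻ (Z? (toℕ i)) {xs = words t′} w∈ in
          ∈ₚ.∈-filter⁺ Z∖Z? (∈-words⁺ (↭-trans (grow-↭ i _) (↭-trans (prep i (∈-words⁻ w∈′)) p))) (grow-Z i z))
        (λ _ _ → grow-injective i)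
        surjective)))
      where
      Z∖Z? = λ w → Z? (toℕ i) w ×-dec ¬? (Z? (suc (toℕ i)) w)
      surjective : ∀ {w} → w ∈ filter Z∖Z? (words t) → ∃ λ v → v ∈ filter (Z? (toℕ i)) (words t′) × grow i v ≡ w
      surjective w∈ with ∈ₚ.∈-filter⁻ Z∖Z? {xs = words t} w∈
      ... | w∈′ , z , ¬z with shrink i z ¬z
      ...   | v , refl , z′ = v , ∈ₚ.∈-filter⁺ (Z? (toℕ i)) (∈-words⁺ (drop-∷
                (↭-trans (↭-sym (grow-↭ i v)) (↭-trans (∈-words⁻ w∈′) (↭-sym p))))) z′ , refl

  open Peeling using (#words)

  module _ {Z Z′ : ℕ → List Letter → Set} (peel : Peeling Z) (peel′ : Peeling Z′) where
    private
      module P  = Peeling peel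
      module P′ = Peeling peel′

    -- At `n = 0` nothing is forbidden. If `i` occurs in `t`, the count for `suc (toℕ i)` follows
    -- from the recurrence by cancelling the counts for `t′`, so the induction hypothesis is used
    -- for two contents.
    #words-unique : ∀ n → n ℕ.≤ k → ∀ t → #words peel n t ≡ #words peel′ n t
    #words-unique zero    _   t = length-filter-cong (P.Z? 0) (P′.Z? 0) (words t) (λ _ _ → P′.initial _) (λ _ _ → P.initial _)
    #words-unique (suc n) n<k t = subst (λ n → #words peel (suc n) t ≡ #words peel′ (suc n) t) (toℕ-fromℕ< n<k) step
      where
      i = fromℕ< n<k
      ih : ∀ t → #words peel (toℕ i) t ≡ #words peel′ (toℕ i) t
      ih = subst (λ n → ∀ t → #words peel n t ≡ #words peel′ n t) (sym (toℕ-fromℕ< n<k)) (#words-unique n (ℕₚ.<⇒≤ n<k))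
      step : #words peel (suc (toℕ i)) t ≡ #words peel′ (suc (toℕ i)) t
      step with i ∈? t
      ... | no i∉t  = trans (sym (P.#words-absent i i∉t)) (trans (ih t) (P′.#words-absent i i∉t))
      ... | yes i∈t = ℕₚ.+-cancelʳ-≡ (#words peel (toℕ i) t′) _ _
        (trans (sym (P.#words-present i p)) (trans (ih t) (trans (P′.#words-present i p) (cong (#words peel′ (suc (toℕ i)) t +_) (sym (ih t′))))))
        where
        t′ = rm i 0 t
        p : i ∷ t′ ↭ t
        p = rm-↭ i 0 t (∈⇒count>0 i∈t)

  setRest : Shape → List Letter → Shape
  setRest (last U)      V = last V
  setRest (block D b F) V = block D b (setRest F V)

  flatten-setRest : ∀ F V → flatten (setRest F V) ≡ body F ++ V
  flatten-setRest (last U)      V = refl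
  flatten-setRest (block D b F) V = trans (cong (λ w → D ++ b ∷ w) (flatten-setRest F V)) (sym (Listₚ.++-assoc D (b ∷ body F) V))

  body-setRest : ∀ F V → body (setRest F V) ≡ body F
  body-setRest (last U)      V = refl
  body-setRest (block D b F) V = cong (λ w → D ++ b ∷ w) (body-setRest F V)

  rest-setRest : ∀ F V → rest (setRest F V) ≡ V
  rest-setRest (last U)      V = refl
  rest-setRest (block D b F) V = rest-setRest F V

  setRest-valid : ∀ {F V} → Valid F → Descending V → Valid (setRest F V)
  setRest-valid (last _)               V↓ = last V↓
  setRest-valid (block D↓ D<b F-valid) V↓ = block D↓ D<b (setRest-valid F-valid V↓)

  rest-descending : ∀ {F} → Valid F → Descending (rest F)
  rest-descending (last U↓)           = U↓
  rest-descending (block _ _ F-valid) = rest-descending F-valid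

  -- Validity asks of the last part only that it descend, so replacing it leaves the blocks as they
  -- are.
  parse-body-++ : ∀ w {V} → Descending V → parse (body (parse w) ++ V) ≡ setRest (parse w) V
  parse-body-++ w {V} V↓ = trans (cong parse (sym (flatten-setRest (parse w) V)))
    (parse-flatten (setRest-valid (parse-valid w) V↓))

  body-++-rest : ∀ w → body (parse w) ++ rest (parse w) ≡ w
  body-++-rest w = trans (sym (flatten≡body++rest (parse w))) (flatten-parse w)

  RestAbove : ℕ → List Letter → Set
  RestAbove n w = All (λ c → n ℕ.≤ toℕ c) (rest (parse w))

  descending-∷ʳ : ∀ {U} i → Descending U → All (λ c → toℕ i ℕ.≤ toℕ c) U → Descending (U ++ [ i ])
  descending-∷ʳ i U↓ i≤U = AllPairsₚ.++⁺ U↓ ([] ∷ []) (All.map (_∷ []) i≤U)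

  least-last : ∀ {U i} → Descending U → All (λ c → toℕ i ℕ.≤ toℕ c) U → i ∈ U → ∃ λ (V : List Letter) → U ≡ V ++ [ i ]
  least-last {d ∷ []}    U↓        i≤U       (here refl) = [] , refl
  least-last {d ∷ e ∷ U} ((e≤d ∷ _) ∷ U↓) (i≤d ∷ i≤e ∷ i≤U) (here refl) with least-last U↓ (i≤e ∷ i≤U) (here (Finₚ.≤-antisym i≤e e≤d))
  ... | V , eq = d ∷ V , cong (d ∷_) eq
  least-last {d ∷ U}     (_ ∷ U↓) (_ ∷ i≤U) (there i∈U) with least-last U↓ i≤U i∈U
  ... | V , refl = d ∷ V , refl

  rest-parse-∷ʳ : ∀ i w → RestAbove (toℕ i) w → rest (parse (w ++ [ i ])) ≡ rest (parse w) ++ [ i ]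
  rest-parse-∷ʳ i w i≤ = trans (cong (rest ∘ parse) (trans (cong (_++ [ i ]) (sym (body-++-rest w))) (Listₚ.++-assoc (body (parse w)) _ [ i ])))
    (trans (cong rest (parse-body-++ w (descending-∷ʳ i (rest-descending (parse-valid w)) i≤))) (rest-setRest (parse w) _))

  -- The last part descends, so when it has no letter below `i`, its letters `i` stand at its end
  -- and hence at the end of the word. That is where an `i` is put or taken away.
  rest-peeling : Peeling RestAbove
  rest-peeling = record
    { Z?             = λ n w → All.all? (λ c → n ℕₚ.≤? toℕ c) (rest (parse w))
    ; initial        = λ w → All.tabulate λ _ → z≤n
    ; weaken         = All.map ℕₚ.<⇒≤
    ; absent         = λ i {w} i∉w i≤ → above i (i∉w ∘ subst (i ∈_) (body-++-rest w) ∘ ∈ₚ.∈-++⁺ʳ (body (parse w))) i≤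
    ; grow           = λ i w → w ++ [ i ]
    ; grow-↭         = λ i w → ↭-sym (∷↭∷ʳ i w)
    ; grow-injective = λ i {v} {w} eq → Listₚ.∷ʳ-injectiveˡ v w eq
    ; grow-Z         = λ i {w} i≤ → subst (All _) (sym (rest-parse-∷ʳ i w i≤)) (Allₚ.++⁺ i≤ (ℕₚ.≤-refl ∷ []))
                               , λ i< → ℕₚ.<-irrefl refl (All.lookup i< (subst (i ∈_) (sym (rest-parse-∷ʳ i w i≤)) (∈ₚ.∈-++⁺ʳ (rest (parse w)) (here refl))))
    ; shrink         = shrink
    }
    where
    above : ∀ i {U} → ¬ i ∈ U → All (λ c → toℕ i ℕ.≤ toℕ c) U → All (λ c → toℕ i ℕ.< toℕ c) U
    above i i∉U i≤U = All.tabulate λ c∈U → ℕₚ.≤∧≢⇒< (All.lookup i≤U c∈U)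
      λ i≡c → i∉U (subst (_∈ _) (sym (toℕ-injective i≡c)) c∈U)
    shrink : ∀ i {w} → RestAbove (toℕ i) w → ¬ RestAbove (suc (toℕ i)) w → ∃ λ v → v ++ [ i ] ≡ w × RestAbove (toℕ i) v
    shrink i {w} i≤ ¬i< with i ∈? rest (parse w)
    ... | no i∉ = contradiction (above i i∉ i≤) ¬i<
    ... | yes i∈ with least-last (rest-descending (parse-valid w)) i≤ i∈
    ...   | V , eq = body (parse w) ++ V
                   , trans (Listₚ.++-assoc (body (parse w)) V [ i ]) (trans (cong (body (parse w) ++_) (sym eq)) (body-++-rest w))
                   , subst (All _) (sym (trans (cong rest (parse-body-++ w V↓)) (rest-setRest (parse w) V)))
                       (Allₚ.++⁻ˡ V (subst (All _) eq i≤))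
      where
      V↓ : Descending V
      V↓ = AllPairs-++⁻ˡ V (subst Descending eq (rest-descending (parse-valid w)))

  less other : Letter → List Letter → ℕ
  less c []       = 0
  less c (d ∷ w)  = ⟦ d Finₚ.<? c ⟧ + less c w
  other c []      = 0
  other c (d ∷ w) = ⟦ ¬? (c ≟ d) ⟧ + other c w

  less-↭ : ∀ c {v w} → v ↭ w → less c v ≡ less c w
  less-↭ c ↭.refl        = refl
  less-↭ c (prep d p)    = cong (⟦ d Finₚ.<? c ⟧ +_) (less-↭ c p)
  less-↭ c (swap d e p)  = trans (cong (λ n → ⟦ d Finₚ.<? c ⟧ + (⟦ e Finₚ.<? c ⟧ + n)) (less-↭ c p))
    (solve 3 (λ x y z → x :+ (y :+ z) := y :+ (x :+ z)) refl ⟦ d Finₚ.<? c ⟧ ⟦ e Finₚ.<? c ⟧ _)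
  less-↭ c (↭.trans p q) = trans (less-↭ c p) (less-↭ c q)

  less-∷-≥ : ∀ {c i} w → c Fin.≤ i → less c (i ∷ w) ≡ less c w
  less-∷-≥ {c} {i} w c≤i = cong (_+ less c w) (⟦⟧-no (i Finₚ.<? c) (ℕₚ.≤⇒≯ c≤i))

  other-++ : ∀ c v w → other c (v ++ w) ≡ other c v + other c w
  other-++ c []      w = refl
  other-++ c (d ∷ v) w = trans (cong (⟦ ¬? (c ≟ d) ⟧ +_) (other-++ c v w)) (sym (ℕₚ.+-assoc ⟦ ¬? (c ≟ d) ⟧ _ _))

  other-same : ∀ c w → other c (c ∷ w) ≡ other c w
  other-same c w = cong (_+ other c w) (⟦⟧-no (¬? (c ≟ c)) (λ ≢ → ≢ refl))

  other-diff : ∀ {c d} w → c ≢ d → other c (d ∷ w) ≡ suc (other c w)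
  other-diff {c} {d} w c≢d = cong (_+ other c w) (⟦⟧-yes (¬? (c ≟ d)) c≢d)

  other+count : ∀ c w → other c w + count c w ≡ length w
  other+count c []      = refl
  other+count c (d ∷ w) with c ≟ d
  ... | yes _ = trans (ℕₚ.+-suc _ _) (cong suc (other+count c w))
  ... | no  _ = cong suc (other+count c w)

  less≤other : ∀ c w → less c w ℕ.≤ other c w
  less≤other c []      = z≤n
  less≤other c (d ∷ w) = ℕₚ.+-mono-≤ (⟦⟧-mono (d Finₚ.<? c) (¬? (c ≟ d)) (λ d<c c≡d → Finₚ.<⇒≢ d<c (sym c≡d))) (less≤other c w)

  less+count≤less : ∀ {c i} w → c Fin.< i → less c w + count c w ℕ.≤ less i w
  less+count≤less         []      c<i = z≤n
  less+count≤less {c} {i} (d ∷ w) c<i = ℕₚ.≤-trans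
    (ℕₚ.≤-reflexive (solve 4 (λ a b x y → (a :+ x) :+ (b :+ y) := (a :+ b) :+ (x :+ y)) refl ⟦ d Finₚ.<? c ⟧ ⟦ c ≟ d ⟧ (less c w) (count c w)))
    (ℕₚ.+-mono-≤ (⟦⟧-mono-⊎ (d Finₚ.<? c) (c ≟ d) (d Finₚ.<? i) (λ d<c c≡d → Finₚ.<⇒≢ d<c (sym c≡d))
      (λ d<c → Finₚ.<-trans d<c c<i) λ { refl → c<i }) (less+count≤less w c<i))

  -- The standardisation of w sends the position after p to the label with less c w + count c p
  -- labels below it, so this position is a fixed point iff length p = less c w + count c p.
  Fixed : Letter → List Letter → Set
  Fixed c w = ∃₂ λ p r → w ≡ p ++ c ∷ r × other c p ≡ less c w

  occurs-after? : ∀ c m w → Dec (∃₂ λ p r → w ≡ p ++ c ∷ r × other c p ≡ m)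
  occurs-after? c m [] = no λ { ([] , _ , () , _) ; (_ ∷ _ , _ , () , _) }
  occurs-after? c m (d ∷ w) with c ≟ d
  occurs-after? c zero    (d ∷ w) | yes refl = yes ([] , w , refl , refl)
  occurs-after? c (suc m) (d ∷ w) | yes refl = map′
    (λ { (p , r , refl , eq) → c ∷ p , r , refl , trans (other-same c p) eq })
    (λ { (_ ∷ p , r , refl , eq) → p , r , refl , trans (sym (other-same c p)) eq })
    (occurs-after? c (suc m) w)
  occurs-after? c zero    (d ∷ w) | no c≢d = no λ
    { ([] , _ , refl , _) → c≢d refl
    ; (_ ∷ p , r , refl , eq) → contradiction (trans (sym eq) (other-diff p c≢d)) λ () }
  occurs-after? c (suc m) (d ∷ w) | no c≢d = map′
    (λ { (p , r , refl , eq) → d ∷ p , r , refl , trans (other-diff p c≢d) (cong suc eq) })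
    (λ { ([] , _ , refl , _) → contradiction refl c≢d
       ; (_ ∷ p , r , refl , eq) → p , r , refl , ℕₚ.suc-injective (trans (sym (other-diff p c≢d)) eq) })
    (occurs-after? c m w)

  fixed? : ∀ c w → Dec (Fixed c w)
  fixed? c w = occurs-after? c (less c w) w

  Unfixed : ℕ → List Letter → Set
  Unfixed n w = ∀ c → toℕ c ℕ.< n → ¬ Fixed c w

  -- The new `i` goes directly behind the `m`-th letter other than `i`. A run of letters `i` may
  -- follow there, but any other place in this run would give the same word.
  insertBehind : Letter → ℕ → List Letter → List Letter
  insertBehind i zero    w       = i ∷ w
  -- A default value, which `grow` does not reach because `less i w` is at most `other i w`.
  insertBehind i (suc m) []      = [ i ]
  insertBehind i (suc m) (d ∷ w) with i ≟ d
  ... | yes _ = d ∷ insertBehind i (suc m) w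
  ... | no  _ = d ∷ insertBehind i m w

  insertBehind-same : ∀ i m w → insertBehind i m (i ∷ w) ≡ i ∷ insertBehind i m w
  insertBehind-same i zero    w = refl
  insertBehind-same i (suc m) w with i ≟ i
  ... | yes _   = refl
  ... | no  i≢i = contradiction refl i≢i

  insertBehind-diff : ∀ {i d} m w → i ≢ d → insertBehind i (suc m) (d ∷ w) ≡ d ∷ insertBehind i m w
  insertBehind-diff {i} {d} m w i≢d with i ≟ d
  ... | yes i≡d = contradiction i≡d i≢d
  ... | no  _   = refl

  -- The cuts with a given number of letters other than `i` in front differ only by letters `i`, so
  -- each of them leads to the same word.
  insertBehind-++ : ∀ i p r → insertBehind i (other i p) (p ++ r) ≡ p ++ i ∷ r
  insertBehind-++ i []      r = refl
  insertBehind-++ i (d ∷ p) r with i ≟ d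
  ... | yes refl = trans (insertBehind-same i (other i p) (p ++ r)) (cong (i ∷_) (insertBehind-++ i p r))
  ... | no  i≢d  = trans (insertBehind-diff (other i p) (p ++ r) i≢d) (cong (d ∷_) (insertBehind-++ i p r))

  insertBehind-split : ∀ i m w → m ℕ.≤ other i w → ∃₂ λ p r → w ≡ p ++ r × other i p ≡ m
  insertBehind-split i zero    w       le = [] , w , refl , refl
  insertBehind-split i (suc m) (d ∷ w) le with i ≟ d
  insertBehind-split i (suc m) (d ∷ w) le       | yes refl with insertBehind-split i (suc m) w le
  ... | p , r , refl , eq = i ∷ p , r , refl , trans (other-same i p) eq
  insertBehind-split i (suc m) (d ∷ w) (s≤s le) | no i≢d with insertBehind-split i m w le
  ... | p , r , refl , eq = d ∷ p , r , refl , trans (other-diff p i≢d) (cong suc eq)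

  insertBehind-injective : ∀ i m v w → insertBehind i m v ≡ insertBehind i m w → length v ≡ length w → v ≡ w
  insertBehind-injective i zero    v       w       eq len = Listₚ.∷-injectiveʳ eq
  insertBehind-injective i (suc m) []      []      eq len = refl
  insertBehind-injective i (suc m) (d ∷ v) (e ∷ w) eq len with i ≟ d | i ≟ e
  ... | yes refl | yes refl = cong (i ∷_) (insertBehind-injective i (suc m) v w (Listₚ.∷-injectiveʳ eq) (ℕₚ.suc-injective len))
  ... | yes refl | no  i≢e  = contradiction (Listₚ.∷-injectiveˡ eq) i≢e
  ... | no  i≢d  | yes refl = contradiction (sym (Listₚ.∷-injectiveˡ eq)) i≢d
  ... | no  _    | no  _    = cong₂ _∷_ (Listₚ.∷-injectiveˡ eq) (insertBehind-injective i m v w (Listₚ.∷-injectiveʳ eq) (ℕₚ.suc-injective len))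

  -- `less i` ignores letters `i`, so the number is the same before and after the insertion, and an
  -- `i` behind exactly that many other letters is fixed.
  grow : Letter → List Letter → List Letter
  grow i w = insertBehind i (less i w) w

  grow-at : ∀ i p r → other i p ≡ less i (p ++ r) → grow i (p ++ r) ≡ p ++ i ∷ r
  grow-at i p r eq = trans (cong (λ m → insertBehind i m (p ++ r)) (sym eq)) (insertBehind-++ i p r)

  grow-split : ∀ i w → ∃₂ λ p r → w ≡ p ++ r × other i p ≡ less i (p ++ r) × grow i w ≡ p ++ i ∷ r
  grow-split i w with insertBehind-split i (less i w) w (less≤other i w)
  ... | p , r , refl , eq = p , r , refl , eq , grow-at i p r eq

  ++-∷-cases : ∀ {c : Letter} p r p′ {r′} → p ++ r ≡ p′ ++ c ∷ r′ →
               (∃ λ s → p ≡ p′ ++ c ∷ s × r′ ≡ s ++ r) ⊎ (∃ λ s → p′ ≡ p ++ s × r ≡ s ++ c ∷ r′)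
  ++-∷-cases []      r p′       eq   = inj₂ (p′ , refl , eq)
  ++-∷-cases (a ∷ p) r []       refl = inj₁ (p , refl , refl)
  ++-∷-cases (a ∷ p) r (_ ∷ p′) eq with Listₚ.∷-injectiveˡ eq | ++-∷-cases p r p′ (Listₚ.∷-injectiveʳ eq)
  ... | refl | inj₁ (s , refl , eq′) = inj₁ (s , refl , eq′)
  ... | refl | inj₂ (s , refl , eq′) = inj₂ (s , refl , eq′)

  less-grown : ∀ {c i} p r → c Fin.≤ i → less c (p ++ i ∷ r) ≡ less c (p ++ r)
  less-grown {c} {i} p r c≤i = trans (less-↭ c (shift i p r)) (less-∷-≥ (p ++ r) c≤i)

  -- A letter c < i behind the insertion point comes too late to be fixed, with or without i in front of it.
  less-behind : ∀ {c i} p r → c Fin.< i → other i p ≡ less i (p ++ r) → less c (p ++ r) + count c r ℕ.≤ other c p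
  less-behind {c} {i} p r c<i eq = ℕₚ.+-cancelʳ-≤ (count c p) _ _ (begin
    less c (p ++ r) + count c r + count c p    ≡⟨ ℕₚ.+-assoc (less c (p ++ r)) _ _ ⟩
    less c (p ++ r) + (count c r + count c p)  ≡⟨ cong (less c (p ++ r) +_) (trans (ℕₚ.+-comm (count c r) _) (sym (count-++ c p r))) ⟩
    less c (p ++ r) + count c (p ++ r)         ≤⟨ less+count≤less (p ++ r) c<i ⟩
    less i (p ++ r)                            ≡⟨ eq ⟨
    other i p                                  ≤⟨ ℕₚ.m≤m+n _ _ ⟩
    other i p + count i p                      ≡⟨ other+count i p ⟩
    length p                                   ≡⟨ other+count c p ⟨
    other c p + count c p                      ∎)
    where open ℕₚ.≤-Reasoning

  module _ {c i : Letter} (p r : List Letter) (c<i : c Fin.< i) (eq : other i p ≡ less i (p ++ r)) where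

    -- An occurrence of `c` in front of the insertion point keeps its prefix, and `less c` does not
    -- see `i`. Occurrences behind that point are ruled out by `less-behind`.
    fixed-grow⁺ : Fixed c (p ++ r) → Fixed c (p ++ i ∷ r)
    fixed-grow⁺ (p′ , r′ , w≡ , fix) with ++-∷-cases p r p′ w≡
    ... | inj₁ (s , refl , refl) = p′ , s ++ i ∷ r , Listₚ.++-assoc p′ (c ∷ s) (i ∷ r)
                                 , trans fix (sym (less-grown p r (ℕₚ.<⇒≤ c<i)))
    ... | inj₂ (s , refl , refl) = contradiction (less-behind p r c<i eq) (ℕₚ.<⇒≱ (begin-strict
      other c p                     ≤⟨ ℕₚ.m≤m+n _ _ ⟩
      other c p + other c s         ≡⟨ trans (sym (other-++ c p s)) fix ⟩
      -- Strict because the occurrence of `c` in question lies in `r`.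
      less c (p ++ r)               <⟨ ℕₚ.m<m+n _ (∈⇒count>0 (∈ₚ.∈-insert s)) ⟩
      less c (p ++ r) + count c r   ∎))
      where open ℕₚ.≤-Reasoning

    fixed-grow⁻ : Fixed c (p ++ i ∷ r) → Fixed c (p ++ r)
    fixed-grow⁻ (p′ , r′ , w≡ , fix) with ++-∷-cases p (i ∷ r) p′ w≡
    ... | inj₁ (s , refl , refl) = p′ , s ++ r , Listₚ.++-assoc p′ (c ∷ s) r
                                 , trans fix (less-grown p r (ℕₚ.<⇒≤ c<i))
    ... | inj₂ ([] , refl , i∷r≡) = contradiction (Listₚ.∷-injectiveˡ i∷r≡) λ { refl → ℕₚ.<-irrefl refl c<i }
    ... | inj₂ (_ ∷ s , refl , refl) = contradiction (less-behind p r c<i eq) (ℕₚ.<⇒≱ (begin-strict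
      -- Strict because the inserted `i` differs from `c` and precedes this occurrence.
      other c p                     <⟨ ℕₚ.m<m+n _ (s≤s z≤n) ⟩
      other c p + suc (other c s)   ≡⟨ cong (other c p +_) (sym (other-diff s λ { refl → ℕₚ.<-irrefl refl c<i })) ⟩
      other c p + other c (i ∷ s)   ≡⟨ trans (sym (other-++ c p (i ∷ s))) fix ⟩
      less c (p ++ i ∷ r)           ≡⟨ less-grown p r (ℕₚ.<⇒≤ c<i) ⟩
      less c (p ++ r)               ≤⟨ ℕₚ.m≤m+n _ _ ⟩
      less c (p ++ r) + count c r   ∎))
      where open ℕₚ.≤-Reasoning

  unfixed-suc : ∀ i {w} → ¬ Fixed i w → Unfixed (toℕ i) w → Unfixed (suc (toℕ i)) w
  unfixed-suc i ¬fix unfixed c (s≤s c≤i) with c ≟ i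
  ... | yes refl = ¬fix
  ... | no  c≢i  = unfixed c (Finₚ.≤∧≢⇒< c≤i c≢i)

  -- Inserting or removing an `i` behind `less i` other letters changes nothing for smaller letters.
  -- A word in which `i` is fixed has an `i` at just that place, and removing it inverts `grow`.
  fixed-peeling : Peeling Unfixed
  fixed-peeling = record
    { Z?             = λ n w → Finₚ.all? λ c → (toℕ c ℕₚ.<? n) →-dec ¬? (fixed? c w)
    ; initial        = λ _ _ ()
    ; weaken         = λ unfixed c c<n → unfixed c (ℕₚ.m<n⇒m<1+n c<n)
    ; absent         = λ i i∉w → unfixed-suc i λ { (p , r , refl , _) → i∉w (∈ₚ.∈-insert p) }
    ; grow           = grow
    ; grow-↭         = grow-↭
    ; grow-injective = λ i {v} {w} eq →
        let v↭w = drop-∷ (↭-trans (↭-sym (grow-↭ i v)) (↭-trans (↭.↭-reflexive eq) (grow-↭ i w))) in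
        insertBehind-injective i (less i v) v w (trans eq (cong (λ m → insertBehind i m w) (sym (less-↭ i v↭w)))) (↭-length v↭w)
    ; grow-Z         = grow-Z
    ; shrink         = shrink
    }
    where
    grow-↭ : ∀ i w → grow i w ↭ i ∷ w
    grow-↭ i w with grow-split i w
    ... | p , r , refl , _ , eq = ↭-trans (↭.↭-reflexive eq) (shift i p r)
    grow-Z : ∀ i {w} → Unfixed (toℕ i) w → Unfixed (toℕ i) (grow i w) × ¬ Unfixed (suc (toℕ i)) (grow i w)
    grow-Z i {w} unfixed with grow-split i w
    ... | p , r , refl , eq , grow≡ rewrite grow≡ =
        (λ c c<i fix → unfixed c c<i (fixed-grow⁻ p r c<i eq fix))
      , (λ unfixed′ → unfixed′ i ℕₚ.≤-refl (p , r , refl , trans eq (sym (less-grown p r Finₚ.≤-refl))))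
    shrink : ∀ i {w} → Unfixed (toℕ i) w → ¬ Unfixed (suc (toℕ i)) w → ∃ λ v → grow i v ≡ w × Unfixed (toℕ i) v
    shrink i {w} unfixed ¬unfixed with fixed? i w
    ... | no ¬fix = contradiction (unfixed-suc i ¬fix unfixed) ¬unfixed
    ... | yes (p , r , refl , eq) = p ++ r , grow-at i p r eq′ , λ c c<i fix → unfixed c c<i (fixed-grow⁺ p r c<i eq′ fix)
      where
      eq′ : other i p ≡ less i (p ++ r)
      eq′ = trans eq (less-grown p r Finₚ.≤-refl)

  #unfixed≡#empty-rest : ∀ t → #words fixed-peeling k t ≡ #words rest-peeling k t
  #unfixed≡#empty-rest = #words-unique fixed-peeling rest-peeling k ℕₚ.≤-refl

-- Linear extensions as words in the chain labels, and promotion on these words.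

module Labelling (k : ℕ) where
  open import Data.Nat.Base using (_+_; _∸_)
  open ≡ using (refl; sym; trans; cong; cong₂; subst; module ≡-Reasoning)
  open Shapes k
  open Parsing k
  open Counting k

  -- offset ch i is the height of i in its chain.
  offset : ∀ {m} → (Fin m → Fin k) → Fin m → ℕ
  offset ch zero    = 0
  offset ch (suc i) = ⟦ ch (suc i) ≟ ch zero ⟧ + offset (ch ∘ suc) i

  offset< : ∀ {m} (ch : Fin m → Fin k) i → offset ch i ℕ.< count (ch i) (List.tabulate ch)
  offset< ch zero    = subst (0 ℕ.<_) (sym (count-here (ch zero) (List.tabulate (ch ∘ suc)))) (s≤s z≤n)
  offset< ch (suc i) = ℕₚ.+-monoʳ-< ⟦ ch (suc i) ≟ ch zero ⟧ (offset< (ch ∘ suc) i)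

  offset-surjective : ∀ {m} (ch : Fin m → Fin k) c q → q ℕ.< count c (List.tabulate ch) → ∃ λ i → ch i ≡ c × offset ch i ≡ q
  offset-surjective {suc m} ch c q q< with c ≟ ch zero
  offset-surjective {suc m} ch c zero    q<       | yes c≡ = zero , sym c≡ , refl
  offset-surjective {suc m} ch c (suc q) (s≤s q<) | yes c≡ with offset-surjective (ch ∘ suc) c q q<
  ... | i , eq , refl = suc i , eq , cong (_+ offset (ch ∘ suc) i) (⟦⟧-yes (ch (suc i) ≟ ch zero) (trans eq c≡))
  offset-surjective {suc m} ch c q       q<       | no c≢ with offset-surjective (ch ∘ suc) c q q<
  ... | i , eq , refl = suc i , eq , cong (_+ offset (ch ∘ suc) i) (⟦⟧-no (ch (suc i) ≟ ch zero) (c≢ ∘ trans (sym eq)))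

  offset-mono : ∀ {m} (ch : Fin m → Fin k) {i j} → ch i ≡ ch j → i Fin.< j → offset ch i ℕ.< offset ch j
  offset-mono ch {zero}  {suc j} eq i<j = subst (λ n → 0 ℕ.< n + offset (ch ∘ suc) j) (sym (⟦⟧-yes (ch (suc j) ≟ ch zero) (sym eq))) (s≤s z≤n)
  offset-mono ch {suc i} {suc j} eq (s≤s i<j) rewrite eq = ℕₚ.+-monoʳ-< ⟦ ch (suc j) ≟ ch zero ⟧ (offset-mono (ch ∘ suc) eq i<j)

  offset-cancel-< : ∀ {m} (ch : Fin m → Fin k) {i j} → ch i ≡ ch j → offset ch i ℕ.< offset ch j → i Fin.< j
  offset-cancel-< ch {i} {j} eq lt with Finₚ.<-cmp i j
  ... | tri< i<j _ _  = i<j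
  ... | tri≈ _ refl _ = contradiction lt (ℕₚ.<-irrefl refl)
  ... | tri> _ _ j<i  = contradiction lt (ℕₚ.<-asym (offset-mono ch (sym eq) j<i))

  offset-injective : ∀ {m} (ch : Fin m → Fin k) {i j} → ch i ≡ ch j → offset ch i ≡ offset ch j → i ≡ j
  offset-injective ch {i} {j} eq off≡ with Finₚ.<-cmp i j
  ... | tri< i<j _ _ = contradiction off≡ (ℕₚ.<⇒≢ (offset-mono ch eq i<j))
  ... | tri≈ _ i≡j _ = i≡j
  ... | tri> _ _ j<i = contradiction (sym off≡) (ℕₚ.<⇒≢ (offset-mono ch (sym eq) j<i))

  Monotone : ∀ {m} → (Fin m → Fin k) → Set
  Monotone ch = ∀ {i j} → i Fin.≤ j → ch i Fin.≤ ch j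

  less-none : ∀ {c w} → All (c Fin.≤_) w → less c w ≡ 0
  less-none         []          = refl
  less-none {c} {d ∷ w} (c≤d ∷ c≤w) = trans (less-∷-≥ w c≤d) (less-none c≤w)

  -- Consecutive labelling enters here: the labels below `i` are all those of the preceding chains
  -- and those lower in its own chain.
  toℕ≡less+offset : ∀ {m} (ch : Fin m → Fin k) → Monotone ch → ∀ i → toℕ i ≡ less (ch i) (List.tabulate ch) + offset ch i
  toℕ≡less+offset ch mono zero    = sym (cong (_+ 0) (less-none (Allₚ.tabulate⁺ {f = ch} λ i → mono {zero} {i} z≤n)))
  toℕ≡less+offset ch mono (suc i) = begin
    1 + toℕ i
      ≡⟨ cong (1 +_) (toℕ≡less+offset (ch ∘ suc) (mono ∘ s≤s) i) ⟩
    1 + (less c t + o)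
      ≡⟨ cong (_+ (less c t + o)) (one (mono {zero} {suc i} z≤n)) ⟨
    (⟦ ch zero Finₚ.<? c ⟧ + ⟦ c ≟ ch zero ⟧) + (less c t + o)
      ≡⟨ +-interchange ⟦ ch zero Finₚ.<? c ⟧ ⟦ c ≟ ch zero ⟧ (less c t) o ⟩
    (⟦ ch zero Finₚ.<? c ⟧ + less c t) + (⟦ c ≟ ch zero ⟧ + o) ∎
    where
    open ≡-Reasoning
    open import Algebra.Properties.CommutativeSemigroup ℕₚ.+-commutativeSemigroup using () renaming (interchange to +-interchange)
    c = ch (suc i)
    t = List.tabulate (ch ∘ suc)
    o = offset (ch ∘ suc) i
    one : ch zero Fin.≤ c → ⟦ ch zero Finₚ.<? c ⟧ + ⟦ c ≟ ch zero ⟧ ≡ 1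
    one le with c ≟ ch zero
    ... | yes c≡ = cong (_+ 1) (⟦⟧-no (ch zero Finₚ.<? c) (ℕₚ.<-irrefl (cong toℕ (sym c≡))))
    ... | no  c≢ = cong (_+ 0) (⟦⟧-yes (ch zero Finₚ.<? c) (Finₚ.≤∧≢⇒< le (c≢ ∘ sym)))

  module Letters {m} (ch : Fin m → Fin k) where

    private
      off : Fin m → ℕ
      off = offset ch
      t : List (Fin k)
      t = List.tabulate ch

    -- Holding for all pairs of a list, it expresses both the order condition and the absence of
    -- repetitions, since `a ≡ b` would give `a < a`.
    Earlier : Fin m → Fin m → Set
    Earlier a b = ch a ≡ ch b → a Fin.< b

    -- l lists every chain upwards, starting behind the labels already used up by p.
    Standard : List (Fin k) → List (Fin m) → Set
    Standard p []      = ⊤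
    Standard p (a ∷ l) = off a ≡ count (ch a) p × Standard (ch a ∷ p) l

    earlier⇒unique : ∀ {l} → AllPairs Earlier l → Unique l
    earlier⇒unique = AllPairs.map λ { earlier refl → ℕₚ.<-irrefl refl (earlier refl) }

    standard⇒count≤offset : ∀ p l → Standard p l → All (λ b → count (ch b) p ℕ.≤ off b) l
    standard⇒count≤offset p []      _          = []
    standard⇒count≤offset p (a ∷ l) (eq , std) = ℕₚ.≤-reflexive (sym eq) ∷
      All.map (ℕₚ.≤-trans (ℕₚ.m≤n+m _ _)) (standard⇒count≤offset (ch a ∷ p) l std)

    standard⇒earlier : ∀ p l → Standard p l → AllPairs Earlier l
    standard⇒earlier p []      _          = []
    standard⇒earlier p (a ∷ l) (eq , std) =
      All.map (λ {b} le a≡b → offset-cancel-< ch a≡b (ℕₚ.≤-trans (ℕₚ.≤-reflexive (lemma b a≡b)) le)) (standard⇒count≤offset (ch a ∷ p) l std)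
      ∷ standard⇒earlier (ch a ∷ p) l std
      where
      lemma : ∀ b → ch a ≡ ch b → suc (off a) ≡ count (ch b) (ch a ∷ p)
      lemma b a≡b rewrite sym a≡b = trans (cong suc eq) (sym (count-here (ch a) p))

    earlier⇒standard : ∀ p l → AllPairs Earlier l → (∀ i → count (ch i) p ℕ.≤ off i → i ∈ l) →
                       (∀ {i} → i ∈ l → count (ch i) p ℕ.≤ off i) → Standard p l
    earlier⇒standard p []      _          complete sound = tt
    earlier⇒standard p (a ∷ l) (a< ∷ l<) complete sound = sym off-a , earlier⇒standard (ch a ∷ p) l l< complete′ sound′
      where
      off-a : count (ch a) p ≡ off a
      off-a with ℕₚ.m≤n⇒m<n∨m≡n (sound (here refl))
      ... | inj₂ eq = eq
      ... | inj₁ lt with offset-surjective ch (ch a) (count (ch a) p) (ℕₚ.<-trans lt (offset< ch a))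
      ...   | i , ch≡ , off≡ with complete i (ℕₚ.≤-reflexive (trans (cong (λ c → count c p) ch≡) (sym off≡)))
      ...     | here refl = sym off≡
      ...     | there i∈l = contradiction (offset-mono ch (sym ch≡) (All.lookup a< i∈l (sym ch≡)))
                              (ℕₚ.<-asym (subst (ℕ._< off a) (sym off≡) lt))
      complete′ : ∀ i → count (ch i) (ch a ∷ p) ℕ.≤ off i → i ∈ l
      complete′ i le with complete i (ℕₚ.≤-trans (ℕₚ.m≤n+m _ _) le)
      ... | there i∈l = i∈l
      ... | here refl = contradiction le (ℕₚ.<⇒≱ (ℕₚ.≤-reflexive (trans (cong suc (sym off-a)) (sym (count-here (ch a) p)))))
      sound′ : ∀ {i} → i ∈ l → count (ch i) (ch a ∷ p) ℕ.≤ off i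
      sound′ {i} i∈l with ch i ≟ ch a
      ... | no  _   = sound (there i∈l)
      ... | yes i≡a = ℕₚ.≤-trans (s≤s (ℕₚ.≤-reflexive (trans (cong (λ c → count c p) i≡a) off-a)))
                        (offset-mono ch (sym i≡a) (All.lookup a< i∈l (sym i≡a)))

    standard-injective : ∀ p {l l′} → Standard p l → Standard p l′ → List.map ch l ≡ List.map ch l′ → l ≡ l′
    standard-injective p {[]}    {[]}     _          _            eq = refl
    standard-injective p {a ∷ l} {b ∷ l′} (a≡ , std) (b≡ , std′) eq with Listₚ.∷-injectiveˡ eq
    ... | a≡b with offset-injective ch a≡b (trans a≡ (trans (cong (λ c → count c p) a≡b) (sym b≡)))
    ...   | refl = cong (a ∷_) (standard-injective (ch a ∷ p) std std′ (Listₚ.∷-injectiveʳ eq))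

    standard-surjective : ∀ p v → (∀ c → count c p + count c v ℕ.≤ count c t) → ∃ λ l → Standard p l × List.map ch l ≡ v
    standard-surjective p []      le = [] , tt , refl
    standard-surjective p (c ∷ v) le with offset-surjective ch c (count c p)
      (ℕₚ.≤-trans (ℕₚ.≤-trans (s≤s (ℕₚ.m≤m+n _ (count c v))) (ℕₚ.≤-reflexive (trans (sym (ℕₚ.+-suc _ _)) (cong (count c p +_) (sym (count-here c v)))))) (le c))
    ... | i , refl , eq with standard-surjective (ch i ∷ p) v (λ c → ℕₚ.≤-trans (ℕₚ.≤-reflexive (reorder c)) (le c))
      where
      reorder : ∀ c → count c (ch i ∷ p) + count c v ≡ count c p + count c (ch i ∷ v)
      reorder c = trans (cong (_+ count c v) (ℕₚ.+-comm ⟦ c ≟ ch i ⟧ (count c p))) (ℕₚ.+-assoc (count c p) _ _)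
    ...   | l , std , refl = i ∷ l , (eq , std) , refl

    standard-at : ∀ p l a r → Standard p (l ++ a ∷ r) → off a ≡ count (ch a) p + count (ch a) (List.map ch l)
    standard-at p []      a r (eq , _)  = trans eq (sym (ℕₚ.+-identityʳ _))
    standard-at p (b ∷ l) a r (_ , std) = trans (standard-at (ch b ∷ p) l a r std)
      (trans (cong (_+ count (ch a) (List.map ch l)) (ℕₚ.+-comm ⟦ ch a ≟ ch b ⟧ (count (ch a) p))) (ℕₚ.+-assoc (count (ch a) p) _ _))

    letters : ∀ {n} → Vec (Fin m) n → List (Fin k)
    letters π = List.map ch (toList π)

    -- The poset is known only through `ch`, so that the results serve both for `P` and for its
    -- restrictions, with `ch ∘ embed S` as chain map.
    module LinearExtensions (Q : LabelledPoset m)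
      (≼⇒chain : ∀ {i j} → LabelledPoset._≼_ Q i j → ch i ≡ ch j × i Fin.≤ j)
      (chain⇒≼ : ∀ {i j} → ch i ≡ ch j → i Fin.≤ j → LabelledPoset._≼_ Q i j) where
      open LabelledPoset Q

      earlier⁺ : ∀ {n} (π : Vec (Fin m) n) → VecAllPairs.AllPairs _≢_ π →
                 (∀ p q → lookup π p ≺ lookup π q → p Fin.< q) → AllPairs Earlier (toList π)
      earlier⁺ []      _           ordered = []
      earlier⁺ (a ∷ π) (a∉π VecAllPairs.∷ π!) ordered = All-toList π earlier ∷ earlier⁺ π π! (λ p q lt → ℕₚ.≤-pred (ordered (suc p) (suc q) lt))
        where
        earlier : ∀ q → Earlier a (lookup π q)
        earlier q eq with Finₚ.<-cmp a (lookup π q)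
        ... | tri< a<b _ _ = a<b
        ... | tri≈ _ a≡b _ = contradiction a≡b (VecAllₚ.lookup⁺ a∉π q)
        ... | tri> _ a≢b b<a = contradiction (ordered (suc q) zero (chain⇒≼ (sym eq) (ℕₚ.<⇒≤ b<a) , a≢b ∘ sym)) λ ()

      earlier⁻ : ∀ {n} (π : Vec (Fin m) n) → AllPairs Earlier (toList π) →
                 VecAllPairs.AllPairs _≢_ π × (∀ p q → lookup π p ≺ lookup π q → p Fin.< q)
      earlier⁻ []      []        = VecAllPairs.[] , λ ()
      earlier⁻ (a ∷ π) (a< ∷ π<) = all≢ π a< VecAllPairs.∷ proj₁ (earlier⁻ π π<) , ordered
        where
        all≢ : ∀ {n} (w : Vec (Fin m) n) → All (Earlier a) (toList w) → VecAll.All (a ≢_) w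
        all≢ []      []        = VecAll.[]
        all≢ (b ∷ w) (e ∷ es) = (λ { refl → ℕₚ.<-irrefl refl (e refl) }) VecAll.∷ all≢ w es
        ordered : ∀ p q → lookup (a ∷ π) p ≺ lookup (a ∷ π) q → p Fin.< q
        ordered zero    zero    (_ , a≢a) = contradiction refl a≢a
        ordered zero    (suc q) _         = s≤s z≤n
        ordered (suc p) zero    (le , _)  = contradiction (All.lookup a< (lookup-∈-toList π p) (sym (proj₁ (≼⇒chain le)))) (ℕₚ.≤⇒≯ (proj₂ (≼⇒chain le)))
        ordered (suc p) (suc q) lt        = s≤s (proj₂ (earlier⁻ π π<) p q lt)

      module _ {π : Word m} (le : IsLinearExtension Q π) where
        le⇒earlier : AllPairs Earlier (toList π)
        le⇒earlier = earlier⁺ π (proj₁ le) (proj₂ le)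

        le⇒complete : ∀ i → i ∈ toList π
        le⇒complete = unique-complete (earlier⇒unique le⇒earlier) (Vecₚ.length-toList π)

        le⇒standard : Standard [] (toList π)
        le⇒standard = earlier⇒standard [] (toList π) le⇒earlier (λ i _ → le⇒complete i) (λ _ → z≤n)

        letters-↭ : letters π ↭ t
        letters-↭ = ↭-trans (↭ₚ.map⁺ ch (unique⇒↭ (earlier⇒unique le⇒earlier) (Uniqueₚ.allFin⁺ m) (λ _ → ∈ₚ.∈-allFin _) (λ _ → le⇒complete _)))
          (↭.↭-reflexive (Listₚ.map-tabulate id ch))

        offset-lookup : ∀ j → ∃₂ λ p r → letters π ≡ p ++ ch (lookup π j) ∷ r × length p ≡ toℕ j × off (lookup π j) ≡ count (ch (lookup π j)) p
        offset-lookup j with toList-split π j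
        ... | l , r , eq , len = List.map ch l , List.map ch r
                               , trans (cong (List.map ch) eq) (Listₚ.map-++ ch l _)
                               , trans (Listₚ.length-map ch l) len
                               , standard-at [] l (lookup π j) r (subst (Standard []) eq le⇒standard)

        module _ (mono : Monotone ch) where
          -- With `c` the chain of the label at `j`, the position is `other c p + count c p` and the
          -- label is `less c (letters π) + count c p`; the common summand cancels.
          fixed-letter : ∀ {j p} → length p ≡ toℕ j → off (lookup π j) ≡ count (ch (lookup π j)) p →
                         (lookup π j ≡ j → other (ch (lookup π j)) p ≡ less (ch (lookup π j)) (letters π)) ×
                         (other (ch (lookup π j)) p ≡ less (ch (lookup π j)) (letters π) → lookup π j ≡ j)
          fixed-letter {j} {p} len off≡ =
              (λ a≡j → ℕₚ.+-cancelʳ-≡ (count c p) _ _ (trans (other+count c p) (trans len (trans (cong toℕ (sym a≡j)) toℕ-a))))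
            , (λ fix → toℕ-injective (trans toℕ-a (trans (cong (_+ count c p) (sym fix)) (trans (other+count c p) len))))
            where
            a = lookup π j
            c = ch a
            toℕ-a : toℕ a ≡ less c (letters π) + count c p
            toℕ-a = trans (toℕ≡less+offset ch mono a) (cong₂ _+_ (less-↭ c (↭-sym letters-↭)) off≡)

          derangement⁺ : (∀ j → lookup π j ≢ j) → Unfixed k (letters π)
          derangement⁺ der c _ (p , r , eq , fix) with map-split ch (toList π) p eq
          ... | l , a , s , eq′ , refl , refl with lookup-split π l eq′
          ...   | j , refl , len = der j (proj₂ (fixed-letter {j} {p} (trans (Listₚ.length-map ch l) (sym len))
                    (standard-at [] l a s (subst (Standard []) eq′ le⇒standard))) fix)

          derangement⁻ : Unfixed k (letters π) → ∀ j → lookup π j ≢ j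
          derangement⁻ unfixed j a≡j with offset-lookup j
          ... | p , r , eq , len , off≡ = unfixed (ch (lookup π j)) (toℕ<n _) (p , r , eq , proj₁ (fixed-letter {j} {p} len off≡) a≡j)

      letters-injective : ∀ {π ρ} → IsLinearExtension Q π → IsLinearExtension Q ρ → letters π ≡ letters ρ → π ≡ ρ
      letters-injective {π} {ρ} le le′ eq = toList-injective π ρ (standard-injective [] (le⇒standard le) (le⇒standard le′) eq)

      letters-surjective : ∀ {v} → v ↭ t → ∃ λ π → IsLinearExtension Q π × letters π ≡ v
      letters-surjective {v} v↭t with standard-surjective [] v (λ c → ℕₚ.≤-reflexive (count-↭ c v↭t))
      ... | l , std , eq with vector l (trans (sym (Listₚ.length-map ch l)) (trans (cong length eq) (trans (↭-length v↭t) (Listₚ.length-tabulate ch))))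
        where
        vector : ∀ {n} (l : List (Fin m)) → length l ≡ n → ∃ λ (π : Vec (Fin m) n) → toList π ≡ l
        vector l refl = Vec.fromList l , Vecₚ.toList∘fromList l
      ...   | π , refl = π , earlier⁻ π (standard⇒earlier [] (toList π) std) , eq

      private
        candidates : List (Word m)
        candidates = allVecs (allFin m) m
        candidates! : Unique candidates
        candidates! = allVecs-unique (Uniqueₚ.allFin⁺ m) m

      ∈-linearExtensions⁺ : ∀ {π} → IsLinearExtension Q π → π ∈ linearExtensions Q
      ∈-linearExtensions⁺ {π} = ∈ₚ.∈-filter⁺ (isLinearExtension? Q) (∈-allVecs ∈ₚ.∈-allFin π)

      ∈-linearExtensions⁻ : ∀ {π} → π ∈ linearExtensions Q → IsLinearExtension Q π
      ∈-linearExtensions⁻ π∈ = proj₂ (∈ₚ.∈-filter⁻ (isLinearExtension? Q) {xs = candidates} π∈)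

      linearExtensions-unique : Unique (linearExtensions Q)
      linearExtensions-unique = Uniqueₚ.filter⁺ (isLinearExtension? Q) candidates!

      #posetDerangements≡#unfixed : Monotone ch → #posetDerangements Q ≡ Peeling.#words fixed-peeling k t
      #posetDerangements≡#unfixed mono = bijection-length letters
        (Uniqueₚ.filter⁺ (isPosetDerangement? Q) candidates!) (Uniqueₚ.filter⁺ (Peeling.Z? fixed-peeling k) (words-unique t))
        (λ π∈ → let le , der = is-derangement π∈ in
          ∈ₚ.∈-filter⁺ (Peeling.Z? fixed-peeling k) (∈-words⁺ (letters-↭ le)) (derangement⁺ le mono der))
        (λ π∈ ρ∈ → letters-injective (proj₁ (is-derangement π∈)) (proj₁ (is-derangement ρ∈)))
        surjective
        where
        is-derangement : ∀ {π} → π ∈ filter (isPosetDerangement? Q) candidates → IsPosetDerangement Q π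
        is-derangement π∈ = proj₂ (∈ₚ.∈-filter⁻ (isPosetDerangement? Q) {xs = candidates} π∈)
        surjective : ∀ {v} → v ∈ filter (Peeling.Z? fixed-peeling k) (words t) →
                     ∃ λ π → π ∈ filter (isPosetDerangement? Q) candidates × letters π ≡ v
        surjective v∈ with ∈ₚ.∈-filter⁻ (Peeling.Z? fixed-peeling k) {xs = words t} v∈
        ... | v∈′ , unfixed with letters-surjective (∈-words⁻ v∈′)
        ...   | π , le , refl = π , ∈ₚ.∈-filter⁺ (isPosetDerangement? Q) (∈-allVecs ∈ₚ.∈-allFin π) (le , derangement⁻ le mono unfixed) , refl

      incomparable⇒chain≢ : ∀ {a b} → Incomparable a b → ch a ≢ ch b
      incomparable⇒chain≢ {a} {b} (¬≼ , ¬≽) eq with Finₚ.≤-total a b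
      ... | inj₁ a≤b = ¬≼ (chain⇒≼ eq a≤b)
      ... | inj₂ b≤a = ¬≽ (chain⇒≼ (sym eq) b≤a)

      comparable⇒chain≡ : ∀ {a b} → ¬ Incomparable a b → ch a ≡ ch b
      comparable⇒chain≡ {a} {b} comparable with ch a ≟ ch b
      ... | yes eq = eq
      ... | no  ≢  = contradiction ((λ le → ≢ (proj₁ (≼⇒chain le))) , (λ le → ≢ (sym (proj₁ (≼⇒chain le))))) comparable

      -- One stage of promotion: a label carried to the right overtakes an incomparable neighbour,
      -- but stays behind a comparable one, which is then carried on in its stead.
      data Step (a b : Fin m) {n} (w : Vec (Fin m) n) : Vec (Fin m) (suc (suc n)) → Set where
        pass   : ch a ≢ ch b → Step a b w (b ∷ ∂ Q zero (a ∷ w))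
        bounce : ch a ≡ ch b → Step a b w (a ∷ ∂ Q zero (b ∷ w))

      foldl-suc : ∀ {n} a (w : Vec (Fin m) (suc n)) is →
                  List.foldl (λ w i → τ Q i w) (a ∷ w) (List.map suc is) ≡ a ∷ List.foldl (λ w i → τ Q i w) w is
      foldl-suc a w []       = refl
      foldl-suc a w (i ∷ is) = foldl-suc a (τ Q i w) is

      ∂-suc : ∀ {n} j a (w : Vec (Fin m) n) → ∂ Q (suc j) (a ∷ w) ≡ a ∷ ∂ Q j w
      ∂-suc {suc n} j a w = trans
        (cong (λ is → List.foldl (λ w i → τ Q i w) (a ∷ w) is)
          (trans (cong (List.drop (toℕ j)) (sym (Listₚ.map-tabulate id suc))) (Listₚ.drop-map (toℕ j) (allFin n))))
        (foldl-suc a w (List.drop (toℕ j) (allFin n)))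

      ∂-step : ∀ {n} a b (w : Vec (Fin m) n) → Step a b w (∂ Q zero (a ∷ b ∷ w))
      ∂-step {n} a b w = subst (Step a b w)
        (sym (cong (List.foldl (λ w i → τ Q i w) (τ Q zero (a ∷ b ∷ w))) (sym (Listₚ.map-tabulate id suc))))
        (step (incomparable? a b))
        where
        step : (inc : Dec (Incomparable a b)) →
               Step a b w (List.foldl (λ w i → τ Q i w) (if does inc then b ∷ a ∷ w else a ∷ b ∷ w) (List.map suc (allFin n)))
        step (yes inc) = subst (Step a b w) (sym (foldl-suc b (a ∷ w) (allFin n))) (pass (incomparable⇒chain≢ inc))
        step (no ¬inc) = subst (Step a b w) (sym (foldl-suc a (b ∷ w) (allFin n))) (bounce (comparable⇒chain≡ ¬inc))

      -- When the carried label changes, the old and the new one lie in the same chain. Among the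
      -- letters, then, it is always `ch a` that travels to the end.
      ∂-zero-letters : ∀ {n} a (w : Vec (Fin m) n) → letters (∂ Q zero (a ∷ w)) ≡ letters w ++ [ ch a ]
      ∂-zero-letters a []      = refl
      ∂-zero-letters a (b ∷ w) with ∂ Q zero (a ∷ b ∷ w) | ∂-step a b w
      ... | _ | pass _    = cong (ch b ∷_) (∂-zero-letters a w)
      ... | _ | bounce eq = cong₂ _∷_ eq (trans (∂-zero-letters b w) (cong (λ c → letters w ++ [ c ]) (sym eq)))

      ∂-zero-All : ∀ {P : Fin m → Set} {n} a (w : Vec (Fin m) n) → All P (toList (a ∷ w)) → All P (toList (∂ Q zero (a ∷ w)))
      ∂-zero-All a []      ps              = ps
      ∂-zero-All a (b ∷ w) (pa ∷ pb ∷ ps) with ∂ Q zero (a ∷ b ∷ w) | ∂-step a b w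
      ... | _ | pass _   = pb ∷ ∂-zero-All a w (pa ∷ ps)
      ... | _ | bounce _ = pa ∷ ∂-zero-All b w (pb ∷ ps)

      ∂-All : ∀ {P : Fin m → Set} {n} j (w : Vec (Fin m) n) → All P (toList w) → All P (toList (∂ Q j w))
      ∂-All zero    (a ∷ w) ps        = ∂-zero-All a w ps
      ∂-All (suc j) (a ∷ w) (pa ∷ ps) rewrite ∂-suc j a w = pa ∷ ∂-All j w ps

      -- Only labels of different chains are ever interchanged.
      ∂-zero-earlier : ∀ {n} a (w : Vec (Fin m) n) → AllPairs Earlier (toList (a ∷ w)) → AllPairs Earlier (toList (∂ Q zero (a ∷ w)))
      ∂-zero-earlier a []      es = es
      ∂-zero-earlier a (b ∷ w) ((ab ∷ as) ∷ bs ∷ es) with ∂ Q zero (a ∷ b ∷ w) | ∂-step a b w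
      ... | _ | pass a≢b = ∂-zero-All a w ((λ eq → contradiction (sym eq) a≢b) ∷ bs) ∷ ∂-zero-earlier a w (as ∷ es)
      ... | _ | bounce _ = ∂-zero-All b w (ab ∷ as) ∷ ∂-zero-earlier b w (bs ∷ es)

      ∂-earlier : ∀ {n} j (w : Vec (Fin m) n) → AllPairs Earlier (toList w) → AllPairs Earlier (toList (∂ Q j w))
      ∂-earlier zero    (a ∷ w) es        = ∂-zero-earlier a w es
      ∂-earlier (suc j) (a ∷ w) (as ∷ es) rewrite ∂-suc j a w = ∂-All j w as ∷ ∂-earlier j w es

      ∂-linearExtension : ∀ j {π} → IsLinearExtension Q π → IsLinearExtension Q (∂ Q j π)
      ∂-linearExtension j {π} le = earlier⁻ (∂ Q j π) (∂-earlier j π (le⇒earlier le))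

      ∂-letters : ∀ {n} j (w : Vec (Fin m) n) → ∃₂ λ p r → letters w ≡ p ++ ch (lookup w j) ∷ r × length p ≡ toℕ j ×
                  letters (∂ Q j w) ≡ (p ++ r) ++ [ ch (lookup w j) ]
      ∂-letters zero    (a ∷ w) = [] , letters w , refl , refl , ∂-zero-letters a w
      ∂-letters (suc j) (a ∷ w) rewrite ∂-suc j a w with ∂-letters j w
      ... | p , r , eq , len , eq′ = ch a ∷ p , r , cong (ch a ∷_) eq , cong suc len , cong (ch a ∷_) eq′

      -- The height of a label is the number of earlier letters of its chain. Expressed this way,
      -- the move depends on the label at `j` only and no longer on the position.
      ∂-letters-rm : ∀ j {π} → IsLinearExtension Q π → let c = ch (lookup π j) in
                     letters (∂ Q j π) ≡ rm c (off (lookup π j)) (letters π) ++ [ c ]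
      ∂-letters-rm j {π} le with ∂-letters j π | offset-lookup le j
      ... | p , r , eq , len , eq′ | p′ , r′ , eq″ , len′ , off≡
        with same-prefix p p′ (trans len (sym len′)) (trans (sym eq) eq″)
        where
        same-prefix : ∀ {A : Set} (p p′ : List A) {r r′} → length p ≡ length p′ → p ++ r ≡ p′ ++ r′ → p ≡ p′
        same-prefix []      []       len eq = refl
        same-prefix (a ∷ p) (b ∷ p′) len eq = cong₂ _∷_ (Listₚ.∷-injectiveˡ eq) (same-prefix p p′ (ℕₚ.suc-injective len) (Listₚ.∷-injectiveʳ eq))
      ... | refl = trans eq′ (cong (_++ [ c ]) (sym (begin
        rm c (off (lookup π j)) (letters π)   ≡⟨ cong₂ (rm c) off≡ eq ⟩
        rm c (count c p) (p ++ c ∷ r)         ≡⟨ rm-++ʳ c (count c p) p (c ∷ r) ℕₚ.≤-refl ⟩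
        p ++ rm c (count c p ∸ count c p) (c ∷ r) ≡⟨ cong (λ q → p ++ rm c q (c ∷ r)) (ℕₚ.n∸n≡0 (count c p)) ⟩
        p ++ rm c 0 (c ∷ r)                   ≡⟨ cong (p ++_) rm-here ⟩
        p ++ r                                ∎)))
        where
        open ≡-Reasoning
        c = ch (lookup π j)
        rm-here : rm c 0 (c ∷ r) ≡ r
        rm-here with c ≟ c
        ... | yes _   = refl
        ... | no  c≢c = contradiction refl c≢c

-- The increasing enumeration of a subset.

module EmbedLemmas where
  open ≡ using (refl; cong)

  embed-mono-< : ∀ {n} (S : Subset n) {i j} → i Fin.< j → embed S i Fin.< embed S j
  embed-mono-< (outside ∷ S)                 i<j       = s≤s (embed-mono-< S i<j)
  embed-mono-< (inside  ∷ S) {zero}  {suc j} i<j       = s≤s z≤n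
  embed-mono-< (inside  ∷ S) {suc i} {suc j} (s≤s i<j) = s≤s (embed-mono-< S i<j)

  embed-mono-≤ : ∀ {n} (S : Subset n) {i j} → i Fin.≤ j → embed S i Fin.≤ embed S j
  embed-mono-≤ S {i} {j} i≤j with i ≟ j
  ... | yes refl = ℕₚ.≤-refl
  ... | no  i≢j  = ℕₚ.<⇒≤ (embed-mono-< S (Finₚ.≤∧≢⇒< i≤j i≢j))

  embed-cancel-≤ : ∀ {n} (S : Subset n) {i j} → embed S i Fin.≤ embed S j → i Fin.≤ j
  embed-cancel-≤ S {i} {j} le with Finₚ.≤-total i j
  ... | inj₁ i≤j = i≤j
  ... | inj₂ j≤i = ℕₚ.≤-reflexive (cong toℕ (embed-injective S (Finₚ.≤-antisym le (embed-mono-≤ S j≤i))))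

  thresholds-≡ : ∀ {x y} N → x ℕ.≤ N → y ℕ.≤ N → (∀ q → q ℕ.< N → q ℕ.< x → q ℕ.< y) →
                 (∀ q → q ℕ.< N → q ℕ.< y → q ℕ.< x) → x ≡ y
  thresholds-≡ {x} {y} N x≤N y≤N to from with ℕₚ.<-cmp x y
  ... | tri< x<y _ _ = contradiction (from x (ℕₚ.<-≤-trans x<y y≤N) x<y) (ℕₚ.<-irrefl refl)
  ... | tri≈ _ x≡y _ = x≡y
  ... | tri> _ _ y<x = contradiction (to y (ℕₚ.<-≤-trans y<x x≤N) y<x) (ℕₚ.<-irrefl refl)

  does-true⇒ : ∀ {p} {P : Set p} (P? : Dec P) → does P? ≡ true → P
  does-true⇒ (yes p) _ = p

  ⇒does-true : ∀ {p} {P : Set p} (P? : Dec P) → P → does P? ≡ true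
  ⇒does-true (yes _) _ = refl
  ⇒does-true (no ¬p) p = contradiction p ¬p

open EmbedLemmas

-- Lower sets, and the linear extensions belonging to a given one.

module Restriction (k : ℕ) where
  open import Data.Nat.Base using (_+_)
  open ≡ using (refl; sym; trans; cong; cong₂; subst; module ≡-Reasoning)
  open Shapes k
  open Parsing k
  open Counting k
  open Labelling k

  complement : ∀ v {t} → (∀ c → count c v ℕ.≤ count c t) → ∃ λ R → v ++ R ↭ t
  complement []      {t} le = t , ↭-refl
  complement (c ∷ v) {t} le with complement v {rm c 0 t} le′
    where
    c∷rm↭t : c ∷ rm c 0 t ↭ t
    c∷rm↭t = rm-↭ c 0 t (ℕₚ.≤-trans (subst (0 ℕ.<_) (sym (count-here c v)) (s≤s z≤n)) (le c))
    le′ : ∀ d → count d v ℕ.≤ count d (rm c 0 t)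
    le′ d = ℕₚ.+-cancelˡ-≤ ⟦ d ≟ c ⟧ _ _ (ℕₚ.≤-trans (le d) (ℕₚ.≤-reflexive (sym (count-↭ d c∷rm↭t))))
  ... | R , p = R , ↭-trans (prep c p) (rm-↭ c 0 t (ℕₚ.≤-trans (subst (0 ℕ.<_) (sym (count-here c v)) (s≤s z≤n)) (le c)))

  descending-unique : ∀ {U V} → Descending U → Descending V → U ↭ V → U ≡ V
  descending-unique {U} {V} U↓ V↓ U↭V with descending-greatest U↓ U↭V | descending-greatest V↓ (↭-sym U↭V)
  ... | inj₁ V≡U | _        = sym V≡U
  ... | inj₂ _   | inj₁ U≡V = U≡V
  ... | inj₂ V⊏U | inj₂ U⊏V = contradiction (numeral-mono (U⊏V {[]} {[]} refl)) (ℕₚ.<-asym (numeral-mono (V⊏U {[]} {[]} refl)))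

  ++-cancelˡ-↭ : ∀ (u : List (Fin k)) {v w} → u ++ v ↭ u ++ w → v ↭ w
  ++-cancelˡ-↭ []      p = p
  ++-cancelˡ-↭ (c ∷ u) p = ++-cancelˡ-↭ u (drop-∷ p)

  restAbove-k : ∀ {w} → RestAbove k w → rest (parse w) ≡ []
  restAbove-k {w} above with rest (parse w) | above
  ... | []    | _          = refl
  ... | c ∷ _ | k≤c ∷ _    = contradiction (toℕ<n c) (ℕₚ.≤⇒≯ k≤c)

  DownClosed : ∀ {n} → (Fin n → Fin k) → Subset n → Set
  DownClosed ch S = ∀ i j → i ∈ˢ S → ch j ≡ ch i → j Fin.≤ i → j ∈ˢ S

  labelsIn : ∀ {n} → (Fin n → Fin k) → Subset n → List (Fin k)
  labelsIn ch S = List.tabulate (ch ∘ embed S)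

  labelsIn≤ : ∀ {n} (ch : Fin n → Fin k) S c → count c (labelsIn ch S) ℕ.≤ count c (List.tabulate ch)
  labelsIn≤ ch []            c = z≤n
  labelsIn≤ ch (outside ∷ S) c = ℕₚ.≤-trans (labelsIn≤ (ch ∘ suc) S c) (ℕₚ.m≤n+m _ _)
  labelsIn≤ ch (inside ∷ S)  c = ℕₚ.+-monoʳ-≤ ⟦ c ≟ ch zero ⟧ (labelsIn≤ (ch ∘ suc) S c)

  downClosed-tail : ∀ {n} {ch : Fin (suc n) → Fin k} {b S} → DownClosed ch (b ∷ S) → DownClosed (ch ∘ suc) S
  downClosed-tail down i j i∈S eq j≤i with down (suc i) (suc j) (there i∈S) eq (s≤s j≤i)
  ... | there j∈S = j∈S

  chain-outside : ∀ {n} (ch : Fin n → Fin k) S c → (∀ i → i ∈ˢ S → ch i ≢ c) → count c (labelsIn ch S) ≡ 0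
  chain-outside ch []            c c∉ = refl
  chain-outside ch (outside ∷ S) c c∉ = chain-outside (ch ∘ suc) S c (λ i i∈S → c∉ (suc i) (there i∈S))
  chain-outside ch (inside ∷ S)  c c∉ = cong₂ _+_ (⟦⟧-no (c ≟ ch zero) (c∉ zero here ∘ sym)) (chain-outside (ch ∘ suc) S c (λ i i∈S → c∉ (suc i) (there i∈S)))

  outside-0 : ∀ {n} (ch : Fin (suc n) → Fin k) S → DownClosed ch (outside ∷ S) → count (ch zero) (labelsIn (ch ∘ suc) S) ≡ 0
  outside-0 ch S down = chain-outside (ch ∘ suc) S (ch zero) λ i i∈S eq →
    contradiction (down (suc i) zero (there i∈S) (sym eq) z≤n) λ ()

  -- A lower set takes an initial segment of every chain, so membership amounts to comparing the
  -- height with the number of labels taken from the chain.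
  ∈⇒offset< : ∀ {n} (ch : Fin n → Fin k) S → DownClosed ch S → ∀ {i} → i ∈ˢ S → offset ch i ℕ.< count (ch i) (labelsIn ch S)
  ∈⇒offset< ch (inside ∷ S)  down here = subst (0 ℕ.<_) (sym (count-here (ch zero) (labelsIn (ch ∘ suc) S))) (s≤s z≤n)
  ∈⇒offset< ch (inside ∷ S)  down {suc i} (there i∈S) = ℕₚ.+-monoʳ-< ⟦ ch (suc i) ≟ ch zero ⟧ (∈⇒offset< (ch ∘ suc) S (downClosed-tail {ch = ch} down) i∈S)
  ∈⇒offset< ch (outside ∷ S) down {suc i} (there i∈S) = ℕₚ.≤-<-trans
    -- As `zero` is outside, the set contains no label of its chain, so `zero` adds nothing to the
    -- height of `suc i`.
    (ℕₚ.≤-reflexive (cong (_+ offset (ch ∘ suc) i) (⟦⟧-no (ch (suc i) ≟ ch zero) λ eq → contradiction (down (suc i) zero (there i∈S) (sym eq) z≤n) λ ())))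
    (∈⇒offset< (ch ∘ suc) S (downClosed-tail {ch = ch} down) i∈S)

  offset<⇒∈ : ∀ {n} (ch : Fin n → Fin k) S → DownClosed ch S → ∀ {i} → offset ch i ℕ.< count (ch i) (labelsIn ch S) → i ∈ˢ S
  offset<⇒∈ ch (inside ∷ S)  down {zero}  lt = here
  offset<⇒∈ ch (inside ∷ S)  down {suc i} lt = there (offset<⇒∈ (ch ∘ suc) S (downClosed-tail {ch = ch} down) (ℕₚ.+-cancelˡ-< ⟦ ch (suc i) ≟ ch zero ⟧ _ _ lt))
  offset<⇒∈ ch (outside ∷ S) down {zero}  lt = contradiction (subst (0 ℕ.<_) (outside-0 ch S down) lt) λ ()
  offset<⇒∈ ch (outside ∷ S) down {suc i} lt = there (offset<⇒∈ (ch ∘ suc) S (downClosed-tail {ch = ch} down) (ℕₚ.≤-<-trans (ℕₚ.m≤n+m _ ⟦ ch (suc i) ≟ ch zero ⟧) lt))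

  module LowerSets {n : ℕ} (ch : Fin n → Fin k) (mono : Monotone ch) (P : LabelledPoset n)
    (≼⇒chain : ∀ {i j} → LabelledPoset._≼_ P i j → ch i ≡ ch j × i Fin.≤ j)
    (chain⇒≼ : ∀ {i j} → ch i ≡ ch j → i Fin.≤ j → LabelledPoset._≼_ P i j) where
    open LabelledPoset P
    open Letters ch
    open LinearExtensions P ≼⇒chain chain⇒≼

    private
      t : List (Fin k)
      t = List.tabulate ch

    -- The last part is a suffix of the word. From each chain, the labels in front of it are
    -- therefore the lowest ones, as many as the body has letters of that chain.
    lowerSet : Word n → Subset n
    lowerSet π = Vec.tabulate λ i → does (offset ch i ℕₚ.<? count (ch i) (body (parse (letters π))))

    ∈-lowerSet⁻ : ∀ π {i} → i ∈ˢ lowerSet π → offset ch i ℕ.< count (ch i) (body (parse (letters π)))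
    ∈-lowerSet⁻ π {i} i∈ = does-true⇒ (offset ch i ℕₚ.<? _) (trans (sym (Vecₚ.lookup∘tabulate _ i)) (Vecₚ.[]=⇒lookup i∈))

    ∈-lowerSet⁺ : ∀ π {i} → offset ch i ℕ.< count (ch i) (body (parse (letters π))) → i ∈ˢ lowerSet π
    ∈-lowerSet⁺ π {i} lt = Vecₚ.lookup⇒[]= i _ (trans (Vecₚ.lookup∘tabulate _ i) (⇒does-true (offset ch i ℕₚ.<? _) lt))

    lowerSet-isLower : ∀ π → IsLower (lowerSet π)
    lowerSet-isLower π x y x∈ y≼x with ≼⇒chain y≼x
    ... | eq , y≤x = ∈-lowerSet⁺ π (subst (λ c → offset ch y ℕ.< count c (body (parse (letters π)))) (sym eq) (ℕₚ.≤-<-trans offset≤ (∈-lowerSet⁻ π x∈)))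
      where
      offset≤ : offset ch y ℕ.≤ offset ch x
      offset≤ with y ≟ x
      ... | yes refl = ℕₚ.≤-refl
      ... | no  y≢x  = ℕₚ.<⇒≤ (offset-mono ch eq (Finₚ.≤∧≢⇒< y≤x y≢x))

    module _ (S : Subset n) (S-lower : IsLower S) where
      private
        down : DownClosed ch S
        down i j i∈S eq j≤i = S-lower i j i∈S (chain⇒≼ eq j≤i)
        tₛ : List (Fin k)
        tₛ = labelsIn ch S

      lowerSet⇒body : ∀ {π} → IsLinearExtension P π → lowerSet π ≡ S → body (parse (letters π)) ↭ tₛ
      lowerSet⇒body {π} le eq = count⇒↭ λ c → thresholds-≡ (count c t) (body≤ c) (labelsIn≤ ch S c) (to c) (from c)
        where
        body≤ : ∀ c → count c (body (parse (letters π))) ℕ.≤ count c t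
        body≤ c = ℕₚ.≤-trans (ℕₚ.m≤m+n _ _) (ℕₚ.≤-reflexive (trans (sym (count-++ c (body (parse (letters π))) (rest (parse (letters π)))))
          (trans (cong (count c) (body-++-rest (letters π))) (count-↭ c (letters-↭ le)))))
        to : ∀ c q → q ℕ.< count c t → q ℕ.< count c (body (parse (letters π))) → q ℕ.< count c tₛ
        to c q q< lt with offset-surjective ch c q q<
        ... | i , refl , refl = ∈⇒offset< ch S down (subst (i ∈ˢ_) eq (∈-lowerSet⁺ π lt))
        from : ∀ c q → q ℕ.< count c t → q ℕ.< count c tₛ → q ℕ.< count c (body (parse (letters π)))
        from c q q< lt with offset-surjective ch c q q<
        ... | i , refl , refl = ∈-lowerSet⁻ π (subst (i ∈ˢ_) (sym eq) (offset<⇒∈ ch S down lt))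

      body⇒lowerSet : ∀ {π} → body (parse (letters π)) ↭ tₛ → lowerSet π ≡ S
      body⇒lowerSet {π} p = Subsetₚ.⊆-antisym
        (λ {i} i∈ → offset<⇒∈ ch S down (subst (offset ch i ℕ.<_) (count-↭ (ch i) p) (∈-lowerSet⁻ π i∈)))
        (λ {i} i∈ → ∈-lowerSet⁺ π (subst (offset ch i ℕ.<_) (sym (count-↭ (ch i) p)) (∈⇒offset< ch S down i∈)))

      _≟ˢ_ : (S T : Subset n) → Dec (S ≡ T)
      _≟ˢ_ = Vecₚ.≡-dec Boolₚ._≟_

      -- The body determines the extension, because the last part consists of the remaining letters
      -- in descending order.
      #lowerSet≡#empty-rest : length (filter (λ π → lowerSet π ≟ˢ S) (linearExtensions P)) ≡ Peeling.#words rest-peeling k tₛ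
      #lowerSet≡#empty-rest = bijection-length (body ∘ parse ∘ letters)
        (Uniqueₚ.filter⁺ (λ π → lowerSet π ≟ˢ S) (linearExtensions-unique))
        (Uniqueₚ.filter⁺ (Peeling.Z? rest-peeling k) (words-unique tₛ))
        (λ {π} π∈ → let le , eq = member π∈ in ∈ₚ.∈-filter⁺ (Peeling.Z? rest-peeling k) (∈-words⁺ (lowerSet⇒body le eq))
          (subst (All _) (sym (rest-body (letters π))) []))
        injective surjective
        where
        member : ∀ {π} → π ∈ filter (λ π → lowerSet π ≟ˢ S) (linearExtensions P) → IsLinearExtension P π × lowerSet π ≡ S
        member π∈ with ∈ₚ.∈-filter⁻ (λ π → lowerSet π ≟ˢ S) {xs = linearExtensions P} π∈
        ... | π∈′ , eq = ∈-linearExtensions⁻ π∈′ , eq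
        rest-body : ∀ w → rest (parse (body (parse w))) ≡ []
        rest-body w = trans (cong (rest ∘ parse) (sym (Listₚ.++-identityʳ (body (parse w)))))
          (trans (cong rest (parse-body-++ w [])) (rest-setRest (parse w) []))
        injective : ∀ {π ρ} → π ∈ filter (λ π → lowerSet π ≟ˢ S) (linearExtensions P) →
                    ρ ∈ filter (λ π → lowerSet π ≟ˢ S) (linearExtensions P) →
                    body (parse (letters π)) ≡ body (parse (letters ρ)) → π ≡ ρ
        injective {π} {ρ} π∈ ρ∈ eq = letters-injective le le′
          (trans (sym (body-++-rest v)) (trans (cong₂ _++_ eq rests) (body-++-rest w)))
          where
          v = letters π
          w = letters ρ
          le = proj₁ (member π∈)
          le′ = proj₁ (member ρ∈)
          v↭w : v ↭ w
          v↭w = ↭-trans (letters-↭ le) (↭-sym (letters-↭ le′))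
          rests : rest (parse v) ≡ rest (parse w)
          rests = descending-unique (rest-descending (parse-valid v)) (rest-descending (parse-valid w))
            (++-cancelˡ-↭ (body (parse v)) (↭-trans (↭.↭-reflexive (body-++-rest v)) (↭-trans v↭w
              (↭.↭-reflexive (trans (sym (body-++-rest w)) (cong (_++ rest (parse w)) (sym eq)))))))
        surjective : ∀ {w} → w ∈ filter (Peeling.Z? rest-peeling k) (words tₛ) →
                     ∃ λ π → π ∈ filter (λ π → lowerSet π ≟ˢ S) (linearExtensions P) × body (parse (letters π)) ≡ w
        surjective {w} w∈ with ∈ₚ.∈-filter⁻ (Peeling.Z? rest-peeling k) {xs = words tₛ} w∈
        ... | w∈′ , above with complement w {t} (λ c → ℕₚ.≤-trans (ℕₚ.≤-reflexive (count-↭ c (∈-words⁻ {tₛ} w∈′))) (labelsIn≤ ch S c))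
        ...   | V , p with letters-surjective (↭-trans (++⁺ˡ w (sort-↭ V)) p)
        ...     | π , le , eq = π , ∈ₚ.∈-filter⁺ (λ π → lowerSet π ≟ˢ S) (∈-linearExtensions⁺ le)
                                      (body⇒lowerSet {π} (↭-trans (↭.↭-reflexive body≡w) (∈-words⁻ {tₛ} w∈′))) , body≡w
          where
          body-w : body (parse w) ≡ w
          body-w = trans (sym (Listₚ.++-identityʳ _)) (trans (cong (body (parse w) ++_) (sym (restAbove-k {w} above))) (body-++-rest w))
          body≡w : body (parse (letters π)) ≡ w
          body≡w = begin
            body (parse (letters π))              ≡⟨ cong (body ∘ parse) eq ⟩
            body (parse (w ++ sort V))               ≡⟨ cong (λ u → body (parse (u ++ sort V))) body-w ⟨
            body (parse (body (parse w) ++ sort V))  ≡⟨ cong body (parse-body-++ w (sort-descending V)) ⟩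
            body (setRest (parse w) (sort V))        ≡⟨ body-setRest (parse w) (sort V) ⟩
            body (parse w)                           ≡⟨ body-w ⟩
            w                                        ∎
            where open ≡-Reasoning

      -- The restriction keeps the alphabet of all `k` chain labels; a chain that misses `S` is a
      -- letter that does not occur.
      #lowerSet≡#posetDerangements : length (filter (λ π → lowerSet π ≟ˢ S) (linearExtensions P)) ≡ #posetDerangements (P ∣ₚ S)
      #lowerSet≡#posetDerangements = trans #lowerSet≡#empty-rest (trans (sym (#unfixed≡#empty-rest tₛ)) (sym
        (Letters.LinearExtensions.#posetDerangements≡#unfixed (ch ∘ embed S) (P ∣ₚ S)
          (λ le → let eq , i≤j = ≼⇒chain le in eq , embed-cancel-≤ S i≤j)
          (λ eq i≤j → chain⇒≼ eq (embed-mono-≤ S i≤j))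
          (mono ∘ embed-mono-≤ S))))

-- The intertwining relation and the factorisation of the determinant.

module Assembly {c ℓ : Level} (R : CommutativeRing c ℓ) {k n : ℕ} (ch : Fin n → Fin k) (P : LabelledPoset n)
  (≼⇒chain : ∀ {i j} → LabelledPoset._≼_ P i j → ch i ≡ ch j × i Fin.≤ j)
  (chain⇒≼ : ∀ {i j} → ch i ≡ ch j → i Fin.≤ j → LabelledPoset._≼_ P i j)
  (mono : Labelling.Monotone k ch)
  (t : CommutativeRing.Carrier R) (x : Fin n → CommutativeRing.Carrier R) where

  open CommutativeRing R hiding (zero)
  open OverRing R
  open Determinant R
  open Products R
  open Shapes k
  open Parsing k
  open Counting k
  open Labelling k
  open Restriction k
  open Letters ch
  open LinearExtensions P ≼⇒chain chain⇒≼
  open LowerSets ch mono P ≼⇒chain chain⇒≼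
  open import Algebra.Properties.Semiring.Sum semiring
    using (sum-cong-≋; ∑-distrib-+; ∑-comm; sum-permute; *-distribˡ-sum; *-distribʳ-sum)
  open import Algebra.Properties.Semiring.Mult semiring using (×1-homo-*; ×-homo-+) renaming (_×_ to _·_)
  open import Algebra.Properties.Group +-group using () renaming (∙-cancelʳ to +-cancelʳ; ⁻¹-involutive to -‿involutive)
  open import Relation.Binary.Reasoning.Setoid setoid

  private
    les : List (Word n)
    les = linearExtensions P
    N : ℕ
    N = length les
    labels : List (Fin k)
    labels = List.tabulate ch
    π[_] : Fin N → Word n
    π[ r ] = List.lookup les r
    w[_] : Fin N → List (Fin k)
    w[ r ] = letters π[ r ]
    F[_] : Fin N → Shape
    F[ r ] = parse w[ r ]
    off : Fin n → ℕ
    off = offset ch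
    le : ∀ r → IsLinearExtension P π[ r ]
    le r = ∈-linearExtensions⁻ (∈ₚ.∈-lookup r)
    les! : Unique les
    les! = linearExtensions-unique

  w-↭ : ∀ r → w[ r ] ↭ labels
  w-↭ r = letters-↭ (le r)

  π-injective : ∀ {r s} → π[ r ] ≡ π[ s ] → r ≡ s
  π-injective {r} {s} = lookup-injective les! r s

  w-injective : ∀ {r s} → w[ r ] ≡ w[ s ] → r ≡ s
  w-injective {r} {s} eq = π-injective (letters-injective (le r) (le s) eq)

  π-surjective : ∀ {π} → IsLinearExtension P π → ∃ λ r → π ≡ π[ r ]
  π-surjective π-le = Any.index π∈ , Anyₚ.lookup-index π∈
    where π∈ = ∈-linearExtensions⁺ π-le

  w-surjective : ∀ {v} → v ↭ labels → ∃ λ r → v ≡ w[ r ]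
  w-surjective v↭ with letters-surjective v↭
  ... | π , π-le , eq with π-surjective π-le
  ...   | r , π≡ = r , ≡.trans (≡.sym eq) (≡.cong letters π≡)

  flatten-F : ∀ r → flatten F[ r ] ≡ w[ r ]
  flatten-F r = flatten-parse w[ r ]

  length-F : ∀ r s → length (flatten F[ r ]) ≡ length w[ s ]
  length-F r s = ≡.trans (≡.cong length (flatten-F r)) (↭-length (↭-trans (w-↭ r) (↭-sym (w-↭ s))))

  -- Matches and coefficients are counted in ℕ, and only the resulting identities are carried over
  -- to the ring.
  ι : ℕ → Carrier
  ι m = m · 1#

  ι-+ : ∀ a b → ι (a ℕ.+ b) ≈ ι a + ι b
  ι-+ = ×-homo-+ 1#

  ι-1 : ι 1 ≈ 1#
  ι-1 = +-identityʳ 1#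

  E : Matrix N
  E r s = ι (match F[ r ] w[ s ])

  det-E : det E ≈ 1#
  det-E = trans (det-triangular (λ r → numeral w[ r ]) E off-diagonal) (∏ᶠ-1 diagonal)
    where
    diagonal : ∀ r → E r r ≈ 1#
    diagonal r = trans (reflexive (≡.cong ι (≡.trans (≡.cong (match F[ r ]) (≡.sym (flatten-F r))) (match-flatten F[ r ])))) ι-1
    off-diagonal : ∀ r s → r ≢ s → ¬ numeral w[ s ] ℕ.< numeral w[ r ] → E r s ≈ 0#
    off-diagonal r s r≢s s≮r with match F[ r ] w[ s ] ℕₚ.≟ 0
    ... | yes ≡0 = reflexive (≡.cong ι ≡0)
    ... | no  ≢0 with match-triangular (parse-valid w[ r ]) w[ s ] (length-F r s) ≢0
    ...   | inj₁ eq = contradiction (≡.sym (w-injective {s} {r} (≡.trans eq (flatten-F r)))) r≢s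
    ...   | inj₂ lt = contradiction (≡.subst (λ v → numeral w[ s ] ℕ.< numeral v) (flatten-F r) (numeral-mono lt)) s≮r

  occurrences : List (Fin k) → List Shape → ℕ
  occurrences w Fs = sumᴸ (List.map (λ F → ⟦ Listₚ.≡-dec _≟_ (flatten F) w ⟧) Fs)

  occurrences-none : ∀ {w Fs} → All (λ F → flatten F ≢ w) Fs → occurrences w Fs ≡ 0
  occurrences-none         []        = ≡.refl
  occurrences-none {w} {F ∷ Fs} (≢w ∷ ≢s) = ≡.cong₂ ℕ._+_ (⟦⟧-no (Listₚ.≡-dec _≟_ (flatten F) w) ≢w) (occurrences-none ≢s)

  -- A valid shape with the right content is the factorisation of exactly one linear extension, so
  -- summing rows of `E` with these multiplicities sums the matches of the list.
  ∑-occurrences : ∀ s {Fs} → All (λ F → Valid F × flatten F ↭ labels) Fs →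
                  ∑ (λ q → ι (occurrences w[ q ] Fs) * E q s) ≈ ι (∑match Fs w[ s ])
  ∑-occurrences s []                            = sum-zero {N} λ _ → zeroˡ _
  ∑-occurrences s {F ∷ Fs} ((F-valid , F↭) ∷ valid) with w-surjective F↭
  ... | q₀ , F≡ = begin
    ∑ (λ q → ι (eq? q ℕ.+ occurrences w[ q ] Fs) * E q s)
      ≈⟨ sum-cong-≋ (λ q → trans (*-congʳ (ι-+ (eq? q) _)) (distribʳ (E q s) _ _)) ⟩
    ∑ (λ q → ι (eq? q) * E q s + ι (occurrences w[ q ] Fs) * E q s)
      ≈⟨ ∑-distrib-+ (λ q → ι (eq? q) * E q s) _ ⟩
    ∑ (λ q → ι (eq? q) * E q s) + ∑ (λ q → ι (occurrences w[ q ] Fs) * E q s)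
      ≈⟨ +-cong (sum-single q₀ {λ q → ι (eq? q) * E q s} λ q q≢ → trans (*-congʳ (reflexive (≡.cong ι
           (⟦⟧-no (Listₚ.≡-dec _≟_ (flatten F) w[ q ]) λ F≡q → q≢ (w-injective {q} {q₀} (≡.trans (≡.sym F≡q) F≡)))))) (zeroˡ _))
           (∑-occurrences s valid) ⟩
    ι (eq? q₀) * E q₀ s + ι (∑match Fs w[ s ])
      ≈⟨ +-congʳ (trans (*-congʳ (trans (reflexive (≡.cong ι (⟦⟧-yes (Listₚ.≡-dec _≟_ (flatten F) w[ q₀ ]) F≡))) ι-1)) (*-identityˡ _)) ⟩
    E q₀ s + ι (∑match Fs w[ s ])
      ≈⟨ +-congʳ (reflexive (≡.cong (λ G → ι (match G w[ s ])) (≡.trans (≡.cong parse (≡.sym F≡)) (parse-flatten F-valid)))) ⟩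
    ι (match F w[ s ]) + ι (∑match Fs w[ s ])
      ≈⟨ ι-+ (match F w[ s ]) _ ⟨
    ι (match F w[ s ] ℕ.+ ∑match Fs w[ s ]) ∎
    where
    eq? : Fin N → ℕ
    eq? q = ⟦ Listₚ.≡-dec _≟_ (flatten F) w[ q ] ⟧

  stays : Fin N → Fin n → ℕ
  stays r a = ⟦ count (ch a) (body F[ r ]) ℕₚ.≤? off a ⟧

  lowered : Fin N → Fin n → List Shape
  lowered r a = lower (ch a) (off a) F[ r ]

  coefficient : Fin N → Fin N → Fin n → ℕ
  coefficient r q a = stays r a ℕ.* ⟦ r ≟ q ⟧ ℕ.+ occurrences w[ q ] (lowered r a)

  move : Fin n → List (Fin k) → List (Fin k)
  move a v = rm (ch a) (off a) v ++ [ ch a ]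

  lowered-valid : ∀ r a → All (λ G → Valid G × flatten G ↭ flatten F[ r ] × weight G ℕ.< weight F[ r ]) (lowered r a)
  lowered-valid r a = lower-valid (ch a) (off a) (parse-valid w[ r ])

  match-moved : ∀ r s a → ι (match F[ r ] (move a w[ s ])) ≈ ∑ λ q → ι (coefficient r q a) * E q s
  match-moved r s a = begin
    ι (match F[ r ] (move a w[ s ]))
      ≈⟨ reflexive (≡.cong ι (match-move (ch a) (off a) F[ r ] w[ s ] (length-F r s)
           (≡.subst (off a ℕ.<_) (≡.sym (count-↭ (ch a) (w-↭ s))) (offset< ch a)))) ⟩
    ι (stays r a ℕ.* match F[ r ] w[ s ] ℕ.+ ∑match (lowered r a) w[ s ])
      ≈⟨ trans (ι-+ (stays r a ℕ.* match F[ r ] w[ s ]) _) (+-congʳ (×1-homo-* (stays r a) (match F[ r ] w[ s ]))) ⟩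
    ι (stays r a) * E r s + ι (∑match (lowered r a) w[ s ])
      ≈⟨ +-cong diagonal (∑-occurrences s (All.map (λ (G-valid , p , _) →
           G-valid , ↭-trans p (≡.subst (_↭ labels) (≡.sym (flatten-F r)) (w-↭ r))) (lowered-valid r a))) ⟨
    ∑ (λ q → ι (stays r a ℕ.* ⟦ r ≟ q ⟧) * E q s) + ∑ (λ q → ι (occurrences w[ q ] (lowered r a)) * E q s)
      ≈⟨ ∑-distrib-+ (λ q → ι (stays r a ℕ.* ⟦ r ≟ q ⟧) * E q s) _ ⟨
    ∑ (λ q → ι (stays r a ℕ.* ⟦ r ≟ q ⟧) * E q s + ι (occurrences w[ q ] (lowered r a)) * E q s)
      ≈⟨ sum-cong-≋ (λ q → trans (*-congʳ (ι-+ (stays r a ℕ.* ⟦ r ≟ q ⟧) _)) (distribʳ (E q s) _ _)) ⟨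
    ∑ (λ q → ι (coefficient r q a) * E q s) ∎
    where
    diagonal : ∑ (λ q → ι (stays r a ℕ.* ⟦ r ≟ q ⟧) * E q s) ≈ ι (stays r a) * E r s
    diagonal = trans (sum-single r {λ q → ι (stays r a ℕ.* ⟦ r ≟ q ⟧) * E q s} λ q q≢r → trans (*-congʳ (reflexive (≡.cong ι
        (≡.trans (≡.cong (stays r a ℕ.*_) (⟦⟧-no (r ≟ q) (q≢r ∘ ≡.sym))) (ℕₚ.*-zeroʳ (stays r a)))))) (zeroˡ _))
      (*-congʳ (reflexive (≡.cong ι (≡.trans (≡.cong (stays r a ℕ.*_) (⟦⟧-yes (r ≟ r) ≡.refl)) (ℕₚ.*-identityʳ (stays r a))))))

  L : Matrix N
  L r q = ∑ λ a → x a * ι (coefficient r q a)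

  -- The weighted adjacency matrix of the promotion graph. It keeps the loops, which
  -- `transitionMatrix` leaves out.
  W : Matrix N
  W q s = ∑ λ j → if does (∂ P j π[ s ] ≟ʷ π[ q ]) then x (Vec.lookup π[ s ] j) else 0#

  sum-positions : ∀ s (f : Fin n → Carrier) → ∑ (λ j → f (Vec.lookup π[ s ] j)) ≈ ∑ f
  sum-positions s f = sym (sum-permute f (Perm.permutation (Vec.lookup π[ s ]) position lookup-position position-lookup))
    where
    splits : ∀ a → ∃ λ j → Vec.lookup π[ s ] j ≡ a
    splits a with ∈ₚ.∈-∃++ (le⇒complete (le s) a)
    ... | l , _ , eq with lookup-split π[ s ] l eq
    ...   | j , eq′ , _ = j , eq′
    position : Fin n → Fin n
    position a = proj₁ (splits a)
    lookup-position : ∀ a → Vec.lookup π[ s ] (position a) ≡ a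
    lookup-position a = proj₂ (splits a)
    position-lookup : ∀ j → position (Vec.lookup π[ s ] j) ≡ j
    position-lookup j = VecUnique.lookup-injective (proj₁ (le s)) _ _ (lookup-position (Vec.lookup π[ s ] j))

  -- For fixed `s` and `j` only the target of the edge contributes. Its match depends on the moved
  -- label alone, so the sum over positions becomes a sum over labels.
  E*W≈L*E : ∀ r s → (E *ᴹ W) r s ≈ (L *ᴹ E) r s
  E*W≈L*E r s = begin
    ∑ (λ q → E r q * W q s)
      ≈⟨ sum-cong-≋ (λ q → *-distribˡ-sum (E r q) (edge q)) ⟩
    ∑ (λ q → ∑ (λ j → E r q * edge q j))
      ≈⟨ ∑-comm (λ q j → E r q * edge q j) ⟩
    ∑ (λ j → ∑ (λ q → E r q * edge q j))
      ≈⟨ sum-cong-≋ target ⟩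
    ∑ (λ j → f (Vec.lookup π[ s ] j))
      ≈⟨ sum-positions s f ⟩
    ∑ f
      ≈⟨ sum-cong-≋ (λ a → trans (*-congˡ (match-moved r s a)) (*-distribˡ-sum (x a) (λ q → ι (coefficient r q a) * E q s))) ⟩
    ∑ (λ a → ∑ (λ q → x a * (ι (coefficient r q a) * E q s)))
      ≈⟨ ∑-comm (λ a q → x a * (ι (coefficient r q a) * E q s)) ⟩
    ∑ (λ q → ∑ (λ a → x a * (ι (coefficient r q a) * E q s)))
      ≈⟨ sum-cong-≋ (λ q → trans (*-distribʳ-sum (E q s) (λ a → x a * ι (coefficient r q a))) (sum-cong-≋ λ a → *-assoc (x a) _ _)) ⟨
    ∑ (λ q → L r q * E q s) ∎
    where
    edge : Fin N → Fin n → Carrier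
    edge q j = if does (∂ P j π[ s ] ≟ʷ π[ q ]) then x (Vec.lookup π[ s ] j) else 0#
    f : Fin n → Carrier
    f a = x a * ι (match F[ r ] (move a w[ s ]))
    target : ∀ j → ∑ (λ q → E r q * edge q j) ≈ f (Vec.lookup π[ s ] j)
    target j with π-surjective (∂-linearExtension j (le s))
    ... | q₀ , ∂≡ = begin
      ∑ (λ q → E r q * edge q j)
        ≈⟨ sum-single q₀ {λ q → E r q * edge q j} (λ q q≢ → trans (*-congˡ (reflexive (if-no (∂ P j π[ s ] ≟ʷ π[ q ])
             λ ∂≡q → q≢ (π-injective {q} {q₀} (≡.trans (≡.sym ∂≡q) ∂≡))))) (zeroʳ _)) ⟩
      E r q₀ * edge q₀ j
        ≈⟨ *-cong (reflexive (≡.cong (λ v → ι (match F[ r ] v)) (≡.trans (≡.cong letters (≡.sym ∂≡)) (∂-letters-rm j (le s)))))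
             (reflexive (if-yes (∂ P j π[ s ] ≟ʷ π[ q₀ ]) ∂≡)) ⟩
      ι (match F[ r ] (move (Vec.lookup π[ s ] j) w[ s ])) * x (Vec.lookup π[ s ] j)
        ≈⟨ *-comm _ _ ⟩
      f (Vec.lookup π[ s ] j) ∎

  z : Carrier
  z = t + ∑ x

  A : Matrix N
  A = scalar t -ᴹ transitionMatrix P x

  T : Matrix N
  T r q = z * 1ᴹ r q - L r q

  cancel-minus : ∀ a b → a - b + b ≈ a
  cancel-minus a b = trans (+-assoc a (- b) b) (trans (+-congˡ (-‿inverseˡ b)) (+-identityʳ a))

  -- Off the diagonal the edges cancel. On it, the proper edges from `A` and the loops from `W`
  -- together make up the total weight leaving a vertex, which is `∑ x` everywhere.
  A+W : ∀ q s → A q s + W q s ≈ z * 1ᴹ q s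
  A+W q s with q ≟ s
  ... | no q≢s = begin
    0# - transitionMatrix P x q s + W q s ≈⟨ +-congʳ (+-congˡ (-‿cong (reflexive (if-no (π[ q ] ≟ʷ π[ s ]) (q≢s ∘ π-injective {q} {s}))))) ⟩
    0# - W q s + W q s                    ≈⟨ cancel-minus 0# (W q s) ⟩
    0#                                    ≈⟨ zeroʳ z ⟨
    z * 0#                                ∎
  ... | yes ≡.refl = begin
    t - transitionMatrix P x q q + W q q ≈⟨ +-congʳ (+-congˡ (-‿cong (reflexive (if-yes (π[ q ] ≟ʷ π[ q ]) ≡.refl)))) ⟩
    t - - ∑ V + W q q                    ≈⟨ +-congʳ (+-congˡ (-‿involutive (∑ V))) ⟩
    t + ∑ V + W q q                      ≈⟨ +-assoc t _ _ ⟩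
    t + (∑ V + W q q)                    ≈⟨ +-congˡ (∑-distrib-+ V _) ⟨
    t + ∑ (λ j → V j + edge j)           ≈⟨ +-congˡ (sum-cong-≋ λ j → complementary (∂ P j π[ q ] ≟ʷ π[ q ]) (x (Vec.lookup π[ q ] j))) ⟩
    t + ∑ (λ j → x (Vec.lookup π[ q ] j)) ≈⟨ +-congˡ (sum-positions q x) ⟩
    z                                    ≈⟨ *-identityʳ z ⟨
    z * 1#                               ∎
    where
    V edge : Fin n → Carrier
    V j = if does (∂ P j π[ q ] ≟ʷ π[ q ]) then 0# else x (Vec.lookup π[ q ] j)
    edge j = if does (∂ P j π[ q ] ≟ʷ π[ q ]) then x (Vec.lookup π[ q ] j) else 0#
    complementary : ∀ {p} {P : Set p} (P? : Dec P) y → (if does P? then 0# else y) + (if does P? then y else 0#) ≈ y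
    complementary (yes _) y = +-identityˡ y
    complementary (no _)  y = +-identityʳ y

  E*A≈T*E : ∀ r s → (E *ᴹ A) r s ≈ (T *ᴹ E) r s
  -- With `E *ᴹ W` added, which equals `L *ᴹ E`, both sides become `z * E r s`.
  E*A≈T*E r s = +-cancelʳ ((E *ᴹ W) r s) _ _ (begin
    (E *ᴹ A) r s + (E *ᴹ W) r s
      ≈⟨ ∑-distrib-+ (λ q → E r q * A q s) _ ⟨
    ∑ (λ q → E r q * A q s + E r q * W q s)
      ≈⟨ sum-cong-≋ (λ q → trans (sym (distribˡ (E r q) _ _)) (*-congˡ (A+W q s))) ⟩
    ∑ (λ q → E r q * (z * 1ᴹ q s))
      ≈⟨ trans (sum-single s {λ q → E r q * (z * 1ᴹ q s)} λ q q≢s → trans (*-congˡ (trans (*-congˡ (1ᴹ-off-diagonal q≢s)) (zeroʳ z))) (zeroʳ _))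
           (trans (*-congˡ (trans (*-congˡ (1ᴹ-diagonal s)) (*-identityʳ z))) (*-comm _ _)) ⟩
    z * E r s
      ≈⟨ trans (sum-single r {λ q → (z * 1ᴹ r q) * E q s} λ q q≢r → trans (*-congʳ (trans (*-congˡ (1ᴹ-off-diagonal (q≢r ∘ ≡.sym))) (zeroʳ z))) (zeroˡ _))
           (*-congʳ (trans (*-congˡ (1ᴹ-diagonal r)) (*-identityʳ z))) ⟨
    ∑ (λ q → (z * 1ᴹ r q) * E q s)
      ≈⟨ sum-cong-≋ (λ q → trans (sym (distribʳ (E q s) _ _)) (*-congʳ (cancel-minus (z * 1ᴹ r q) (L r q)))) ⟨
    ∑ (λ q → T r q * E q s + L r q * E q s)
      ≈⟨ ∑-distrib-+ (λ q → T r q * E q s) _ ⟩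
    (T *ᴹ E) r s + (L *ᴹ E) r s
      ≈⟨ +-congˡ (E*W≈L*E r s) ⟨
    (T *ᴹ E) r s + (E *ᴹ W) r s ∎)

  occurrences-above : ∀ r q a → ¬ weight F[ q ] ℕ.< weight F[ r ] → occurrences w[ q ] (lowered r a) ≡ 0
  occurrences-above r q a ≮ = occurrences-none (All.map distinct (lowered-valid r a))
    where
    distinct : ∀ {G} → Valid G × flatten G ↭ flatten F[ r ] × weight G ℕ.< weight F[ r ] → flatten G ≢ w[ q ]
    distinct (G-valid , _ , lt) eq = ≮ (≡.subst (λ G → weight G ℕ.< weight F[ r ]) (≡.trans (≡.sym (parse-flatten G-valid)) (≡.cong parse eq)) lt)

  eigenvalue : Fin N → Carrier
  eigenvalue r = t + subsetSum x (lowerSet π[ r ])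

  T-off-diagonal : ∀ r q → r ≢ q → ¬ weight F[ q ] ℕ.< weight F[ r ] → T r q ≈ 0#
  T-off-diagonal r q r≢q ≮ = begin
    z * 1ᴹ r q - L r q ≈⟨ +-cong (trans (*-congˡ (1ᴹ-off-diagonal r≢q)) (zeroʳ z)) (-‿cong (sum-zero λ a → trans (*-congˡ (reflexive (≡.cong ι
        (≡.cong₂ ℕ._+_ (≡.trans (≡.cong (stays r a ℕ.*_) (⟦⟧-no (r ≟ q) r≢q)) (ℕₚ.*-zeroʳ (stays r a))) (occurrences-above r q a ≮))))) (zeroʳ (x a)))) ⟩
    0# - 0#            ≈⟨ -‿inverseʳ 0# ⟩
    0#                 ∎

  -- On the diagonal, `L` collects the weights of the labels in the last part; subtracted from `z`,
  -- they leave those of the lower set.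
  T-diagonal : ∀ r → T r r ≈ eigenvalue r
  T-diagonal r = +-cancelʳ (L r r) _ _ (begin
    T r r + L r r
      ≈⟨ cancel-minus (z * 1ᴹ r r) (L r r) ⟩
    z * 1ᴹ r r
      ≈⟨ trans (*-congˡ (1ᴹ-diagonal r)) (*-identityʳ z) ⟩
    t + ∑ x
      ≈⟨ +-congˡ (sum-cong-≋ split) ⟩
    t + ∑ (λ a → chosen a + x a * ι (coefficient r r a))
      ≈⟨ +-congˡ (∑-distrib-+ chosen _) ⟩
    t + (∑ chosen + L r r)
      ≈⟨ +-assoc t _ _ ⟨
    eigenvalue r + L r r ∎)
    where
    S = lowerSet π[ r ]
    chosen : Fin n → Carrier
    chosen a = if does (a Subsetₚ.∈? S) then x a else 0#
    coefficient≡stays : ∀ a → coefficient r r a ≡ stays r a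
    coefficient≡stays a = ≡.trans (≡.cong₂ ℕ._+_ (≡.trans (≡.cong (stays r a ℕ.*_) (⟦⟧-yes (r ≟ r) ≡.refl)) (ℕₚ.*-identityʳ (stays r a)))
      (occurrences-above r r a (ℕₚ.<-irrefl ≡.refl))) (ℕₚ.+-identityʳ (stays r a))
    split : ∀ a → x a ≈ chosen a + x a * ι (coefficient r r a)
    split a = trans (by-cases (a Subsetₚ.∈? S)) (+-congˡ (*-congˡ (reflexive (≡.cong ι (≡.sym (coefficient≡stays a))))))
      where
      by-cases : (a∈? : Dec (a ∈ˢ S)) → x a ≈ (if does a∈? then x a else 0#) + x a * ι (stays r a)
      by-cases (yes a∈) = sym (trans (+-congˡ (trans (*-congˡ (reflexive (≡.cong ι (⟦⟧-no (count (ch a) (body F[ r ]) ℕₚ.≤? off a)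
        (ℕₚ.<⇒≱ (∈-lowerSet⁻ π[ r ] a∈)))))) (zeroʳ (x a)))) (+-identityʳ (x a)))
      by-cases (no a∉) = sym (trans (+-identityˡ _) (trans (*-congˡ (trans (reflexive (≡.cong ι (⟦⟧-yes (count (ch a) (body F[ r ]) ℕₚ.≤? off a)
        (ℕₚ.≮⇒≥ (a∉ ∘ ∈-lowerSet⁺ π[ r ]))))) ι-1)) (*-identityʳ (x a))))

  det-A≈∏ᶠ : det A ≈ ∏ᶠ eigenvalue
  det-A≈∏ᶠ = begin
    det A           ≈⟨ *-identityˡ _ ⟨
    1# * det A      ≈⟨ *-congʳ det-E ⟨
    det E * det A   ≈⟨ det-* E A ⟨
    det (E *ᴹ A)    ≈⟨ det-cong E*A≈T*E ⟩
    det (T *ᴹ E)    ≈⟨ det-* T E ⟩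
    det T * det E   ≈⟨ *-congˡ det-E ⟩
    det T * 1#      ≈⟨ *-identityʳ _ ⟩
    det T           ≈⟨ det-triangular (λ r → weight F[ r ]) T T-off-diagonal ⟩
    ∏ᶠ (λ r → T r r) ≈⟨ ∏ᶠ-cong T-diagonal ⟩
    ∏ᶠ eigenvalue   ∎

  open LabelledPoset P using (isLower?; IsLower)

  private
    ls : List (Subset n)
    ls = nonemptyLowerSets P
    nonemptyLower? = λ (S : Subset n) → Subsetₚ.nonempty? S ×-dec isLower? S
    subsets : List (Subset n)
    subsets = allVecs (inside ∷ outside ∷ []) n

  -- The empty set is listed separately, as it provides the factor `t` in front of the product.
  ∈-lowerSets : ∀ {S} → IsLower S → S ∈ ⊥ ∷ ls
  ∈-lowerSets {S} S-lower with Subsetₚ.nonempty? S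
  ... | no  ¬∃x = here (Subsetₚ.Empty-unique ¬∃x)
  ... | yes ∃x  = there (∈ₚ.∈-filter⁺ nonemptyLower? (∈-allVecs (λ { inside → here ≡.refl ; outside → there (here ≡.refl) }) S) (∃x , S-lower))

  lowerSets-lower : ∀ {S} → S ∈ ⊥ ∷ ls → IsLower S
  lowerSets-lower (here ≡.refl) x y x∈⊥ _ = contradiction x∈⊥ Subsetₚ.∉⊥
  lowerSets-lower (there S∈)              = proj₂ (proj₂ (∈ₚ.∈-filter⁻ nonemptyLower? {xs = subsets} S∈))

  lowerSets-unique : Unique (⊥ ∷ ls)
  lowerSets-unique = All.tabulate (λ S∈ → λ { ≡.refl → Subsetₚ.∉⊥ (proj₂ (proj₁ (proj₂ (∈ₚ.∈-filter⁻ nonemptyLower? {xs = subsets} S∈)))) })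
    ∷ Uniqueₚ.filter⁺ nonemptyLower? (allVecs-unique (((λ ()) ∷ []) ∷ [] ∷ []) n)

  -- The empty word is the only candidate and has no position to be fixed. The size is a variable
  -- because the cardinality of `⊥` is zero only up to a proof.
  #posetDerangements-empty : ∀ {m} (Q : LabelledPoset m) → m ≡ 0 → #posetDerangements Q ≡ 1
  #posetDerangements-empty Q ≡.refl = ≡.refl

  det-factorises : det A ≈ t * ∏[ ls ] (λ S → (t + subsetSum x S) ^ #posetDerangements (P ∣ₚ S))
  det-factorises = begin
    det A
      ≈⟨ det-A≈∏ᶠ ⟩
    ∏ᶠ eigenvalue
      ≈⟨ ∏ᶠ-lookup (g ∘ lowerSet) les ⟩
    ∏[ les ] (g ∘ lowerSet)
      ≈⟨ ∏-group (Vecₚ.≡-dec Boolₚ._≟_) g lowerSet les (⊥ ∷ ls) lowerSets-unique (λ {π} _ → ∈-lowerSets (lowerSet-isLower π)) ⟩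
    ∏[ ⊥ ∷ ls ] (λ S → g S ^ length (filter (λ π → Vecₚ.≡-dec Boolₚ._≟_ (lowerSet π) S) les))
      ≈⟨ ∏-cong (⊥ ∷ ls) (λ {S} S∈ → reflexive (≡.cong (g S ^_)
           (#lowerSet≡#posetDerangements S (lowerSets-lower S∈)))) ⟩
    g ⊥ ^ #posetDerangements (P ∣ₚ ⊥) * ∏[ ls ] (λ S → g S ^ #posetDerangements (P ∣ₚ S))
      ≈⟨ *-congʳ (trans (reflexive (≡.cong (g ⊥ ^_) (#posetDerangements-empty (P ∣ₚ ⊥) (Subsetₚ.∣⊥∣≡0 n)))) (trans (*-identityʳ (g ⊥)) g-⊥)) ⟩
    t * ∏[ ls ] (λ S → g S ^ #posetDerangements (P ∣ₚ S)) ∎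
    where
    g : Subset n → Carrier
    g S = t + subsetSum x S
    g-⊥ : g ⊥ ≈ t
    g-⊥ = trans (+-congˡ (sum-zero λ i → reflexive (if-no {x = x i} (i Subsetₚ.∈? (⊥ {n})) Subsetₚ.∉⊥))) (+-identityʳ t)

-- Unions of chains labelled consecutively.

chainOf-mono : ∀ {k} (ns : Vec ℕ k) → Labelling.Monotone k (chainOf ns)
chainOf-mono (m ∷ ns) {i} {j} i≤j with splitAt m i in eqᵢ | splitAt m j in eqⱼ
... | inj₁ _ | _      = z≤n
... | inj₂ p | inj₂ q = s≤s (chainOf-mono ns (ℕₚ.+-cancelˡ-≤ m _ _ (≡.subst₂ ℕ._≤_ (position p eqᵢ) (position q eqⱼ) i≤j)))
  where
  position : ∀ {i} p → splitAt m i ≡ inj₂ p → toℕ i ≡ m ℕ.+ toℕ p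
  position p eq = ≡.trans (≡.cong toℕ (≡.sym (Finₚ.splitAt⁻¹-↑ʳ eq))) (Finₚ.toℕ-↑ʳ m p)
... | inj₂ p | inj₁ q = contradiction i≤j (ℕₚ.<⇒≱ (≡.subst₂ ℕ._<_
    (≡.trans (≡.sym (Finₚ.toℕ-↑ˡ q _)) (≡.cong toℕ (Finₚ.splitAt⁻¹-↑ˡ eqⱼ)))
    (≡.trans (≡.sym (Finₚ.toℕ-↑ʳ m p)) (≡.cong toℕ (Finₚ.splitAt⁻¹-↑ʳ eqᵢ)))
    (ℕₚ.<-≤-trans (toℕ<n q) (ℕₚ.m≤m+n m (toℕ p)))))

theorem5p4 : ∀ {c ℓ} (R : CommutativeRing c ℓ) →
    let open CommutativeRing R
        open OverRing R
    in
    ∀ {k} (ns : Vec ℕ k) (t : Carrier) (x : Fin (sum ns) → Carrier) →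
    let P = chains ns in
    det (scalar t -ᴹ transitionMatrix P x)
      ≈ t * ∏[ nonemptyLowerSets P ] (λ S → (t + subsetSum x S) ^ #posetDerangements (P ∣ₚ S))
theorem5p4 R ns t x = Assembly.det-factorises R (chainOf ns) (chains ns) (λ p → p) _,_ (chainOf-mono ns) t x
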